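{- For integers $d,k$ with $2\le k\le d-1$ we have $$\underline{sa}_d^s(d+k) = \Theta\left((d-k)d\right).$$ Moreover, the quotient $U(d,k)/L(d,k)$ of the upper estimate $$U(d,k):=\begin{cases}\dfrac{d(d+1)}{2}+k-1, & 2\le k\le\lfloor (2d-2)/3\rfloor,\\[2mm] k+\dfrac{(d-k)(d+3k-1)}{2}, & \lceil (2d-2)/3\rceil\le k\le d-1,\end{cases}$$ of $\underline{sa}_d^s(d+k)$ and of the lower estimate $$L(d,k):=\frac{d^2-k^2+d+k}{2}$$ of $\underline{sa}_d^s(d+k)$ is at most $2$, and this value $2$ is sharp (it cannot be replaced by any smaller constant valid for all such $d,k$).
   Context: Let $X=\{x_1,\dots,x_n\}\subset\mathbb{R}^d$ be a finite set (with $x_i\neq x_j$ for $i\ne j$) whose affine hull is $\mathbb{R}^d$, and let $P=\operatorname{conv}X$. Two distinct points $x_i,x_j\in X$ are strictly antipodal (in $X$) if there are different parallel supporting hyperplanes $H',H''$ of $P$ with $X\cap H'=\{x_i\}$ and $X\cap H''=\{x_j\}$. $sa(X)$ is the number of (unordered) strictly antipodal pairs of $X$. $X$ is in strictly convex position if $X=\operatorname{vert}P$ (the vertex set of $P$). $\mathcal{C}_d^s(n)$ is the family of all $X\subset\mathbb{R}^d$ with $|X|=n$, $\operatorname{aff}X=\mathbb{R}^d$, $X$ in strictly convex position, and $\underline{sa}_d^s(n):=\min\{sa(X)\mid X\in\mathcal{C}_d^s(n)\}$. The $\Theta(\cdot)$ relation means two-sided bounds with positive absolute constants, over the stated range of $d,k$.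 If $(2d-2)/3$ is an integer, both lines in the definition of $U(d,k)$ give the same value at $k=(2d-2)/3$. -}

module Defs where

open import Level using (0ℓ)
open import Algebra.Bundles using (CommutativeRing)
import Algebra.Properties.Semiring.Mult as Mult
import Algebra.Properties.Semiring.Sum as Sum
open import Axiom.ExcludedMiddle using (ExcludedMiddle)
open import Data.Bool.Base using (if_then_else_)
open import Data.Fin.Base as Fin using (Fin)
open import Data.List.Base using (length; filter; cartesianProduct; allFin)
open import Data.Nat.Base as ℕ using (ℕ)
import Data.Nat.DivMod as ℕ
open import Data.Product.Base using (_×_; _,_; ∃; ∃-syntax)
open import Data.Sum.Base using (_⊎_)
open import Data.Vec.Functional using (Vector)
open import Data.Vec.Functional.Relation.Binary.Pointwise using (Pointwise)
open import Relation.Binary.Core using (Rel)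
open import Relation.Binary.Structures using (IsTotalOrder)
import Relation.Binary.Construct.NonStrictToStrict as ToStrict
open import Relation.Binary.PropositionalEquality.Core using (_≡_; _≢_)
open import Relation.Nullary.Negation.Core using (¬_)
open import Relation.Unary using (Pred; _∈_; _∩_; _≐_)

-- The real numbers, given (uniquely up to isomorphism) by the axioms of a
-- Dedekind-complete ordered field.  Field inversion is a total operation;
-- its value at 0# is unspecified.
record Reals : Set₁ where
  infix  4 _≤_
  infix  8 _⁻¹
  field
    commutativeRing : CommutativeRing 0ℓ 0ℓ
  open CommutativeRing commutativeRing public
  field
    _≤_          : Rel Carrier 0ℓ
    isTotalOrder : IsTotalOrder _≈_ _≤_
    +-monoˡ-≤    : ∀ {x y} z → x ≤ y → x + z ≤ y + z
    *-nonNeg     : ∀ {x y} → 0# ≤ x → 0# ≤ y → 0# ≤ x * y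
    1≉0          : 1# ≉ 0#
    _⁻¹          : Carrier → Carrier
    *-inverseʳ   : ∀ {x} → x ≉ 0# → x * x ⁻¹ ≈ 1#

  IsUpperBound : Pred Carrier 0ℓ → Pred Carrier 0ℓ
  IsUpperBound S b = ∀ x → x ∈ S → x ≤ b

  field
    supremum : ∀ (S : Pred Carrier 0ℓ) → ∃ S → ∃ (IsUpperBound S) →
               ∃[ s ] (IsUpperBound S s × (∀ b → IsUpperBound S b → s ≤ b))

  open ToStrict _≈_ _≤_ public using (_<_)
  open Sum semiring public using (sum)

  infixl 7 _/_
  _/_ : Carrier → Carrier → Carrier
  x / y = x * y ⁻¹

  fromℕ : ℕ → Carrier
  fromℕ n = Mult._×_ semiring n 1#

IsMinimum : Pred ℕ 0ℓ → ℕ → Set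
IsMinimum S m = m ∈ S × (∀ n → n ∈ S → m ℕ.≤ n)

module Estimates (ℝ : Reals) where
  open Reals ℝ

  -- On 2 ≤ k ≤ d - 1, failing k ≤ ⌊(2d-2)/3⌋ implies ⌈(2d-2)/3⌉ ≤ k.
  U : ℕ → ℕ → Carrier
  U d k = if k ℕ.≤ᵇ (2 ℕ.* d ℕ.∸ 2) ℕ./ 3
          then d′ * (d′ + 1#) / fromℕ 2 + k′ - 1#
          else k′ + (d′ - k′) * (d′ + fromℕ 3 * k′ - 1#) / fromℕ 2
    where
    d′ = fromℕ d
    k′ = fromℕ k

  L : ℕ → ℕ → Carrier
  L d k = (d′ * d′ - k′ * k′ + d′ + k′) / fromℕ 2
    where
    d′ = fromℕ d
    k′ = fromℕ k

module Geometry (ℝ : Reals) where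
  open Reals ℝ

  Point : ℕ → Set
  Point d = Vector Carrier d

  infix 4 _≋_
  _≋_ : ∀ {d} → Rel (Point d) 0ℓ
  _≋_ = Pointwise _≈_

  singleton : ∀ {d} → Point d → Pred (Point d) 0ℓ
  singleton x p = p ≋ x

  infix 8 _·_
  _·_ : ∀ {d} → Point d → Point d → Carrier
  u · p = sum (λ i → u i * p i)

  combination : ∀ {n d} → Vector Carrier n → Vector (Point d) n → Point d
  combination c X j = sum (λ i → c i * X i j)

  -- A set of n points is given by an enumeration X : Vector (Point d) n,
  -- required to be Distinct below.
  points : ∀ {n d} → Vector (Point d) n → Pred (Point d) 0ℓ
  points X p = ∃[ i ] p ≋ X i

  Distinct : ∀ {n d} → Vector (Point d) n → Set
  Distinct X = ∀ i j → i ≢ j → ¬ (X i ≋ X j)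

  aff : ∀ {n d} → Vector (Point d) n → Pred (Point d) 0ℓ
  aff X p = ∃[ c ] (sum c ≈ 1# × p ≋ combination c X)

  conv : ∀ {n d} → Vector (Point d) n → Pred (Point d) 0ℓ
  conv X p = ∃[ c ] ((∀ i → 0# ≤ c i) × sum c ≈ 1# × p ≋ combination c X)

  record Hyperplane (d : ℕ) : Set where
    field
      normal   : Point d
      offset   : Carrier
      normal≉0 : ¬ (∀ i → normal i ≈ 0#)

  open Hyperplane

  ⟦_⟧ : ∀ {d} → Hyperplane d → Pred (Point d) 0ℓ
  ⟦ H ⟧ p = normal H · p ≈ offset H

  Parallel : ∀ {d} → Rel (Hyperplane d) 0ℓ
  Parallel H H′ = ∃[ t ] (t ≉ 0# × (∀ i → normal H′ i ≈ t * normal H i))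

  Supports : ∀ {d} → Hyperplane d → Pred (Point d) 0ℓ → Set
  Supports H P = ∃ (P ∩ ⟦ H ⟧) ×
    ((∀ p → p ∈ P → normal H · p ≤ offset H) ⊎
     (∀ p → p ∈ P → offset H ≤ normal H · p))

  -- Vertices of a polytope, as its 0-dimensional faces.
  vert : ∀ {d} → Pred (Point d) 0ℓ → Pred (Point d) 0ℓ
  vert P v = ∃[ H ] (Supports H P × P ∩ ⟦ H ⟧ ≐ singleton v)

  StrictlyAntipodal : ∀ {n d} → Vector (Point d) n → Rel (Fin n) 0ℓ
  StrictlyAntipodal X i j = i ≢ j ×
    ∃[ H ] ∃[ H′ ] (Supports H (conv X) × Supports H′ (conv X)
      × Parallel H H′ × ¬ (⟦ H ⟧ ≐ ⟦ H′ ⟧)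
      × points X ∩ ⟦ H ⟧  ≐ singleton (X i)
      × points X ∩ ⟦ H′ ⟧ ≐ singleton (X j))

  record 𝓒ˢ (d n : ℕ) : Set where
    field
      X              : Vector (Point d) n
      distinct       : Distinct X
      fullDim        : ∀ p → p ∈ aff X
      strictlyConvex : points X ≐ vert (conv X)

  -- Excluded middle makes strict antipodality decidable, so that the pairs
  -- can be counted; i < j selects each unordered pair once.
  sa : ExcludedMiddle 0ℓ → ∀ {n d} → Vector (Point d) n → ℕ
  sa lem {n} X =
    length (filter (λ (i , j) → lem {i Fin.< j × StrictlyAntipodal X i j})
                   (cartesianProduct (allFin n) (allFin n)))

  saValues : ExcludedMiddle 0ℓ → (d n : ℕ) → Pred ℕ 0ℓ
  saValues lem d n m = ∃[ C ] sa lem (𝓒ˢ.X {d} {n} C) ≡ m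

{-# OPTIONS --safe #-}
module Submission where

-- The lower estimate.  Call a pair of points good if some linear functional
-- is strictly minimal at one and strictly maximal at the other.  We show that
-- n points of affine rank d have at least n (2d + 1 - n) / 2 good pairs, by
-- induction on d: contract any good pair x, y, i.e. keep the functionals with
-- equal values at x and y, and those points that remain vertices.  By
-- genericity a good pair of the contraction lifts to a good pair of the given
-- points.  The good pairs that are lost contain x or y, and their number is
-- estimated by moving a functional with minimum at x and maximum at y along a
-- generic direction until the minimum or the maximum ceases to be strict: this
-- exhibits a good partner of x or y, unless both events are tied, and tied
-- points contribute only half to the rank.
--
-- The upper estimates come from a simplex with points stacked on some of its
-- facets, and from the join of a cross-polytope and a simplex.

open import Defs
open import Level using (0ℓ)
import Algebra.Properties.Ring as RingProperties
import Algebra.Properties.Semiring.Mult as Mult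
import Algebra.Properties.Semiring.Sum as Sum
import Algebra.Solver.Ring as RingSolver
open import Algebra.Solver.Ring.AlmostCommutativeRing
  using (_-Raw-AlmostCommutative⟶_; fromCommutativeRing)
open import Axiom.ExcludedMiddle using (ExcludedMiddle)
open import Data.Bool.Base using (true; false; if_then_else_; T)
open import Data.Empty using (⊥; ⊥-elim)
open import Data.Fin.Base as Fin using (Fin; zero; suc; _↑ˡ_; _↑ʳ_)
import Data.Fin.Properties as Fin
open import Data.Integer.Base as ℤ using (ℤ; +_; -[1+_]; _⊖_)
import Data.Integer.Properties as ℤ
open import Data.List.Base using (List; []; _∷_; _++_; length; filter; map; cartesianProduct; allFin)
import Data.List.Properties as List
open import Data.List.Membership.Propositional using (_∈_; _∉_)
open import Data.List.Membership.Propositional.Properties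
  using (∈-∃++; ∈-++⁻; ∈-++⁺ˡ; ∈-++⁺ʳ; ∈-filter⁺; ∈-filter⁻; ∈-cartesianProduct⁺; ∈-cartesianProduct⁻
        ; ∈-map⁺; ∈-map⁻; ∈-allFin)
open import Data.List.Relation.Unary.All as All using (All; []; _∷_)
open import Data.List.Relation.Unary.AllPairs as AllPairs using (AllPairs; []; _∷_)
import Data.List.Relation.Unary.AllPairs.Properties as AllPairs
open import Data.List.Relation.Unary.Any using (here; there)
open import Data.List.Relation.Unary.Unique.Propositional using (Unique)
import Data.List.Relation.Unary.Unique.Propositional.Properties as Unique
open import Data.Maybe.Base using (just; nothing)
open import Data.Nat.Base as ℕ using (ℕ; zero; suc; z≤n; s≤s)
import Data.Nat.DivMod as ℕ
import Data.Nat.Properties as ℕ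
import Data.Nat.Tactic.RingSolver as ℕSolver
open import Data.Product.Base using (_×_; _,_; ∃; ∃-syntax; proj₁; proj₂)
open import Data.Sum.Base using (_⊎_; inj₁; inj₂; [_,_]′)
open import Data.Vec.Functional using (Vector) renaming (_++_ to _++ᵛ_)
open import Function.Base using (_∘_; id; case_of_)
open import Relation.Binary.Core using (Rel)
import Relation.Binary.Definitions as B
open import Relation.Binary.PropositionalEquality.Core as ≡ using (_≡_; _≢_; refl)
import Relation.Binary.Reasoning.Setoid as SetoidReasoning
open import Relation.Binary.Structures using (IsTotalOrder)
open import Relation.Nullary.Decidable.Core using (Dec; yes; no)
open import Relation.Nullary.Negation.Core using (¬_; contradiction)
open import Relation.Unary using (Pred; Decidable; _≐_; _∩_) renaming (_∈_ to _∈′_)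

-- Put `s = 2d + 1 - n`, so that twice the claimed number of good pairs is `n s`. When `d` drops by
-- one, this product can change in two ways. If the contracted point remains a vertex, `n` and `s`
-- both drop by one and `d + 1` extra pairs are needed. Ties are then impossible, since they would
-- put a vertex between two other points; the obstacle is that pairs at the contracted vertex are
-- lost as well. They are paid for because each partner of that vertex is seen twice, from `x` and
-- from `y`. If the contracted point is not a vertex, `x` and `y` both disappear, so `n` drops by
-- two while `s` stays, and `s` extra pairs are needed; counting tied points by half yields exactly
-- that many. Further vertices may vanish under contraction, so the induction carries only an upper
-- bound for the number of points. The constant 2 is approached by the cross-polytope estimate. With
-- `e = d - k`, twice the upper estimate is `4ek + 2k + e^2 - e` and twice the lower one is
-- `2ek + 2k + e^2 + e`; the products `ek` dominate when `e` is large and `k` is much larger than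
-- `e`.

-- Ordered field arithmetic, with a ring solver over integer coefficients.

module OrderedField (lem : ExcludedMiddle 0ℓ) (ℝ : Reals) where
  open Reals ℝ hiding (zero) renaming (refl to ≈-refl)
  open IsTotalOrder isTotalOrder public
    using () renaming (refl to ≤-refl; trans to ≤-trans; antisym to ≤-antisym; total to ≤-total; reflexive to ≤-reflexive)
  open RingProperties ring public
    using (-‿involutive; -0#≈0#; -‿distribˡ-*; -‿+-comm)
  private module M = Mult semiring

  fromℤ : ℤ → Carrier
  fromℤ (+ n)      = fromℕ n
  fromℤ (-[1+ n ]) = - fromℕ (suc n)

  fromℕ-+ : ∀ m n → fromℕ (m ℕ.+ n) ≈ fromℕ m + fromℕ n
  fromℕ-+ = M.×-homo-+ 1#

  fromℕ-* : ∀ m n → fromℕ (m ℕ.* n) ≈ fromℕ m * fromℕ n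
  fromℕ-* = M.×1-homo-*

  private
    open SetoidReasoning setoid

    fromℤ-⊖ : ∀ m n → fromℤ (m ⊖ n) ≈ fromℕ m + - fromℕ n
    fromℤ-⊖ zero zero = sym (-‿inverseʳ 0#)
    fromℤ-⊖ zero (suc n) = sym (+-identityˡ _)
    fromℤ-⊖ (suc m) zero = sym (trans (+-congˡ -0#≈0#) (+-identityʳ _))
    fromℤ-⊖ (suc m) (suc n) = begin
      fromℤ (suc m ⊖ suc n)                    ≡⟨ ≡.cong fromℤ (ℤ.[1+m]⊖[1+n]≡m⊖n m n) ⟩
      fromℤ (m ⊖ n)                            ≈⟨ fromℤ-⊖ m n ⟩
      fromℕ m + - fromℕ n                      ≈⟨ +-congˡ (+-identityˡ _) ⟨
      fromℕ m + (0# + - fromℕ n)               ≈⟨ +-congˡ (+-congʳ (-‿inverseʳ 1#)) ⟨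
      fromℕ m + ((1# + - 1#) + - fromℕ n)      ≈⟨ +-congˡ (+-assoc _ _ _) ⟩
      fromℕ m + (1# + (- 1# + - fromℕ n))      ≈⟨ +-assoc _ _ _ ⟨
      (fromℕ m + 1#) + (- 1# + - fromℕ n)      ≈⟨ +-cong (+-comm _ _) (-‿+-comm _ _) ⟩
      fromℕ (suc m) + - fromℕ (suc n)          ∎

    fromℤ-neg : ∀ i → fromℤ (ℤ.- i) ≈ - fromℤ i
    fromℤ-neg (+ zero)   = sym -0#≈0#
    fromℤ-neg (+ suc n)  = ≈-refl
    fromℤ-neg -[1+ n ]   = sym (-‿involutive _)

    fromℤ-+ : ∀ i j → fromℤ (i ℤ.+ j) ≈ fromℤ i + fromℤ j
    fromℤ-+ (+ m)    (+ n)    = fromℕ-+ m n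
    fromℤ-+ (+ m)    -[1+ n ] = fromℤ-⊖ m (suc n)
    fromℤ-+ -[1+ m ] (+ n)    = trans (fromℤ-⊖ n (suc m)) (+-comm _ _)
    fromℤ-+ -[1+ m ] -[1+ n ] = begin
      - fromℕ (suc (suc (m ℕ.+ n)))          ≡⟨ ≡.cong (λ k → - fromℕ (suc k)) (ℕ.+-suc m n) ⟨
      - fromℕ (suc m ℕ.+ suc n)              ≈⟨ -‿cong (fromℕ-+ (suc m) (suc n)) ⟩
      - (fromℕ (suc m) + fromℕ (suc n))      ≈⟨ -‿+-comm _ _ ⟨
      - fromℕ (suc m) + - fromℕ (suc n)      ∎

    fromℤ-*⁺ : ∀ m j → fromℤ (+ m ℤ.* j) ≈ fromℕ m * fromℤ j
    fromℤ-*⁺ m (+ n) = trans (reflexive (≡.cong fromℤ (≡.sym (ℤ.pos-* m n)))) (fromℕ-* m n)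
    fromℤ-*⁺ m -[1+ n ] = begin
      fromℤ (+ m ℤ.* ℤ.- (+ suc n))     ≡⟨ ≡.cong fromℤ (ℤ.neg-distribʳ-* (+ m) (+ suc n)) ⟨
      fromℤ (ℤ.- (+ m ℤ.* + suc n))     ≈⟨ fromℤ-neg (+ m ℤ.* + suc n) ⟩
      - fromℤ (+ m ℤ.* + suc n)         ≈⟨ -‿cong (fromℤ-*⁺ m (+ suc n)) ⟩
      - (fromℕ m * fromℕ (suc n))       ≈⟨ RingProperties.-‿distribʳ-* ring _ _ ⟩
      fromℕ m * - fromℕ (suc n)         ∎

    fromℤ-* : ∀ i j → fromℤ (i ℤ.* j) ≈ fromℤ i * fromℤ j
    fromℤ-* (+ m) j = fromℤ-*⁺ m j
    fromℤ-* -[1+ m ] j = begin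
      fromℤ (ℤ.- (+ suc m) ℤ.* j)       ≡⟨ ≡.cong fromℤ (ℤ.neg-distribˡ-* (+ suc m) j) ⟨
      fromℤ (ℤ.- (+ suc m ℤ.* j))       ≈⟨ fromℤ-neg (+ suc m ℤ.* j) ⟩
      - fromℤ (+ suc m ℤ.* j)           ≈⟨ -‿cong (fromℤ-*⁺ (suc m) j) ⟩
      - (fromℕ (suc m) * fromℤ j)       ≈⟨ -‿distribˡ-* _ _ ⟩
      - fromℕ (suc m) * fromℤ j         ∎

    -- Agrees with fromℤ up to ≈, but sends the literals 0 and 1 to 0# and 1#
    -- on the nose, so that solver goals can mention 1#.
    fromℕ′ : ℕ → Carrier
    fromℕ′ 0 = 0#
    fromℕ′ 1 = 1#
    fromℕ′ (suc n@(suc _)) = 1# + fromℕ′ n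

    ⟦_⟧ : ℤ → Carrier
    ⟦ + n ⟧      = fromℕ′ n
    ⟦ -[1+ n ] ⟧ = - fromℕ′ (suc n)

    ⟦+⟧≈fromℕ : ∀ n → fromℕ′ n ≈ fromℕ n
    ⟦+⟧≈fromℕ 0 = ≈-refl
    ⟦+⟧≈fromℕ 1 = sym (+-identityʳ 1#)
    ⟦+⟧≈fromℕ (suc n@(suc _)) = +-congˡ (⟦+⟧≈fromℕ n)

    ⟦⟧≈fromℤ : ∀ i → ⟦ i ⟧ ≈ fromℤ i
    ⟦⟧≈fromℤ (+ n)    = ⟦+⟧≈fromℕ n
    ⟦⟧≈fromℤ -[1+ n ] = -‿cong (⟦+⟧≈fromℕ (suc n))

    ⟦⟧-morphism : ℤ.+-*-rawRing -Raw-AlmostCommutative⟶ fromCommutativeRing commutativeRing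
    ⟦⟧-morphism = record
      { ⟦_⟧ = ⟦_⟧
      ; +-homo = λ i j → trans (⟦⟧≈fromℤ (i ℤ.+ j)) (trans (fromℤ-+ i j) (sym (+-cong (⟦⟧≈fromℤ i) (⟦⟧≈fromℤ j))))
      ; *-homo = λ i j → trans (⟦⟧≈fromℤ (i ℤ.* j)) (trans (fromℤ-* i j) (sym (*-cong (⟦⟧≈fromℤ i) (⟦⟧≈fromℤ j))))
      ; -‿homo = λ i → trans (⟦⟧≈fromℤ (ℤ.- i)) (trans (fromℤ-neg i) (-‿cong (sym (⟦⟧≈fromℤ i))))
      ; 0-homo = ≈-refl ; 1-homo = ≈-refl }

    _ℤ≟_ : B.WeaklyDecidable (λ i j → ⟦ i ⟧ ≈ ⟦ j ⟧)
    i ℤ≟ j = case i ℤ.≟ j of λ where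
      (yes i≡j) → just (reflexive (≡.cong ⟦_⟧ i≡j))
      (no _)    → nothing

  open RingSolver ℤ.+-*-rawRing (fromCommutativeRing commutativeRing) ⟦⟧-morphism _ℤ≟_ public
    using (solve; _:=_; _:+_; _:*_; _:-_; :-_; con)

  :1 :2 : ∀ {n} → RingSolver.Polynomial ℤ.+-*-rawRing (fromCommutativeRing commutativeRing) ⟦⟧-morphism _ℤ≟_ n
  :1 = con (+ 1)
  :2 = con (+ 2)

  2# : Carrier
  2# = 1# + 1#

  fromℕ-1 : fromℕ 1 ≈ 1#
  fromℕ-1 = +-identityʳ 1#

  fromℕ-2 : fromℕ 2 ≈ 2#
  fromℕ-2 = +-congˡ fromℕ-1

  ≤-resp : ∀ {x y x′ y′} → x ≈ x′ → y ≈ y′ → x ≤ y → x′ ≤ y′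
  ≤-resp x≈x′ y≈y′ x≤y = ≤-trans (≤-reflexive (sym x≈x′)) (≤-trans x≤y (≤-reflexive y≈y′))

  <-resp : ∀ {x y x′ y′} → x ≈ x′ → y ≈ y′ → x < y → x′ < y′
  <-resp x≈x′ y≈y′ (x≤y , x≉y) =
    ≤-resp x≈x′ y≈y′ x≤y , λ x′≈y′ → x≉y (trans x≈x′ (trans x′≈y′ (sym y≈y′)))

  <⇒≤ : ∀ {x y} → x < y → x ≤ y
  <⇒≤ = proj₁

  <-irrefl : ∀ {x y} → x ≈ y → ¬ (x < y)
  <-irrefl x≈y (_ , x≉y) = x≉y x≈y

  <⇒≱ : ∀ {x y} → x < y → ¬ (y ≤ x)
  <⇒≱ (x≤y , x≉y) y≤x = x≉y (≤-antisym x≤y y≤x)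

  <-asym : ∀ {x y} → x < y → ¬ (y < x)
  <-asym x<y y<x = <⇒≱ x<y (<⇒≤ y<x)

  <-≤-trans : ∀ {x y z} → x < y → y ≤ z → x < z
  <-≤-trans (x≤y , x≉y) y≤z = ≤-trans x≤y y≤z , λ x≈z → x≉y (≤-antisym x≤y (≤-trans y≤z (≤-reflexive (sym x≈z))))

  ≤-<-trans : ∀ {x y z} → x ≤ y → y < z → x < z
  ≤-<-trans x≤y (y≤z , y≉z) = ≤-trans x≤y y≤z , λ x≈z → y≉z (≤-antisym y≤z (≤-trans (≤-reflexive (sym x≈z)) x≤y))

  <-trans : ∀ {x y z} → x < y → y < z → x < z
  <-trans x<y y<z = <-≤-trans x<y (<⇒≤ y<z)

  _≟_ : ∀ x y → Dec (x ≈ y)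
  x ≟ y = lem

  <-or-≥ : ∀ x y → x < y ⊎ y ≤ x
  <-or-≥ x y with ≤-total x y | x ≟ y
  ... | inj₁ x≤y | yes x≈y = inj₂ (≤-reflexive (sym x≈y))
  ... | inj₁ x≤y | no x≉y  = inj₁ (x≤y , x≉y)
  ... | inj₂ y≤x | _       = inj₂ y≤x

  ≮⇒≥ : ∀ {x y} → ¬ (x < y) → y ≤ x
  ≮⇒≥ {x} {y} x≮y with <-or-≥ x y
  ... | inj₁ x<y = contradiction x<y x≮y
  ... | inj₂ y≤x = y≤x

  ≉⇒<⊎> : ∀ {x y} → x ≉ y → x < y ⊎ y < x
  ≉⇒<⊎> {x} {y} x≉y with ≤-total x y
  ... | inj₁ x≤y = inj₁ (x≤y , x≉y)
  ... | inj₂ y≤x = inj₂ (y≤x , x≉y ∘ sym)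

  ≤-diff : ∀ {x y} p → 0# ≤ p → x + p ≈ y → x ≤ y
  ≤-diff {x} {y} p 0≤p x+p≈y =
    ≤-resp (+-identityˡ x) (trans (+-comm p x) x+p≈y) (+-monoˡ-≤ x 0≤p)

  <-diff : ∀ {x y} p → 0# < p → x + p ≈ y → x < y
  <-diff {x} {y} p (0≤p , 0≉p) x+p≈y = ≤-diff p 0≤p x+p≈y , λ x≈y → 0≉p
    (begin
      0#              ≈⟨ -‿inverseʳ y ⟨
      y - y           ≈⟨ +-cong (sym x+p≈y) (-‿cong (sym x≈y)) ⟩
      (x + p) - x     ≈⟨ solve 2 (λ x p → (x :+ p) :- x := p) ≈-refl x p ⟩
      p               ∎)

  ≤⇒0≤ : ∀ {x y} → x ≤ y → 0# ≤ y - x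
  ≤⇒0≤ {x} x≤y = ≤-resp (-‿inverseʳ x) ≈-refl (+-monoˡ-≤ (- x) x≤y)

  <⇒0< : ∀ {x y} → x < y → 0# < y - x
  <⇒0< {x} {y} (x≤y , x≉y) = ≤⇒0≤ x≤y , λ 0≈y-x → x≉y
    (begin
      x              ≈⟨ +-identityʳ x ⟨
      x + 0#         ≈⟨ +-congˡ 0≈y-x ⟩
      x + (y - x)    ≈⟨ solve 2 (λ x y → x :+ (y :- x) := y) ≈-refl x y ⟩
      y              ∎)

  0≤-+ : ∀ {x y} → 0# ≤ x → 0# ≤ y → 0# ≤ x + y
  0≤-+ {x} 0≤x 0≤y = ≤-trans 0≤x (≤-diff _ 0≤y ≈-refl)

  0<-+ : ∀ {x y} → 0# < x → 0# ≤ y → 0# < x + y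
  0<-+ 0<x 0≤y = <-≤-trans 0<x (≤-diff _ 0≤y ≈-refl)

  0<-* : ∀ {x y} → 0# < x → 0# < y → 0# < x * y
  0<-* {x} {y} (0≤x , 0≉x) (0≤y , 0≉y) = *-nonNeg 0≤x 0≤y , λ 0≈xy → 0≉y
    (begin
      0#                  ≈⟨ zeroˡ _ ⟨
      0# * x ⁻¹           ≈⟨ *-congʳ 0≈xy ⟩
      (x * y) * x ⁻¹      ≈⟨ solve 3 (λ x y i → (x :* y) :* i := y :* (x :* i)) ≈-refl x y _ ⟩
      y * (x * x ⁻¹)      ≈⟨ *-congˡ (*-inverseʳ (0≉x ∘ sym)) ⟩
      y * 1#              ≈⟨ *-identityʳ y ⟩
      y                   ∎)

  *-monoˡ-≤ : ∀ {x y} z → 0# ≤ z → x ≤ y → z * x ≤ z * y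
  *-monoˡ-≤ {x} {y} z 0≤z x≤y = ≤-diff _ (*-nonNeg 0≤z (≤⇒0≤ x≤y))
    (solve 3 (λ x y z → z :* x :+ z :* (y :- x) := z :* y) ≈-refl x y z)

  *-monoˡ-< : ∀ {x y} z → 0# < z → x < y → z * x < z * y
  *-monoˡ-< {x} {y} z 0<z x<y = <-diff _ (0<-* 0<z (<⇒0< x<y))
    (solve 3 (λ x y z → z :* x :+ z :* (y :- x) := z :* y) ≈-refl x y z)

  *-cancelˡ-≤ : ∀ {x y} z → 0# < z → z * x ≤ z * y → x ≤ y
  *-cancelˡ-≤ z 0<z zx≤zy = ≮⇒≥ (λ y<x → <⇒≱ (*-monoˡ-< z 0<z y<x) zx≤zy)

  *-cancelˡ-< : ∀ {x y} z → 0# ≤ z → z * x < z * y → x < y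
  *-cancelˡ-< {x} {y} z 0≤z zx<zy with <-or-≥ x y
  ... | inj₁ x<y = x<y
  ... | inj₂ y≤x = contradiction (*-monoˡ-≤ z 0≤z y≤x) (<⇒≱ zx<zy)

  +-mono-≤ : ∀ {x y u v} → x ≤ y → u ≤ v → x + u ≤ y + v
  +-mono-≤ {x} {y} {u} {v} x≤y u≤v = ≤-diff _ (0≤-+ (≤⇒0≤ x≤y) (≤⇒0≤ u≤v))
    (solve 4 (λ x y u v → (x :+ u) :+ ((y :- x) :+ (v :- u)) := y :+ v) ≈-refl x y u v)

  neg-mono-< : ∀ {x y} → x < y → - y < - x
  neg-mono-< {x} {y} x<y = <-diff _ (<⇒0< x<y) (solve 2 (λ x y → :- y :+ (y :- x) := :- x) ≈-refl x y)

  neg-mono-≤ : ∀ {x y} → x ≤ y → - y ≤ - x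
  neg-mono-≤ {x} {y} x≤y = ≤-diff _ (≤⇒0≤ x≤y) (solve 2 (λ x y → :- y :+ (y :- x) := :- x) ≈-refl x y)

  0≤1 : 0# ≤ 1#
  0≤1 with ≤-total 0# 1#
  ... | inj₁ 0≤1 = 0≤1
  ... | inj₂ 1≤0 = ≤-resp ≈-refl (solve 0 (:- :1 :* :- :1 := :1) ≈-refl) (*-nonNeg 0≤-1 0≤-1)
    where 0≤-1 = ≤-resp -0#≈0# ≈-refl (neg-mono-≤ 1≤0)

  0<1 : 0# < 1#
  0<1 = 0≤1 , 1≉0 ∘ sym

  0<2 : 0# < 2#
  0<2 = 0<-+ 0<1 0≤1

  0<⇒≉ : ∀ {x} → 0# < x → x ≉ 0#
  0<⇒≉ (_ , 0≉x) x≈0 = 0≉x (sym x≈0)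

  *-inverseˡ : ∀ {x} → x ≉ 0# → x ⁻¹ * x ≈ 1#
  *-inverseˡ x≉0 = trans (*-comm _ _) (*-inverseʳ x≉0)

  0<⁻¹ : ∀ {x} → 0# < x → 0# < x ⁻¹
  0<⁻¹ {x} 0<x = *-cancelˡ-< x (<⇒≤ 0<x)
    (<-resp (sym (zeroʳ x)) (sym (*-inverseʳ (0<⇒≉ 0<x))) 0<1)

  x*y≈0⇒y≈0 : ∀ {x y} → x ≉ 0# → x * y ≈ 0# → y ≈ 0#
  x*y≈0⇒y≈0 {x} {y} x≉0 xy≈0 = begin
    y                   ≈⟨ *-identityˡ y ⟨
    1# * y              ≈⟨ *-congʳ (*-inverseˡ x≉0) ⟨
    x ⁻¹ * x * y        ≈⟨ *-assoc _ _ _ ⟩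
    x ⁻¹ * (x * y)      ≈⟨ *-congˡ xy≈0 ⟩
    x ⁻¹ * 0#           ≈⟨ zeroʳ _ ⟩
    0#                  ∎

  x-y≈0⇒x≈y : ∀ {x y} → x - y ≈ 0# → x ≈ y
  x-y≈0⇒x≈y {x} {y} x-y≈0 = begin
    x                ≈⟨ solve 2 (λ x y → x := (x :- y) :+ y) ≈-refl x y ⟩
    (x - y) + y      ≈⟨ +-congʳ x-y≈0 ⟩
    0# + y           ≈⟨ +-identityˡ y ⟩
    y                ∎

  /-≤ : ∀ {x y z} → 0# < y → x ≤ z * y → x / y ≤ z
  /-≤ {x} {y} {z} 0<y x≤zy = *-cancelˡ-≤ y 0<y
    (≤-resp (sym (trans (*-comm y _) (trans (*-assoc _ _ _) (trans (*-congˡ (*-inverseˡ (0<⇒≉ 0<y))) (*-identityʳ x)))))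
            (*-comm z y) x≤zy)

  /-≤⁻¹ : ∀ {x y z} → 0# < y → x / y ≤ z → x ≤ z * y
  /-≤⁻¹ {x} {y} {z} 0<y x/y≤z =
    ≤-resp (trans (*-comm y _) (trans (*-assoc _ _ _) (trans (*-congˡ (*-inverseˡ (0<⇒≉ 0<y))) (*-identityʳ x))))
           (*-comm y z) (*-monoˡ-≤ y (<⇒≤ 0<y) x/y≤z)

  0≤fromℕ : ∀ n → 0# ≤ fromℕ n
  0≤fromℕ zero    = ≤-refl
  0≤fromℕ (suc n) = 0≤-+ 0≤1 (0≤fromℕ n)

  0<fromℕ-suc : ∀ n → 0# < fromℕ (suc n)
  0<fromℕ-suc n = 0<-+ 0<1 (0≤fromℕ n)

  fromℕ-mono-≤ : ∀ {m n} → m ℕ.≤ n → fromℕ m ≤ fromℕ n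
  fromℕ-mono-≤ {n = n} z≤n = 0≤fromℕ n
  fromℕ-mono-≤ (s≤s m≤n) = +-mono-≤ ≤-refl (fromℕ-mono-≤ m≤n)

  -- Completeness enters here: if `x` bounded all naturals, they would have a least upper bound `s`;
  -- but `n + 1 ≤ s` for every `n` makes `s - 1#` an upper bound too.
  archimedean : ∀ x → ∃[ n ] x < fromℕ n
  archimedean x with lem {∃[ n ] x < fromℕ n}
  ... | yes p = p
  ... | no ¬p = ⊥-elim (<⇒≱ s-1<s (s-least (s - 1#) s-1-upper))
    where
    S : Carrier → Set
    S y = ∃[ n ] y ≈ fromℕ n
    x-upper : IsUpperBound S x
    x-upper y (n , y≈n) = ≤-resp (sym y≈n) ≈-refl (≮⇒≥ (λ x<n → ¬p (n , x<n)))
    sup = supremum S (0# , 0 , ≈-refl) (x , x-upper)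
    s  = proj₁ sup
    s-least = proj₂ (proj₂ sup)
    s-1-upper : IsUpperBound S (s - 1#)
    s-1-upper y (n , y≈n) = ≤-resp
      (trans (solve 1 (λ m → (:1 :+ m) :- :1 := m) ≈-refl (fromℕ n)) (sym y≈n)) ≈-refl
      (+-monoˡ-≤ (- 1#) (proj₁ (proj₂ sup) (fromℕ (suc n)) (suc n , ≈-refl)))
    s-1<s : s - 1# < s
    s-1<s = <-diff 1# 0<1 (solve 1 (λ s → (s :- :1) :+ :1 := s) ≈-refl s)

  sum-nonNeg : ∀ {n} (t : Vector Carrier n) → (∀ i → 0# ≤ t i) → 0# ≤ sum t
  sum-nonNeg {zero}  t 0≤t = ≤-refl
  sum-nonNeg {suc n} t 0≤t = 0≤-+ (0≤t zero) (sum-nonNeg (t ∘ suc) (0≤t ∘ suc))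

  sum≈0⇒≈0 : ∀ {n} (t : Vector Carrier n) → (∀ i → 0# ≤ t i) → sum t ≈ 0# → ∀ i → t i ≈ 0#
  sum≈0⇒≈0 {suc n} t 0≤t ∑≈0 i = lookup i
    where
    ∑tail≥0 = sum-nonNeg (t ∘ suc) (0≤t ∘ suc)
    t₀≈0 : t zero ≈ 0#
    t₀≈0 = ≤-antisym (≤-resp ≈-refl ∑≈0 (≤-diff _ ∑tail≥0 ≈-refl)) (0≤t zero)
    lookup : ∀ i → t i ≈ 0#
    lookup zero    = t₀≈0
    lookup (suc i) = sum≈0⇒≈0 (t ∘ suc) (0≤t ∘ suc) (trans (sym (trans (+-congʳ t₀≈0) (+-identityˡ _))) ∑≈0) i

-- Counting by matchings between lists.

module Lists where

  private variable
    A B : Set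
    xs ys : List A

  -- With `_≡_` for `S` this is `Unique`; with `_≈ˢ_` the length of a list of ordered pairs counts
  -- unordered pairs.
  Distinctᴸ : Rel A 0ℓ → List A → Set
  Distinctᴸ S = AllPairs (λ x x′ → ¬ S x x′)

  abstract
    -- The matching is a relation, so partners need only exist. The partner of the head is removed
    -- from `ys`; injectivity up to `S` keeps the partners of the tail among what is left.
    length-injection : {S : Rel A 0ℓ} (R : A → B → Set) → (∀ {x x′ y} → R x y → R x′ y → S x x′) →
      Distinctᴸ S xs → (∀ {x} → x ∈ xs → ∃[ y ] (y ∈ ys × R x y)) → length xs ℕ.≤ length ys
    length-injection R inj [] f = z≤n
    length-injection {xs = x ∷ xs} R inj (x# ∷ xs#) f with f (here refl)
    ... | y , y∈ys , Rxy with ∈-∃++ y∈ys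
    ... | us , vs , refl = ≡.subst (suc (length xs) ℕ.≤_)
        (≡.trans (≡.cong suc (List.length-++ us)) (≡.trans (≡.sym (ℕ.+-suc (length us) (length vs))) (≡.sym (List.length-++ us))))
        (s≤s (length-injection R inj xs# f′))
      where
      f′ : ∀ {x′} → x′ ∈ xs → ∃[ y′ ] (y′ ∈ us ++ vs × R x′ y′)
      f′ x′∈xs with f (there x′∈xs)
      ... | y′ , y′∈ys , Rx′y′ with ∈-++⁻ us y′∈ys
      ... | inj₁ y′∈us          = y′ , ∈-++⁺ˡ y′∈us , Rx′y′
      ... | inj₂ (here refl)    = contradiction (inj Rxy Rx′y′) (All.lookup x# x′∈xs)
      ... | inj₂ (there y′∈vs)  = y′ , ∈-++⁺ʳ us y′∈vs , Rx′y′

    unique-⊆⇒length-≤ : Unique xs → (∀ {x} → x ∈ xs → x ∈ ys) → length xs ℕ.≤ length ys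
    unique-⊆⇒length-≤ {ys = ys} xs! xs⊆ys =
      length-injection {ys = ys} _≡_ (λ { refl refl → refl }) xs! (λ x∈xs → _ , xs⊆ys x∈xs , refl)

    -- Turns the mere existence of lifts into a list of lifts of the same length, so that a count
    -- made in the contraction is also a count before it.
    choose : {S : Rel A 0ℓ} {S′ : Rel B 0ℓ} (R : A → B → Set) →
      (∀ {x x′ y y′} → R x y → R x′ y′ → S′ y y′ → S x x′) →
      ∀ xs → Distinctᴸ S xs → (∀ {x} → x ∈ xs → ∃[ y ] R x y) →
      ∃[ ys ] (Distinctᴸ S′ ys × length ys ≡ length xs × (∀ {y} → y ∈ ys → ∃[ x ] (x ∈ xs × R x y))
               × (∀ {x} → x ∈ xs → ∃[ y ] (y ∈ ys × R x y)))
    choose R inj [] [] f = [] , [] , refl , (λ ()) , (λ ())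
    choose {S′ = S′} R inj (x ∷ xs) (x# ∷ xs#) f with f (here refl) | choose R inj xs xs# (f ∘ there)
    ... | y , Rxy | ys , ys# , len , back , forth =
      y ∷ ys , All.tabulate y# ∷ ys# , ≡.cong suc len
        , (λ { (here refl) → x , here refl , Rxy
             ; (there y′∈ys) → let x′ , x′∈xs , Rx′y′ = back y′∈ys in x′ , there x′∈xs , Rx′y′ })
        , (λ { (here refl) → y , here refl , Rxy
             ; (there x′∈xs) → let y′ , y′∈ys , Rx′y′ = forth x′∈xs in y′ , there y′∈ys , Rx′y′ })
      where
      y# : ∀ {y′} → y′ ∈ ys → ¬ S′ y y′
      y# y′∈ys Syy′ = let x′ , x′∈xs , Rx′y′ = back y′∈ys
                      in All.lookup x# x′∈xs (inj Rxy Rx′y′ Syy′)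

    length-filter-∁ : {P : Pred A 0ℓ} (P? : Decidable P) (¬P? : Decidable (¬_ ∘ P)) → ∀ xs →
      length xs ≡ length (filter P? xs) ℕ.+ length (filter ¬P? xs)
    length-filter-∁ P? ¬P? [] = refl
    length-filter-∁ P? ¬P? (x ∷ xs) with P? x | ¬P? x
    ... | yes p | yes ¬p = contradiction p ¬p
    ... | yes p | no  _  = ≡.cong suc (length-filter-∁ P? ¬P? xs)
    ... | no ¬p | yes _  = ≡.trans (≡.cong suc (length-filter-∁ P? ¬P? xs)) (≡.sym (ℕ.+-suc _ _))
    ... | no ¬p | no ¬¬p = contradiction ¬p ¬¬p

  infix 4 _≈ˢ_
  _≈ˢ_ : Rel (A × A) 0ℓ
  (a , b) ≈ˢ (a′ , b′) = (a ≡ a′ × b ≡ b′) ⊎ (a ≡ b′ × b ≡ a′)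

  ≈ˢ-sym : {p q : A × A} → p ≈ˢ q → q ≈ˢ p
  ≈ˢ-sym (inj₁ (refl , refl)) = inj₁ (refl , refl)
  ≈ˢ-sym (inj₂ (refl , refl)) = inj₂ (refl , refl)

  ≈ˢ-trans : {p q r : A × A} → p ≈ˢ q → q ≈ˢ r → p ≈ˢ r
  ≈ˢ-trans (inj₁ (refl , refl)) qr                     = qr
  ≈ˢ-trans (inj₂ (refl , refl)) (inj₁ (refl , refl))  = inj₂ (refl , refl)
  ≈ˢ-trans (inj₂ (refl , refl)) (inj₂ (refl , refl))  = inj₁ (refl , refl)

-- Spaces of functionals on a finite set: perturbation, genericity, antipodality.

module Spaces (lem : ExcludedMiddle 0ℓ) (ℝ : Reals) where
  open Lists
  open Reals ℝ hiding (zero) renaming (refl to ≈-refl)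
  open OrderedField lem ℝ

  Perturbation : {C : Set} → List C → (p r : C → Carrier) → Set
  Perturbation cs p r =
    ∃[ ε ] (0# < ε × (∀ {c c′} → c ∈ cs → c′ ∈ cs → p c < p c′ → p c + ε * r c < p c′ + ε * r c′))

  -- Finitely many strict inequalities form an open condition. The auxiliary `upTo` proves more, for
  -- all positive `ε` up to `δ`, so that the bounds for single pairs combine by taking the smaller
  -- one.
  perturbation : ∀ {C : Set} (cs : List C) (p r : C → Carrier) → Perturbation cs p r
  perturbation {C} cs p r =
    let δ , 0<δ , works = upTo (cartesianProduct cs cs)
    in δ , 0<δ , λ c∈cs c′∈cs → works δ 0<δ ≤-refl (∈-cartesianProduct⁺ c∈cs c′∈cs)
    where
    Works : List (C × C) → Carrier → Set
    Works ps ε = ∀ {c c′} → (c , c′) ∈ ps → p c < p c′ → p c + ε * r c < p c′ + ε * r c′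

    single : ∀ c c′ → ∃[ δ ] (0# < δ × (∀ ε → 0# < ε → ε ≤ δ → p c < p c′ → p c + ε * r c < p c′ + ε * r c′))
    single c c′ with <-or-≥ (p c) (p c′)
    ... | inj₂ p≥p′ = 1# , 0<1 , λ ε _ _ p<p′ → contradiction p≥p′ (<⇒≱ p<p′)
    ... | inj₁ p<p′ with <-or-≥ (r c′) (r c)
    ... | inj₂ r≤r′ = 1# , 0<1 , λ ε 0<ε _ _ → <-diff _ (0<-+ (<⇒0< p<p′) (*-nonNeg (<⇒≤ 0<ε) (≤⇒0≤ r≤r′)))
            (solve 5 (λ p p′ r r′ ε → (p :+ ε :* r) :+ ((p′ :- p) :+ ε :* (r′ :- r)) := p′ :+ ε :* r′) ≈-refl
               (p c) (p c′) (r c) (r c′) ε)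
    -- The gap `γ` has to exceed `ε * ρ`. The extra `1#` in the denominator leaves room for
    -- strictness: `ε * (1# + ρ) ≤ γ` gives `ε * ρ ≤ γ - ε`.
    ... | inj₁ r′<r = γ * (1# + ρ) ⁻¹ , 0<-* 0<γ (0<⁻¹ 0<1+ρ) , λ ε 0<ε ε≤δ _ →
            <-diff _ (0<-+ 0<ε (≤⇒0≤ (bound ε ε≤δ)))
              (solve 5 (λ p p′ r r′ ε →
                (p :+ ε :* r) :+ (ε :+ ((p′ :- p) :- ε :* (:1 :+ (r :- r′)))) := p′ :+ ε :* r′) ≈-refl
                (p c) (p c′) (r c) (r c′) ε)
      where
      γ = p c′ - p c
      ρ = r c - r c′
      0<γ = <⇒0< p<p′
      0<1+ρ = 0<-+ 0<1 (<⇒≤ (<⇒0< r′<r))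
      bound : ∀ ε → ε ≤ γ * (1# + ρ) ⁻¹ → ε * (1# + ρ) ≤ γ
      bound ε ε≤δ = ≤-resp (*-comm _ _)
        (trans (solve 3 (λ a b c → a :* (b :* c) := b :* (a :* c)) ≈-refl _ _ _)
               (trans (*-congˡ (*-inverseʳ (0<⇒≉ 0<1+ρ))) (*-identityʳ γ)))
        (*-monoˡ-≤ (1# + ρ) (<⇒≤ 0<1+ρ) ε≤δ)

    upTo : ∀ ps → ∃[ δ ] (0# < δ × (∀ ε → 0# < ε → ε ≤ δ → Works ps ε))
    upTo [] = 1# , 0<1 , λ _ _ _ ()
    upTo ((c , c′) ∷ ps) with single c c′ | upTo ps
    ... | δ₁ , 0<δ₁ , works₁ | δ₂ , 0<δ₂ , works₂ with ≤-total δ₁ δ₂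
    ... | inj₁ δ₁≤δ₂ = δ₁ , 0<δ₁ , λ ε 0<ε ε≤δ₁ → λ where
            (here refl) → works₁ ε 0<ε ε≤δ₁
            (there i)   → works₂ ε 0<ε (≤-trans ε≤δ₁ δ₁≤δ₂) i
    ... | inj₂ δ₂≤δ₁ = δ₂ , 0<δ₂ , λ ε 0<ε ε≤δ₂ → λ where
            (here refl) → works₁ ε 0<ε (≤-trans ε≤δ₂ δ₂≤δ₁)
            (there i)   → works₂ ε 0<ε ε≤δ₂ i

  abstract
    perturb : ∀ {C : Set} (cs : List C) (p r : C → Carrier) → Perturbation cs p r
    perturb = perturbation

  argmin : ∀ {C : Set} (p : C → Carrier) {cs c₀} → c₀ ∈ cs → ∃[ c ] (c ∈ cs × (∀ {c′} → c′ ∈ cs → p c ≤ p c′))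
  argmin p {c ∷ []} _ = c , here refl , λ { (here refl) → ≤-refl }
  argmin p {c ∷ cs@(_ ∷ _)} _ with argmin p {cs} (here refl)
  ... | d , d∈cs , d-min with ≤-total (p c) (p d)
  ... | inj₁ c≤d = c , here refl , λ { (here refl) → ≤-refl ; (there i) → ≤-trans c≤d (d-min i) }
  ... | inj₂ d≤c = d , there d∈cs , λ { (here refl) → d≤c ; (there i) → d-min i }

  -1* : ∀ a → - 1# * a ≈ - a
  -1* = solve 1 (λ a → (:- :1) :* a := :- a) ≈-refl

  neg-< : ∀ {a b} → a < b → - 1# * b < - 1# * a
  neg-< a<b = <-resp (sym (-1* _)) (sym (-1* _)) (neg-mono-< a<b)

  neg-≤ : ∀ {a b} → a ≤ b → - 1# * b ≤ - 1# * a
  neg-≤ a≤b = ≤-resp (sym (-1* _)) (sym (-1* _)) (neg-mono-≤ a≤b)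

  module _ {I : Set} where

    -- A functional is represented by its values on the points. Contracting points then means
    -- passing to a smaller space of functions on the same index set, and no coordinates have to be
    -- projected.
    Functions : Set₁
    Functions = Pred (I → Carrier) 0ℓ

    private variable
      V : Functions
      W : List I
      f g h : I → Carrier
      x y z : I

    infix 5 _⊕_·_
    _⊕_·_ : (I → Carrier) → Carrier → (I → Carrier) → (I → Carrier)
    (f ⊕ ε · g) i = f i + ε * g i

    record IsSubspace (V : Functions) : Set where
      field
        ⊕-closed : ∀ ε → V f → V g → V (f ⊕ ε · g)
        *-closed : ∀ ε → V f → V (λ i → ε * f i)
      neg-closed : V f → V (λ i → - 1# * f i)
      neg-closed = *-closed (- 1#)

    open IsSubspace

    Linear : ((I → Carrier) → Carrier) → Set
    Linear φ = ∀ f g ε → φ (f ⊕ ε · g) ≈ φ f + ε * φ g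

    Generic : Functions → {C : Set} → List C → (C → (I → Carrier) → Carrier) → (I → Carrier) → Set
    Generic V cs m h =
      ∃[ h′ ] (V h′ × (∀ {c c′} → c ∈ cs → c′ ∈ cs → m c h < m c′ h → m c h′ < m c′ h′)
                    × (∀ {c c′} → c ∈ cs → c′ ∈ cs → m c h′ ≈ m c′ h′ → ∀ {q} → V q → m c q ≈ m c′ q))

    genericity : IsSubspace V → ∀ {C : Set} (cs : List C) (m : C → (I → Carrier) → Carrier) →
      (∀ c → Linear (m c)) → V h → Generic V cs m h
    genericity {V = V} {h = h} sub {C} cs m lin Vh =
      let h′ , Vh′ , mono , sep = separate (cartesianProduct cs cs) (∈-cartesianProduct⁻ cs cs)
      in h′ , Vh′ , mono , λ c∈ c′∈ → sep (∈-cartesianProduct⁺ c∈ c′∈)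
      where
      separate : ∀ ps → (∀ {p} → p ∈ ps → proj₁ p ∈ cs × proj₂ p ∈ cs) →
        ∃[ h′ ] (V h′ × (∀ {c c′} → c ∈ cs → c′ ∈ cs → m c h < m c′ h → m c h′ < m c′ h′)
                      × (∀ {c c′} → (c , c′) ∈ ps → m c h′ ≈ m c′ h′ → ∀ {q} → V q → m c q ≈ m c′ q))
      separate [] _ = h , Vh , (λ _ _ → id) , λ ()
      separate ((c , c′) ∷ ps) ps⊆ with separate ps (ps⊆ ∘ there)
      ... | h₁ , Vh₁ , mono₁ , sep₁ with lem {m c h₁ ≈ m c′ h₁} | lem {∃[ q ] (V q × m c q ≉ m c′ q)}
      ... | no c≉c′ | _ = h₁ , Vh₁ , mono₁ , λ where
              (here refl) c≈c′ → contradiction c≈c′ c≉c′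
              (there i)        → sep₁ i
      ... | yes _ | no ∄q = h₁ , Vh₁ , mono₁ , λ where
              (here refl) _ {q} Vq → case-lem q Vq
              (there i)            → sep₁ i
        where
        case-lem : ∀ q → V q → m c q ≈ m c′ q
        case-lem q Vq with lem {m c q ≈ m c′ q}
        ... | yes e = e
        ... | no ¬e = contradiction (q , Vq , ¬e) ∄q
      ... | yes c≈c′ | yes (q , Vq , q-sep) =
          h₂ , ⊕-closed sub ε Vh₁ Vq , (λ i j → mono₂ i j ∘ mono₁ i j) , λ where
            (here refl) e → contradiction e c≉c′₂
            (there i) e   → sep₁ i (≈-back (ps⊆ (there i)) e)
        where
        ε-data = perturb cs (λ d → m d h₁) (λ d → m d q)
        ε = proj₁ ε-data
        0<ε = proj₁ (proj₂ ε-data)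
        h₂ = h₁ ⊕ ε · q
        mono₂ : ∀ {d d′} → d ∈ cs → d′ ∈ cs → m d h₁ < m d′ h₁ → m d h₂ < m d′ h₂
        mono₂ {d} {d′} d∈ d′∈ d<d′ = <-resp (sym (lin d h₁ q ε)) (sym (lin d′ h₁ q ε)) (proj₂ (proj₂ ε-data) d∈ d′∈ d<d′)
        ≈-back : ∀ {d d′} → d ∈ cs × d′ ∈ cs → m d h₂ ≈ m d′ h₂ → m d h₁ ≈ m d′ h₁
        ≈-back {d} {d′} (d∈ , d′∈) e with lem {m d h₁ ≈ m d′ h₁}
        ... | yes e₁ = e₁
        ... | no ¬e₁ with ≉⇒<⊎> ¬e₁
        ... | inj₁ lt = contradiction (mono₂ d∈ d′∈ lt) (<-irrefl e)
        ... | inj₂ gt = contradiction (mono₂ d′∈ d∈ gt) (<-irrefl (sym e))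
        c≉c′₂ : m c h₂ ≉ m c′ h₂
        c≉c′₂ e = q-sep (x-y≈0⇒x≈y (x*y≈0⇒y≈0 (0<⇒≉ 0<ε) (begin
          ε * (m c q - m c′ q)                                      ≈⟨ solve 4 (λ ε u v w → ε :* (u :- v) := (w :+ ε :* u) :- (w :+ ε :* v)) ≈-refl ε (m c q) (m c′ q) (m c h₁) ⟩
          (m c h₁ + ε * m c q) - (m c h₁ + ε * m c′ q)              ≈⟨ +-congˡ (-‿cong (+-congʳ c≈c′)) ⟩
          (m c h₁ + ε * m c q) - (m c′ h₁ + ε * m c′ q)             ≈⟨ +-cong (lin c h₁ q ε) (-‿cong (lin c′ h₁ q ε)) ⟨
          m c h₂ - m c′ h₂                                          ≈⟨ +-congʳ e ⟩
          m c′ h₂ - m c′ h₂                                         ≈⟨ -‿inverseʳ _ ⟩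
          0#                                                        ∎)))
          where open SetoidReasoning setoid

    abstract
      generic : IsSubspace V → ∀ {C : Set} (cs : List C) (m : C → (I → Carrier) → Carrier) →
        (∀ c → Linear (m c)) → V h → Generic V cs m h
      generic = genericity

    StrictMax StrictMin : (I → Carrier) → List I → I → Set
    StrictMax f W x = ∀ {w} → w ∈ W → w ≢ x → f w < f x
    StrictMin f W x = ∀ {w} → w ∈ W → w ≢ x → f x < f w

    Exposed : Functions → List I → I → Set
    Exposed V W x = ∃[ f ] (V f × StrictMax f W x)

    Antipodal : Functions → List I → I → I → Set
    Antipodal V W x y = ∃[ f ] (V f × StrictMin f W x × StrictMax f W y)

    -- In a contraction different indices may represent the same point; this is equality of the
    -- points represented.
    Equivalent : Functions → I → I → Set
    Equivalent V x y = ∀ {q} → V q → q x ≈ q y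

    antipodal-sym : IsSubspace V → Antipodal V W x y → Antipodal V W y x
    antipodal-sym sub (f , Vf , min , max) =
      _ , neg-closed sub Vf , (λ i ne → neg-< (max i ne)) , (λ i ne → neg-< (min i ne))

    exposed-equivalent⇒≡ : (∀ {x} → x ∈ W → Exposed V W x) → x ∈ W → y ∈ W → Equivalent V x y → x ≡ y
    exposed-equivalent⇒≡ {x = x} {y = y} exposed x∈W y∈W x~y with lem {y ≡ x}
    ... | yes refl = refl
    ... | no y≢x   = let f , Vf , max = exposed x∈W in contradiction (max y∈W y≢x) (<-irrefl (sym (x~y Vf)))

    genericOn : IsSubspace V → ∀ W → V f → ∃[ f′ ] (V f′
      × (∀ {w w′} → w ∈ W → w′ ∈ W → f w < f w′ → f′ w < f′ w′)
      × (∀ {w w′} → w ∈ W → w′ ∈ W → f′ w ≈ f′ w′ → Equivalent V w w′))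
    genericOn sub W = generic sub W (λ w f → f w) (λ _ _ _ _ → ≈-refl)

    module _ (sub : IsSubspace V) (exposed : ∀ {x} → x ∈ W → Exposed V W x) where

      -- For a generic functional, points with equal values are equivalent, and exposed points are
      -- pairwise inequivalent. Any minimum and any maximum is therefore strict.
      perturbed-antipodal : V f → ∃[ f′ ] (V f′ × (∀ {w w′} → w ∈ W → w′ ∈ W → f w < f w′ → f′ w < f′ w′)
        × (∀ {w₀} → w₀ ∈ W → ∃[ x ] ∃[ y ] (x ∈ W × y ∈ W × StrictMin f′ W x × StrictMax f′ W y)))
      perturbed-antipodal Vf with genericOn sub W Vf
      ... | f′ , Vf′ , mono , sep = f′ , Vf′ , mono , λ w₀∈W →
        let x , x∈W , min = argmin f′ w₀∈W
            y , y∈W , max = argmin (λ w → - 1# * f′ w) w₀∈W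
        in x , y , x∈W , y∈W
         , (λ w∈W w≢x → min w∈W , λ e → w≢x (exposed-equivalent⇒≡ exposed w∈W x∈W (λ Vq → sym (sep x∈W w∈W e Vq))))
         , (λ w∈W w≢y → ≤-resp (neg-neg _) (neg-neg _) (neg-≤ (max w∈W)) , λ e → w≢y (exposed-equivalent⇒≡ exposed w∈W y∈W (sep w∈W y∈W e)))
        where
        neg-neg : ∀ a → - 1# * (- 1# * a) ≈ a
        neg-neg = solve 1 (λ a → (:- :1) :* ((:- :1) :* a) := a) ≈-refl

      -- Subtracting a small multiple of a functional exposing z breaks the
      -- ties at the bottom in favour of z.
      antipodal-bottom : V g → z ∈ W → (∀ {w} → w ∈ W → g z ≤ g w) → y ∈ W → StrictMax g W y → Antipodal V W z y
      antipodal-bottom {g = g} {z = z} {y = y} Vg z∈W z-min y∈W y-max with exposed z∈W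
      ... | e , Ve , e-max with perturb W g (λ w → - 1# * e w)
      ... | ε , 0<ε , mono = _ , ⊕-closed sub ε Vg (neg-closed sub Ve) , min , λ w∈W w≢y → mono w∈W y∈W (y-max w∈W w≢y)
        where
        min : StrictMin (g ⊕ ε · (λ w → - 1# * e w)) W z
        min {w} w∈W w≢z with lem {g z ≈ g w}
        ... | no gz≉gw  = mono z∈W w∈W (z-min w∈W , gz≉gw)
        ... | yes gz≈gw = <-resp (+-comm _ _) (trans (+-comm _ _) (+-congʳ gz≈gw))
                (<-diff _ (<⇒0< (*-monoˡ-< ε 0<ε (neg-< (e-max w∈W w≢z))))
                  (solve 3 (λ a b c → (a :+ c) :+ (b :- a) := b :+ c) ≈-refl _ _ (g z)))

      antipodal-top : V g → z ∈ W → (∀ {w} → w ∈ W → g w ≤ g z) → x ∈ W → StrictMin g W x → Antipodal V W x z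
      antipodal-top Vg z∈W z-max x∈W x-min = antipodal-sym sub
        (antipodal-bottom (neg-closed sub Vg) z∈W (λ i → neg-≤ (z-max i)) x∈W (λ i ne → neg-< (x-min i ne)))

-- Sliding an antipodal functional until it ceases to be strict.

module Sliding (lem : ExcludedMiddle 0ℓ) (ℝ : Reals) {I : Set} where
  open Lists
  open Reals ℝ hiding (zero) renaming (refl to ≈-refl)
  open OrderedField lem ℝ
  open Spaces lem ℝ
  open IsSubspace

  private variable
    V : Functions {I}
    W : List I
    a b x y z : I
    f h : I → Carrier

  -- Dual to projecting along the direction `x - y`: the functionals of the quotient are those that
  -- agree on `x` and `y`.
  Identify : Functions → I → I → Functions
  Identify V x y q = V q × q x ≈ q y

  identify-subspace : IsSubspace V → IsSubspace (Identify V x y)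
  identify-subspace sub .⊕-closed ε (Vf , e) (Vg , e′) = ⊕-closed sub ε Vf Vg , +-cong e (*-congˡ e′)
  identify-subspace sub .*-closed ε (Vf , e) = *-closed sub ε Vf , *-congˡ e

  -- As seen by `V`, the point `x` lies strictly between `z` and `z′` on a line, or all three
  -- coincide.
  Tied : Functions → I → I → I → Set
  Tied V x z z′ = ∃[ α ] ∃[ β ] (0# < α × 0# < β × (∀ {q} → V q → α * (q z - q x) + β * (q z′ - q x) ≈ 0#))

  tied-sym : Tied V x y z → Tied V x z y
  tied-sym (α , β , 0<α , 0<β , tie) = β , α , 0<β , 0<α , λ Vq → trans (+-comm _ _) (tie Vq)

  tied-≈ : ∀ {g} → Tied V x y z → V g → g y ≈ g x → g z ≈ g x
  tied-≈ {x = x} {y} {z} {g = g} (α , β , 0<α , 0<β , tie) Vg gy≈gx = x-y≈0⇒x≈y (x*y≈0⇒y≈0 (0<⇒≉ 0<β) (begin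
    β * (g z - g x)                              ≈⟨ +-identityˡ _ ⟨
    0# + β * (g z - g x)                         ≈⟨ +-congʳ (zeroʳ α) ⟨
    α * 0# + β * (g z - g x)                     ≈⟨ +-congʳ (*-congˡ (trans (+-congʳ gy≈gx) (-‿inverseʳ _))) ⟨
    α * (g y - g x) + β * (g z - g x)            ≈⟨ tie Vg ⟩
    0#                                           ∎))
    where open SetoidReasoning setoid

  ¬tied-self : ∀ {g} → Tied V x z z → V g → g z ≈ g x
  ¬tied-self {x = x} {z} {g = g} (α , β , 0<α , 0<β , tie) Vg = x-y≈0⇒x≈y (x*y≈0⇒y≈0
    (0<⇒≉ (0<-+ 0<α (<⇒≤ 0<β))) (trans (distribʳ _ α β) (tie Vg)))

  -- `low z` keeps the value at `z` above that at `x`, and `up z` keeps it below that at `y`. The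
  -- form of `none` is zero; comparing with it makes genericity preserve negative signs of the other
  -- forms.
  data Constraint : Set where
    none : Constraint
    low up : I → Constraint

  -- Starting from f, which is strictly minimal at x and maximal at y, we move
  -- along h (constant on x and y) until some value reaches f x or f y.  For
  -- generic h, all constraints that become tight at that moment are the same
  -- functional.
  sliding : IsSubspace V → (∀ {w} → w ∈ W → Exposed V W w) → x ∈ W → y ∈ W → x ≢ y →
    V f → StrictMin f W x → StrictMax f W y → Identify V x y h → ∃[ w ] (w ∈ W × h w ≉ h x) →
    ∃[ z ] (z ∈ W × z ≢ x × z ≢ y × h z ≉ h x ×
      (Antipodal V W z y ⊎ Antipodal V W x z
       ⊎ ∃[ z′ ] (z′ ∈ W × z′ ≢ x × z′ ≢ y × Tied (Identify V x y) x z z′)))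
  sliding {V = V} {W = W} {x = x} {y = y} {f = f} {h = h} sub exposed x∈W y∈W x≢y Vf f-min f-max V′h@(Vh , hx≈hy) (w₀ , w₀∈W , hw₀≉hx) =
    finish c* c*∈ ≡.refl
    where
    open SetoidReasoning setoid
    V′ = Identify V x y
    Z? : Decidable (λ z → z ≢ x × z ≢ y)
    Z? z = lem
    Z = filter Z? W

    ∈Z : ∀ {w} → w ∈ W → w ≢ x → w ≢ y → w ∈ Z
    ∈Z w∈W w≢x w≢y = ∈-filter⁺ Z? w∈W (w≢x , w≢y)

    lo hi : I → Carrier
    lo z = f z - f x
    hi z = f y - f z

    0<lo : ∀ {z} → z ∈ Z → 0# < lo z
    0<lo z∈Z = let z∈W , z≢x , _ = ∈-filter⁻ Z? {xs = W} z∈Z in <⇒0< (f-min z∈W z≢x)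

    0<hi : ∀ {z} → z ∈ Z → 0# < hi z
    0<hi z∈Z = let z∈W , _ , z≢y = ∈-filter⁻ Z? {xs = W} z∈Z in <⇒0< (f-max z∈W z≢y)

    -- Along `f ⊕ τ · q` with `q x ≈ q y`, the slack of `low z` is `lo z * (1# + τ * m (low z) q)`,
    -- and likewise for `up z` with `hi z`. Through this rescaling the first constraint to become
    -- tight is the one whose form is least.
    m : Constraint → (I → Carrier) → Carrier
    m none    q = 0#
    m (low z) q = lo z ⁻¹ * (q z - q x)
    m (up z)  q = hi z ⁻¹ * (q x - q z)

    m-linear : ∀ c → Linear (m c)
    m-linear none    p q ε = solve 1 (λ ε → con (+ 0) := con (+ 0) :+ ε :* con (+ 0)) ≈-refl ε
    m-linear (low z) p q ε = solve 6 (λ i a b c d ε → i :* ((a :+ ε :* c) :- (b :+ ε :* d)) := i :* (a :- b) :+ ε :* (i :* (c :- d)))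
                               ≈-refl (lo z ⁻¹) (p z) (p x) (q z) (q x) ε
    m-linear (up z)  p q ε = solve 6 (λ i a b c d ε → i :* ((a :+ ε :* c) :- (b :+ ε :* d)) := i :* (a :- b) :+ ε :* (i :* (c :- d)))
                               ≈-refl (hi z ⁻¹) (p x) (p z) (q x) (q z) ε

    cs = none ∷ map low Z ++ map up Z
    low∈ : ∀ {z} → z ∈ Z → low z ∈ cs
    low∈ z∈Z = there (∈-++⁺ˡ (∈-map⁺ low z∈Z))
    up∈ : ∀ {z} → z ∈ Z → up z ∈ cs
    up∈ z∈Z = there (∈-++⁺ʳ (map low Z) (∈-map⁺ up z∈Z))

    low∈⁻ : ∀ {z} → low z ∈ cs → z ∈ Z
    low∈⁻ (there i) with ∈-++⁻ (map low Z) i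
    ... | inj₁ j with ∈-map⁻ low j
    ...   | _ , z∈Z , refl = z∈Z
    low∈⁻ (there i) | inj₂ j with ∈-map⁻ up j
    ...   | _ , _ , ()

    up∈⁻ : ∀ {z} → up z ∈ cs → z ∈ Z
    up∈⁻ (there i) with ∈-++⁻ (map low Z) i
    ... | inj₂ j with ∈-map⁻ up j
    ...   | _ , z∈Z , refl = z∈Z
    up∈⁻ (there i) | inj₁ j with ∈-map⁻ low j
    ...   | _ , _ , ()

    gen = generic (identify-subspace sub) cs m m-linear V′h
    h′ = proj₁ gen
    V′h′ = proj₁ (proj₂ gen)
    mono = proj₁ (proj₂ (proj₂ gen))
    same : ∀ {c c′} → c ∈ cs → c′ ∈ cs → m c h′ ≈ m c′ h′ → ∀ {q} → V′ q → m c q ≈ m c′ q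
    same = proj₂ (proj₂ (proj₂ gen))

    abstract
      best : ∃[ c ] (c ∈ cs × (∀ {c′} → c′ ∈ cs → m c h′ ≤ m c′ h′))
      best = argmin (λ c → m c h′) {cs} (here refl)
    c* = proj₁ best
    c*∈ = proj₁ (proj₂ best)
    c*-min : ∀ {c} → c ∈ cs → m c* h′ ≤ m c h′
    c*-min = proj₂ (proj₂ best)

    w₀∈Z : w₀ ∈ Z
    w₀∈Z = ∈Z w₀∈W (λ { refl → hw₀≉hx ≈-refl }) (λ { refl → hw₀≉hx (sym hx≈hy) })

    -- As `h` moves `w₀` relative to `x`, it moves it towards the value at `x` or at `y`; hence some
    -- constraint becomes tight after finite time.
    neg-c : ∃[ c ] (c ∈ cs × m c h < 0#)
    neg-c with ≉⇒<⊎> hw₀≉hx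
    ... | inj₁ lt = low w₀ , low∈ w₀∈Z , <-resp ≈-refl (zeroʳ _)
            (*-monoˡ-< _ (0<⁻¹ (0<lo w₀∈Z)) (<-resp ≈-refl (-‿inverseʳ (h x)) (<-diff _ (<⇒0< lt)
              (solve 2 (λ a b → (a :- b) :+ (b :- a) := b :- b) ≈-refl (h w₀) (h x)))))
    ... | inj₂ gt = up w₀ , up∈ w₀∈Z , <-resp ≈-refl (zeroʳ _)
            (*-monoˡ-< _ (0<⁻¹ (0<hi w₀∈Z)) (<-resp ≈-refl (-‿inverseʳ (h x)) (<-diff _ (<⇒0< gt)
              (solve 2 (λ a b → (b :- a) :+ (a :- b) := b :- b) ≈-refl (h w₀) (h x)))))

    -- A constraint that becomes tight along the perturbed `h′` already has a negative form at `h`: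
    -- otherwise the constraint from `neg-c` would lie strictly below it at `h`, hence also at `h′`.
    -- This is why the point found is moved by the given `h`.
    c*<0 : ∀ {c} → c ∈ cs → m c h′ ≈ m c* h′ → m c h < 0#
    c*<0 {c} c∈ c≈c* with <-or-≥ (m c h) 0#
    ... | inj₁ lt = lt
    ... | inj₂ ge = let d , d∈ , d<0 = neg-c in contradiction (c*-min d∈)
          (<⇒≱ (<-resp ≈-refl c≈c* (mono d∈ c∈ (<-≤-trans d<0 ge))))

    s = - m c* h′
    0<s : 0# < s
    0<s = let d , d∈ , d<0 = neg-c in <-resp -0#≈0# ≈-refl
      (neg-mono-< (≤-<-trans (c*-min d∈) (mono d∈ (here refl) d<0)))

    τ = s ⁻¹
    0<τ = 0<⁻¹ 0<s
    g = f ⊕ τ · h′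

    h′x≈h′y = proj₂ V′h′

    slack : Constraint → Carrier
    slack c = 1# + τ * m c h′

    0≤slack : ∀ {c} → c ∈ cs → 0# ≤ slack c
    0≤slack {c} c∈ = ≤-resp (trans (solve 2 (λ τ s → τ :* (:- s) :+ τ :* s := con (+ 0)) ≈-refl τ s) ≈-refl)
        (trans (+-comm _ _) (+-congʳ (*-inverseˡ (0<⇒≉ 0<s))))
        (+-mono-≤ (*-monoˡ-≤ τ (<⇒≤ 0<τ) (≤-resp (sym (-‿involutive _)) ≈-refl (c*-min c∈))) ≤-refl)

    0<slack : ∀ {c} → c ∈ cs → m c h′ ≉ m c* h′ → 0# < slack c
    0<slack {c} c∈ c≉c* = 0≤slack c∈ , λ 0≈ → c≉c* (begin
      m c h′                              ≈⟨ cancel (m c h′) ⟩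
      s * (slack c) - s                   ≈⟨ +-congʳ (*-congˡ 0≈) ⟨
      s * 0# - s                          ≈⟨ solve 1 (λ c → (:- c) :* con (+ 0) :- (:- c) := c) ≈-refl (m c* h′) ⟩
      m c* h′                             ∎)
      where
      cancel : ∀ a → a ≈ s * (1# + τ * a) - s
      cancel a = begin
        a                           ≈⟨ *-identityˡ a ⟨
        1# * a                      ≈⟨ *-congʳ (*-inverseʳ (0<⇒≉ 0<s)) ⟨
        s * τ * a                   ≈⟨ solve 3 (λ s τ a → s :* τ :* a := s :* (:1 :+ τ :* a) :- s) ≈-refl s τ a ⟩
        s * (1# + τ * a) - s        ∎

    slack-tight : ∀ {c} → m c h′ ≈ m c* h′ → slack c ≈ 0#
    slack-tight {c} e = begin
      1# + τ * m c h′             ≈⟨ +-congˡ (*-congˡ e) ⟩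
      1# + τ * m c* h′            ≈⟨ solve 2 (λ τ a → :1 :+ τ :* a := :1 :- τ :* (:- a)) ≈-refl τ (m c* h′) ⟩
      1# - τ * s                  ≈⟨ +-congˡ (-‿cong (*-inverseˡ (0<⇒≉ 0<s))) ⟩
      1# - 1#                     ≈⟨ -‿inverseʳ 1# ⟩
      0#                          ∎

    cancel⁻¹ : ∀ {u} v → 0# < u → u * (u ⁻¹ * v) ≈ v
    cancel⁻¹ v 0<u = trans (sym (*-assoc _ _ _)) (trans (*-congʳ (*-inverseʳ (0<⇒≉ 0<u))) (*-identityˡ v))

    g-low : ∀ {z} → z ∈ Z → g z ≈ g x + lo z * slack (low z)
    g-low {z} z∈Z = begin
      f z + τ * h′ z                                     ≈⟨ solve 5 (λ a b τ c d → a :+ τ :* c := (b :+ τ :* d) :+ ((a :- b) :+ τ :* (c :- d))) ≈-refl (f z) (f x) τ (h′ z) (h′ x) ⟩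
      g x + (lo z + τ * (h′ z - h′ x))                   ≈⟨ +-congˡ (+-congˡ (*-congˡ (cancel⁻¹ _ (0<lo z∈Z)))) ⟨
      g x + (lo z + τ * (lo z * m (low z) h′))           ≈⟨ solve 4 (λ x l τ m → x :+ (l :+ τ :* (l :* m)) := x :+ l :* (:1 :+ τ :* m)) ≈-refl (g x) (lo z) τ (m (low z) h′) ⟩
      g x + lo z * slack (low z)                         ∎

    g-up : ∀ {z} → z ∈ Z → g z + hi z * slack (up z) ≈ g y
    g-up {z} z∈Z = begin
      g z + hi z * slack (up z)                          ≈⟨ solve 4 (λ x l τ m → x :+ l :* (:1 :+ τ :* m) := x :+ (l :+ τ :* (l :* m))) ≈-refl (g z) (hi z) τ (m (up z) h′) ⟩
      g z + (hi z + τ * (hi z * m (up z) h′))            ≈⟨ +-congˡ (+-congˡ (*-congˡ (cancel⁻¹ _ (0<hi z∈Z)))) ⟩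
      (f z + τ * h′ z) + ((f y - f z) + τ * (h′ x - h′ z)) ≈⟨ solve 5 (λ a b τ c d → (a :+ τ :* c) :+ ((b :- a) :+ τ :* (d :- c)) := b :+ τ :* d) ≈-refl (f z) (f y) τ (h′ z) (h′ x) ⟩
      f y + τ * h′ x                                     ≈⟨ +-congˡ (*-congˡ h′x≈h′y) ⟩
      g y                                                ∎

    gx<gy : g x < g y
    gx<gy = <-diff _ (<⇒0< (f-max x∈W x≢y)) (begin
      (f x + τ * h′ x) + (f y - f x)   ≈⟨ solve 3 (λ a b c → (a :+ c) :+ (b :- a) := b :+ c) ≈-refl (f x) (f y) (τ * h′ x) ⟩
      f y + τ * h′ x                   ≈⟨ +-congˡ (*-congˡ h′x≈h′y) ⟩
      g y                              ∎)

    Vg : V g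
    Vg = ⊕-closed sub τ Vf (proj₁ V′h′)

    data Position (w : I) : Set where
      at-x : w ≡ x → Position w
      at-y : w ≡ y → Position w
      in-Z : w ∈ Z → Position w

    position : ∀ {w} → w ∈ W → Position w
    position {w} w∈W with lem {w ≡ x} | lem {w ≡ y}
    ... | yes e  | _      = at-x e
    ... | no _   | yes e  = at-y e
    ... | no ne  | no ne′ = in-Z (∈Z w∈W ne ne′)

    x≤ : ∀ {w} → w ∈ W → g x ≤ g w
    x≤ w∈W with position w∈W
    ... | at-x refl = ≤-refl
    ... | at-y refl = <⇒≤ gx<gy
    ... | in-Z w∈Z  = ≤-diff _ (*-nonNeg (<⇒≤ (0<lo w∈Z)) (0≤slack (low∈ w∈Z))) (sym (g-low w∈Z))

    ≤y : ∀ {w} → w ∈ W → g w ≤ g y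
    ≤y w∈W with position w∈W
    ... | at-x refl = <⇒≤ gx<gy
    ... | at-y refl = ≤-refl
    ... | in-Z w∈Z  = ≤-diff _ (*-nonNeg (<⇒≤ (0<hi w∈Z)) (0≤slack (up∈ w∈Z))) (g-up w∈Z)

    TightLow TightUp : I → Set
    TightLow z = z ∈ Z × m (low z) h′ ≈ m c* h′
    TightUp  z = z ∈ Z × m (up z) h′ ≈ m c* h′

    low-moves : ∀ {z} → TightLow z → h z ≉ h x
    low-moves {z} (z∈Z , t) e = <-irrefl (trans (*-congˡ (trans (+-congʳ e) (-‿inverseʳ _))) (zeroʳ _)) (c*<0 (low∈ z∈Z) t)

    up-moves : ∀ {z} → TightUp z → h z ≉ h x
    up-moves {z} (z∈Z , t) e = <-irrefl (trans (*-congˡ (trans (+-congˡ (-‿cong e)) (-‿inverseʳ _))) (zeroʳ _)) (c*<0 (up∈ z∈Z) t)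

    Z⊆ : ∀ {z} → z ∈ Z → z ∈ W × z ≢ x × z ≢ y
    Z⊆ = ∈-filter⁻ Z? {xs = W}

    -- Simultaneous tightness is an equality of two forms at the generic `h′`, hence an identity on
    -- `V′`; written out, this identity is the tie.
    tied : ∀ {z z′} → TightLow z → TightUp z′ → Tied V′ x z z′
    tied {z} {z′} (z∈Z , t) (z′∈Z , t′) = lo z ⁻¹ , hi z′ ⁻¹ , 0<⁻¹ (0<lo z∈Z) , 0<⁻¹ (0<hi z′∈Z) , λ {q} V′q → begin
      lo z ⁻¹ * (q z - q x) + hi z′ ⁻¹ * (q z′ - q x)     ≈⟨ +-congʳ (same (low∈ z∈Z) (up∈ z′∈Z) (trans t (sym t′)) V′q) ⟩
      hi z′ ⁻¹ * (q x - q z′) + hi z′ ⁻¹ * (q z′ - q x)   ≈⟨ solve 3 (λ i a b → i :* (a :- b) :+ i :* (b :- a) := con (+ 0)) ≈-refl _ (q x) (q z′) ⟩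
      0#                                                  ∎

    Conclusion = ∃[ z ] (z ∈ W × z ≢ x × z ≢ y × h z ≉ h x ×
      (Antipodal V W z y ⊎ Antipodal V W x z
       ⊎ ∃[ z′ ] (z′ ∈ W × z′ ≢ x × z′ ≢ y × Tied (Identify V x y) x z z′)))

    both : ∀ {z z′} → TightLow z → TightUp z′ → Conclusion
    both {z} {z′} l@(z∈Z , _) u@(z′∈Z , _) =
      let z∈W , z≢x , z≢y = Z⊆ z∈Z
          z′∈W , z′≢x , z′≢y = Z⊆ z′∈Z
      in z , z∈W , z≢x , z≢y , low-moves l , inj₂ (inj₂ (z′ , z′∈W , z′≢x , z′≢y , tied l u))

    finish : ∀ c → c ∈ cs → c ≡ c* → Conclusion
    finish none    _   c≡c* = contradiction (c*<0 (here refl) (reflexive (≡.cong (λ c → m c h′) c≡c*))) (<-irrefl ≈-refl)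
    finish (low z) c∈ c≡c* = case-up (lem {∃ TightUp})
      where
      z∈Z = low∈⁻ c∈
      l : TightLow z
      l = z∈Z , reflexive (≡.cong (λ c → m c h′) c≡c*)
      case-up : Dec (∃ TightUp) → Conclusion
      case-up (yes (z′ , u)) = both l u
      -- No `up` constraint is tight, so `y` is still a strict maximum. At the bottom `z` has
      -- reached the value of `x`, and `antipodal-bottom` breaks this tie in favour of `z`.
      case-up (no ∄u) = let z∈W , z≢x , z≢y = Z⊆ z∈Z in
        z , z∈W , z≢x , z≢y , low-moves l , inj₁ (antipodal-bottom sub exposed Vg z∈W
          (λ w∈W → ≤-trans (≤-reflexive (trans (g-low z∈Z) (trans (+-congˡ (trans (*-congˡ (slack-tight {low z} (proj₂ l))) (zeroʳ _))) (+-identityʳ _)))) (x≤ w∈W))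
          y∈W strict)
        where
        strict : StrictMax g W y
        strict w∈W w≢y with position w∈W
        ... | at-x refl = gx<gy
        ... | at-y e    = contradiction e w≢y
        ... | in-Z w∈Z  = <-diff _ (0<-* (0<hi w∈Z) (0<slack (up∈ w∈Z) (λ t → ∄u (_ , w∈Z , t)))) (g-up w∈Z)
    finish (up z)  c∈ c≡c* = case-low (lem {∃ TightLow})
      where
      z∈Z = up∈⁻ c∈
      u : TightUp z
      u = z∈Z , reflexive (≡.cong (λ c → m c h′) c≡c*)
      case-low : Dec (∃ TightLow) → Conclusion
      case-low (yes (z′ , l)) = both l u
      case-low (no ∄l) = let z∈W , z≢x , z≢y = Z⊆ z∈Z in
        z , z∈W , z≢x , z≢y , up-moves u , inj₂ (inj₁ (antipodal-top sub exposed Vg z∈W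
          (λ w∈W → ≤-trans (≤y w∈W) (≤-reflexive (trans (sym (g-up z∈Z)) (trans (+-congˡ (trans (*-congˡ (slack-tight {up z} (proj₂ u))) (zeroʳ _))) (+-identityʳ _)))))
          x∈W strict))
        where
        strict : StrictMin g W x
        strict w∈W w≢x with position w∈W
        ... | at-x e    = contradiction e w≢x
        ... | at-y refl = gx<gy
        ... | in-Z w∈Z  = <-diff _ (0<-* (0<lo w∈Z) (0<slack (low∈ w∈Z) (λ t → ∄l (_ , w∈Z , t)))) (sym (g-low w∈Z))

-- Contraction of an antipodal pair: partners, lifting, and the degrees of its ends.

module LowerBound (lem : ExcludedMiddle 0ℓ) (ℝ : Reals) {I : Set} where
  open Lists
  open Reals ℝ hiding (zero) renaming (refl to ≈-refl)
  open OrderedField lem ℝ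
  open Spaces lem ℝ
  open Sliding lem ℝ {I}
  open IsSubspace

  -- The functions in V on the points of W have affine rank at least d.
  HasRank : Functions → List I → ℕ → Set
  HasRank V W d = ∀ l → length l ℕ.< d →
    ∃[ q ] (V q × (∀ {p} → p ∈ l → q (proj₁ p) ≈ q (proj₂ p)) × ∃[ w ] ∃[ w′ ] (w ∈ W × w′ ∈ W × q w < q w′))

  -- As far as functionals in `V` can see, the convex hull of `W` is contained in that of `W′`.
  Dominates : Functions → List I → List I → Set
  Dominates V W W′ = ∀ {f} → V f → ∀ {w} → w ∈ W → ∃[ w′ ] (w′ ∈ W′ × f w ≤ f w′)

  reduce : ∀ V n W → length W ℕ.≤ n → Unique W →
    ∃[ W′ ] (Unique W′ × (∀ {w} → w ∈ W′ → w ∈ W) × Dominates V W W′ × (∀ {w} → w ∈ W′ → Exposed V W′ w))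
  reduce V n W len W! with lem {∃[ w ] (w ∈ W × ¬ Exposed V W w)}
  ... | no ∄w = W , W! , id , (λ _ w∈W → _ , w∈W , ≤-refl) , exposed
    where
    exposed : ∀ {w} → w ∈ W → Exposed V W w
    exposed {w} w∈W with lem {Exposed V W w}
    ... | yes e = e
    ... | no ¬e = contradiction (w , w∈W , ¬e) ∄w
  reduce V n@zero (_ ∷ _) () W! | yes _
  reduce V (suc n) W len W! | yes (w , w∈W , ¬e) =
    let W₂ , W₂! , W₂⊆W₁ , dom₂ , exposed = reduce V n W₁ |W₁|≤n W₁!
    in W₂ , W₂! , proj₁ ∘ W₁⊆ ∘ W₂⊆W₁
     , (λ Vf i → let u , u∈W₁ , f≤ = dom₁ Vf i ; u′ , u′∈W₂ , ≤f = dom₂ Vf u∈W₁ in u′ , u′∈W₂ , ≤-trans f≤ ≤f)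
     , exposed
    where
    ≢w? : Decidable (_≢ w)
    ≢w? u = lem
    W₁ = filter ≢w? W
    W₁! = Unique.filter⁺ ≢w? W!
    W₁⊆ : ∀ {u} → u ∈ W₁ → u ∈ W × u ≢ w
    W₁⊆ = ∈-filter⁻ ≢w? {xs = W}
    |W₁|≤n : length W₁ ℕ.≤ n
    |W₁|≤n = ℕ.≤-pred (ℕ.≤-trans (unique-⊆⇒length-≤ {xs = w ∷ W₁} {ys = W}
      (All.tabulate (λ i e → proj₂ (W₁⊆ i) (≡.sym e)) ∷ W₁!)
      (λ { (here refl) → w∈W ; (there i) → proj₁ (W₁⊆ i) })) len)
    dom₁ : Dominates V W W₁
    dom₁ {f} Vf {u} u∈W with lem {u ≡ w}
    ... | no u≢w = u , ∈-filter⁺ ≢w? u∈W u≢w , ≤-refl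
    ... | yes refl with lem {∃[ w′ ] (w′ ∈ W × w′ ≢ w × f w ≤ f w′)}
    ... | yes (w′ , w′∈W , w′≢w , le) = w′ , ∈-filter⁺ ≢w? w′∈W w′≢w , le
    ... | no ∄w′ = ⊥-elim (¬e (f , Vf , λ {u} u∈W u≢w → [ id , (λ le → contradiction (u , u∈W , u≢w , le) ∄w′) ]′ (<-or-≥ (f u) (f w))))

  AntipodalPairs : Functions → List I → List (I × I) → Set
  AntipodalPairs V W E = Distinctᴸ _≈ˢ_ E ×
    (∀ {p} → p ∈ E → proj₁ p ∈ W × proj₂ p ∈ W × proj₁ p ≢ proj₂ p × Antipodal V W (proj₁ p) (proj₂ p))

  antipodal-exists : ∀ {V W d} → IsSubspace V → (∀ {w} → w ∈ W → Exposed V W w) → HasRank V W (suc d) →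
    ∃[ x ] ∃[ y ] (x ∈ W × y ∈ W × x ≢ y × Antipodal V W x y)
  antipodal-exists sub exposed rank with rank [] (s≤s z≤n)
  ... | q , Vq , _ , w , w′ , w∈W , w′∈W , w<w′ with perturbed-antipodal sub exposed Vq
  ... | f , Vf , mono , extremes with extremes w∈W
  ... | x , y , x∈W , y∈W , min , max = x , y , x∈W , y∈W , x≢y , f , Vf , min , max
    where
    x≢y : x ≢ y
    x≢y refl with lem {w ≡ x}
    ... | yes refl = <-asym (mono w∈W w′∈W w<w′) (max w′∈W (λ { refl → <-irrefl ≈-refl w<w′ }))
    ... | no w≢x   = <-asym (min w∈W w≢x) (max w∈W w≢x)

  module Contraction {V : Functions} (sub : IsSubspace V) {W : List I} (W! : Unique W)
    (exposed : ∀ {w} → w ∈ W → Exposed V W w)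
    {x y : I} (x∈W : x ∈ W) (y∈W : y ∈ W) (x≢y : x ≢ y)
    {f : I → Carrier} (Vf : V f) (f-min : StrictMin f W x) (f-max : StrictMax f W y)
    {d : ℕ} (rank : HasRank V W (suc d)) where

    V′ : Functions
    V′ = Identify V x y

    sub′ : IsSubspace V′
    sub′ = identify-subspace sub

    -- A point equivalent to `x` lies on the line through `x` and `y`, and `f` places it strictly
    -- between them, which is impossible for a vertex `z`.
    not-collinear : ∀ {z} → z ∈ W → z ≢ x → z ≢ y → ¬ Equivalent V′ z x
    not-collinear {z} z∈W z≢x z≢y z~x with exposed z∈W
    ... | e , Ve , e-max = case (≤-total 0# t)
      where
      open SetoidReasoning setoid
      0<fy-fx = <⇒0< (f-max x∈W x≢y)
      -- With this `t` the functional `e ⊕ t · f` agrees on `x` and `y`. If `z` is equivalent to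
      -- `x`, then `e x` is `e z + t * (f z - f x)` and `e y` is `e z - t * (f y - f z)`; by the
      -- sign of `t`, one of them is at least `e z`.
      t = (e x - e y) * (f y - f x) ⁻¹
      q = e ⊕ t · f
      t*Δ : t * (f y - f x) ≈ e x - e y
      t*Δ = trans (*-assoc _ _ _) (trans (*-congˡ (*-inverseˡ (0<⇒≉ 0<fy-fx))) (*-identityʳ _))
      qx≈qy : q x ≈ q y
      qx≈qy = begin
        e x + t * f x                                   ≈⟨ solve 5 (λ a b t c d → a :+ t :* c := (b :+ t :* d) :+ ((a :- b) :- t :* (d :- c))) ≈-refl (e x) (e y) t (f x) (f y) ⟩
        q y + ((e x - e y) - t * (f y - f x))           ≈⟨ +-congˡ (+-congˡ (-‿cong t*Δ)) ⟩
        q y + ((e x - e y) - (e x - e y))               ≈⟨ +-congˡ (-‿inverseʳ _) ⟩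
        q y + 0#                                        ≈⟨ +-identityʳ _ ⟩
        q y                                             ∎
      V′q : V′ q
      V′q = ⊕-closed sub t Ve Vf , qx≈qy
      case : 0# ≤ t ⊎ t ≤ 0# → ⊥
      case (inj₁ 0≤t) = <⇒≱ (e-max x∈W (z≢x ∘ ≡.sym)) (≤-diff _ (*-nonNeg 0≤t (<⇒≤ (<⇒0< (f-min z∈W z≢x)))) (begin
        e z + t * (f z - f x)      ≈⟨ solve 4 (λ a t b c → a :+ t :* (b :- c) := (a :+ t :* b) :- t :* c) ≈-refl (e z) t (f z) (f x) ⟩
        q z - t * f x              ≈⟨ +-congʳ (z~x V′q) ⟩
        q x - t * f x              ≈⟨ solve 2 (λ a b → (a :+ b) :- b := a) ≈-refl (e x) (t * f x) ⟩
        e x                        ∎))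
      case (inj₂ t≤0) = <⇒≱ (e-max y∈W (z≢y ∘ ≡.sym)) (≤-diff _ (*-nonNeg (≤⇒0≤ t≤0) (<⇒≤ (<⇒0< (f-max z∈W z≢y)))) (begin
        e z + (0# - t) * (f y - f z)   ≈⟨ solve 4 (λ a t b c → a :+ (con (+ 0) :- t) :* (b :- c) := (a :+ t :* c) :- t :* b) ≈-refl (e z) t (f y) (f z) ⟩
        q z - t * f y                  ≈⟨ +-congʳ (trans (z~x V′q) qx≈qy) ⟩
        q y - t * f y                  ≈⟨ solve 2 (λ a b → (a :+ b) :- b := a) ≈-refl (e y) (t * f y) ⟩
        e y                            ∎))

    A? : Decidable (λ z → (z ≢ x × z ≢ y) × Antipodal V W x z)
    A? z = lem
    B? : Decidable (λ z → (z ≢ x × z ≢ y) × Antipodal V W z y)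
    B? z = lem
    A B : List I
    A = filter A? W
    B = filter B? W
    A! : Unique A
    A! = Unique.filter⁺ A? W!
    B! : Unique B
    B! = Unique.filter⁺ B? W!

    A⊆ : ∀ {z} → z ∈ A → z ∈ W × (z ≢ x × z ≢ y) × Antipodal V W x z
    A⊆ = ∈-filter⁻ A? {xs = W}
    B⊆ : ∀ {z} → z ∈ B → z ∈ W × (z ≢ x × z ≢ y) × Antipodal V W z y
    B⊆ = ∈-filter⁻ B? {xs = W}

    annihilator : ∀ l → length l ℕ.< d → ∃[ q ] (V′ q × (∀ {z} → z ∈ l → q z ≈ q x) × ∃[ w ] (w ∈ W × q w ≉ q x))
    annihilator l len with rank ((x , y) ∷ map (_, x) l) (s≤s (≡.subst (ℕ._< d) (≡.sym (List.length-map (_, x) l)) len))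
    ... | q , Vq , kills , w , w′ , w∈W , w′∈W , w<w′ =
        q , (Vq , kills (here refl)) , (λ z∈l → kills (there (∈-map⁺ (_, x) z∈l))) , moved
      where
      moved : ∃[ w ] (w ∈ W × q w ≉ q x)
      moved with lem {q w ≈ q x}
      ... | no ne = w , w∈W , ne
      ... | yes e = w′ , w′∈W , λ e′ → <-irrefl (trans e (sym e′)) w<w′

    -- Sliding finds a point moved by `h`. When `h` moves no partner in `A` or `B`, the point found
    -- cannot be a partner of `x` or `y`, so only the tie is left.
    slide : ∀ {h w} → V′ h → (∀ {z} → z ∈ A → h z ≈ h x) → (∀ {z} → z ∈ B → h z ≈ h x) → w ∈ W → h w ≉ h x →
      ∃[ z ] ∃[ z′ ] (z ∈ W × z ≢ x × z ≢ y × h z ≉ h x × z′ ∈ W × z′ ≢ x × z′ ≢ y × Tied V′ x z z′)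
    slide V′h killsA killsB w∈W moved with sliding sub exposed x∈W y∈W x≢y Vf f-min f-max V′h (_ , w∈W , moved)
    ... | z , z∈W , z≢x , z≢y , ne , inj₁ ant        = contradiction (killsB (∈-filter⁺ B? z∈W ((z≢x , z≢y) , ant))) ne
    ... | z , z∈W , z≢x , z≢y , ne , inj₂ (inj₁ ant) = contradiction (killsA (∈-filter⁺ A? z∈W ((z≢x , z≢y) , ant))) ne
    ... | z , z∈W , z≢x , z≢y , ne , inj₂ (inj₂ (z′ , z′∈W , z′≢x , z′≢y , tie)) =
      z , z′ , z∈W , z≢x , z≢y , ne , z′∈W , z′≢x , z′≢y , tie

    -- Outside A ∪ B the points come in tied pairs, and a tied pair
    -- contributes only one to the rank.
    rank-bound : 2 ℕ.* suc d ℕ.≤ length A ℕ.+ length B ℕ.+ length W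
    rank-bound = ℕ.≤-trans main (ℕ.+-monoˡ-≤ (length W)
        (≡.subst (m ℕ.≤_) (List.length-++ A) (unique-⊆⇒length-≤ U! (λ i → [ ∈-++⁺ˡ , ∈-++⁺ʳ A ]′ (proj₂ (U⊆ i))))))
      where
      U? : Decidable (λ z → z ∈ A ⊎ z ∈ B)
      U? z = lem
      U = filter U? W
      U! : Unique U
      U! = Unique.filter⁺ U? W!
      U⊆ : ∀ {z} → z ∈ U → z ∈ W × (z ∈ A ⊎ z ∈ B)
      U⊆ = ∈-filter⁻ U? {xs = W}
      A⊆U : ∀ {z} → z ∈ A → z ∈ U
      A⊆U i = ∈-filter⁺ U? (proj₁ (A⊆ i)) (inj₁ i)
      B⊆U : ∀ {z} → z ∈ B → z ∈ U
      B⊆U i = ∈-filter⁺ U? (proj₁ (B⊆ i)) (inj₂ i)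
      m = length U

      U-away : ∀ {z} → z ∈ U → z ≢ x × z ≢ y
      U-away i with proj₂ (U⊆ i)
      ... | inj₁ i∈A = proj₁ (proj₂ (A⊆ i∈A))
      ... | inj₂ i∈B = proj₁ (proj₂ (B⊆ i∈B))

      TiedPairs : ℕ → Set
      TiedPairs j = ∃[ P ] ∃[ gens ] (Unique P × length P ≡ 2 ℕ.* j × length gens ≡ j
        × (∀ {p} → p ∈ P → p ∈ W × p ≢ x × p ≢ y × p ∉ U)
        × (∀ {q} → V′ q → (∀ {g} → g ∈ gens → q g ≈ q x) → ∀ {p} → p ∈ P → q p ≈ q x))

      -- As long as `U` and one generator per pair impose fewer than `d` equations, a nonconstant
      -- `q` satisfies them all. The pair found by sliding along `q` is moved by `q`, hence new and
      -- outside `U`. Only `z` joins the generators, since the tie makes `z′` follow.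
      tiedPairs : ∀ j → m ℕ.+ j ℕ.≤ d → TiedPairs j
      tiedPairs zero    _ = [] , [] , [] , refl , refl , (λ ()) , λ _ _ ()
      tiedPairs (suc j) m+1+j≤d with tiedPairs j (ℕ.≤-trans (ℕ.+-monoʳ-≤ m (ℕ.n≤1+n j)) m+1+j≤d)
      ... | P , gens , P! , |P| , |gens| , P⊆ , killsP with annihilator (U ++ gens)
              (≡.subst (ℕ._< d) (≡.sym (≡.trans (List.length-++ U) (≡.cong (m ℕ.+_) |gens|))) (≡.subst (ℕ._≤ d) (ℕ.+-suc m j) m+1+j≤d))
      ... | q , V′q , kills , w , w∈W , moved with slide V′q (kills ∘ ∈-++⁺ˡ ∘ A⊆U) (kills ∘ ∈-++⁺ˡ ∘ B⊆U) w∈W moved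
      ... | z , z′ , z∈W , z≢x , z≢y , qz≉qx , z′∈W , z′≢x , z′≢y , tie =
          z ∷ z′ ∷ P , z ∷ gens
        , (z≢z′ ∷ All.tabulate (λ i → λ { refl → qz≉qx (q-kills-P i) })) ∷ All.tabulate (λ i → λ { refl → qz′≉qx (q-kills-P i) }) ∷ P!
        , ≡.trans (≡.cong (λ k → suc (suc k)) |P|) (≡.sym (ℕ.*-suc 2 j))
        , ≡.cong suc |gens|
        , (λ { (here refl) → z∈W , z≢x , z≢y , qz≉qx ∘ kills ∘ ∈-++⁺ˡ
             ; (there (here refl)) → z′∈W , z′≢x , z′≢y , qz′≉qx ∘ kills ∘ ∈-++⁺ˡ
             ; (there (there i)) → P⊆ i })
        , λ { V′p kills-p (here refl) → kills-p (here refl)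
            ; V′p kills-p (there (here refl)) → tied-≈ tie V′p (kills-p (here refl))
            ; V′p kills-p (there (there i)) → killsP V′p (kills-p ∘ there) i }
        where
        qz′≉qx : q z′ ≉ q x
        qz′≉qx e = qz≉qx (tied-≈ (tied-sym tie) V′q e)
        z≢z′ : z ≢ z′
        z≢z′ refl = qz≉qx (¬tied-self tie V′q)
        q-kills-P : ∀ {p} → p ∈ P → q p ≈ q x
        q-kills-P = killsP V′q (λ i → kills (∈-++⁺ʳ U i))

      count : ∀ j → TiedPairs j → 2 ℕ.+ (m ℕ.+ 2 ℕ.* j) ℕ.≤ length W
      count j (P , _ , P! , |P| , _ , P⊆ , _) = ≡.subst (λ k → 2 ℕ.+ k ℕ.≤ length W)
        (≡.trans (List.length-++ U) (≡.cong (m ℕ.+_) |P|))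
        (unique-⊆⇒length-≤ {xs = x ∷ y ∷ U ++ P}
          ((x≢y ∷ All.tabulate (λ i e → proj₁ (UP-away i) (≡.sym e))) ∷ All.tabulate (λ i e → proj₂ (UP-away i) (≡.sym e))
            ∷ Unique.++⁺ U! P! (λ (i , j) → proj₂ (proj₂ (proj₂ (P⊆ j))) i))
          (λ { (here refl) → x∈W ; (there (here refl)) → y∈W ; (there (there i)) → [ proj₁ ∘ U⊆ , proj₁ ∘ P⊆ ]′ (∈-++⁻ U i) }))
        where
        UP-away : ∀ {z} → z ∈ U ++ P → z ≢ x × z ≢ y
        UP-away i with ∈-++⁻ U i
        ... | inj₁ i∈U = U-away i∈U
        ... | inj₂ i∈P = let _ , z≢x , z≢y , _ = P⊆ i∈P in z≢x , z≢y

      -- The points `x`, `y`, those of `U` and `d - m` tied pairs are distinct points of `W`, so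
      -- `length W` is at least `2 + m + 2 (d - m)`. If `d ≤ m`, no tied pairs are required.
      main : 2 ℕ.* suc d ℕ.≤ m ℕ.+ length W
      main with ℕ.≤-total m d
      ... | inj₂ d≤m = begin
          2 ℕ.* suc d                       ≤⟨ ℕ.*-monoʳ-≤ 2 (s≤s d≤m) ⟩
          2 ℕ.* suc m                       ≡⟨ identity₀ m ⟩
          m ℕ.+ (2 ℕ.+ (m ℕ.+ 2 ℕ.* 0))     ≤⟨ ℕ.+-monoʳ-≤ m (count 0 ([] , [] , [] , refl , refl , (λ ()) , λ _ _ ())) ⟩
          m ℕ.+ length W                    ∎
        where
        open ℕ.≤-Reasoning
        identity₀ : ∀ m → 2 ℕ.* suc m ≡ m ℕ.+ (2 ℕ.+ (m ℕ.+ 2 ℕ.* 0))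
        identity₀ = ℕSolver.solve-∀
      ... | inj₁ m≤d = begin
          2 ℕ.* suc d                       ≡⟨ ≡.cong (λ k → 2 ℕ.* suc k) (ℕ.m+[n∸m]≡n m≤d) ⟨
          2 ℕ.* suc (m ℕ.+ (d ℕ.∸ m))       ≡⟨ identity m (d ℕ.∸ m) ⟩
          m ℕ.+ (2 ℕ.+ (m ℕ.+ 2 ℕ.* (d ℕ.∸ m)))   ≤⟨ ℕ.+-monoʳ-≤ m (count _ (tiedPairs (d ℕ.∸ m) (ℕ.≤-reflexive (ℕ.m+[n∸m]≡n m≤d)))) ⟩
          m ℕ.+ length W                    ∎
        where
        open ℕ.≤-Reasoning
        identity : ∀ m j → 2 ℕ.* suc (m ℕ.+ j) ≡ m ℕ.+ (2 ℕ.+ (m ℕ.+ 2 ℕ.* j))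
        identity = ℕSolver.solve-∀

    module _ {W′ : List I} (W′! : Unique W′) (W′⊆ : ∀ {w} → w ∈ W′ → w ∈ W) (y∉W′ : y ∉ W′)
      (dominates : Dominates V′ W W′) (exposed′ : ∀ {w} → w ∈ W′ → Exposed V′ W′ w) where

      -- The lower end may be prescribed as any point `x₀` of `W` over `a`, while the upper end is
      -- some point over `b`. By domination a generic refinement of `p` has its minimum on `W` over
      -- `a` and its maximum over `b`. Subtracting a little of a functional exposing `x₀` makes `x₀`
      -- the strict minimum, and a further perturbation singles out a maximum, still over `b`. The
      -- freedom in `x₀` allows lifting from the contracted point to `x` as well as to `y`.
      lift : ∀ {x₀ a b} → x₀ ∈ W → a ∈ W′ → b ∈ W′ → Equivalent V′ x₀ a → Antipodal V′ W′ a b →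
        ∃[ b′ ] (b′ ∈ W × Antipodal V W x₀ b′ × Equivalent V′ b b′)
      lift {x₀} {a} {b} x₀∈W a∈W′ b∈W′ x₀~a (p , V′p , p-min , p-max) with genericOn sub′ W V′p
      ... | p₁ , V′p₁ , mono₁ , sep₁ with exposed x₀∈W
      ... | e , Ve , e-max with perturb W p₁ (λ w → - 1# * e w)
      ... | ε , 0<ε , mono₂ with perturbed-antipodal sub exposed (⊕-closed sub ε (proj₁ V′p₁) (neg-closed sub Ve))
      ... | p₃ , Vp₃ , mono₃ , extremes with extremes x∈W
      ... | _ , b′ , _ , b′∈W , _ , max₃ = b′ , b′∈W , (p₃ , Vp₃ , min₃ , max₃) , sep₁ (W′⊆ b∈W′) b′∈W (sym b′≈b)
        where
        a≤ : ∀ {w} → w ∈ W → p₁ a ≤ p₁ w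
        a≤ {w} w∈W with dominates (neg-closed sub′ V′p₁) w∈W
        ... | w′ , w′∈W′ , le = ≤-trans a≤w′ (≮⇒≥ (λ w<w′ → <⇒≱ (neg-< w<w′) le))
          where
          a≤w′ : p₁ a ≤ p₁ w′
          a≤w′ with lem {w′ ≡ a}
          ... | yes refl = ≤-refl
          ... | no ne    = <⇒≤ (mono₁ (W′⊆ a∈W′) (W′⊆ w′∈W′) (p-min w′∈W′ ne))
        ≤b : ∀ {w} → w ∈ W → p₁ w ≤ p₁ b
        ≤b {w} w∈W with dominates V′p₁ w∈W
        ... | w′ , w′∈W′ , le with lem {w′ ≡ b}
        ... | yes refl = le
        ... | no ne    = ≤-trans le (<⇒≤ (mono₁ (W′⊆ w′∈W′) (W′⊆ b∈W′) (p-max w′∈W′ ne)))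
        min₂ : StrictMin (p₁ ⊕ ε · (λ w → - 1# * e w)) W x₀
        min₂ {w} w∈W w≢x₀ with lem {p₁ x₀ ≈ p₁ w}
        ... | no ne = mono₂ x₀∈W w∈W (≤-resp (sym (x₀~a V′p₁)) ≈-refl (a≤ w∈W) , ne)
        ... | yes x₀≈w = <-resp ≈-refl (+-congʳ x₀≈w)
                (<-diff _ (<⇒0< (*-monoˡ-< ε 0<ε (neg-< (e-max w∈W w≢x₀))))
                  (solve 3 (λ a b c → (c :+ a) :+ (b :- a) := c :+ b) ≈-refl _ _ (p₁ x₀)))
        min₃ : StrictMin p₃ W x₀
        min₃ w∈W w≢x₀ = mono₃ x₀∈W w∈W (min₂ w∈W w≢x₀)
        b′≈b : p₁ b′ ≈ p₁ b
        b′≈b with lem {p₁ b′ ≈ p₁ b}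
        ... | yes e = e
        ... | no ne = ⊥-elim (<-asym b′<b₃ (max₃ (W′⊆ b∈W′) λ { refl → ne ≈-refl }))
          where
          b′<b₃ : p₃ b′ < p₃ b
          b′<b₃ = mono₃ b′∈W (W′⊆ b∈W′) (mono₂ b′∈W (W′⊆ b∈W′) (≤b b′∈W , ne))

      away⇒≁x : ∀ {a} → a ∈ W′ → a ≢ x → ¬ Equivalent V′ a x
      away⇒≁x a∈W′ a≢x = not-collinear (W′⊆ a∈W′) a≢x (λ { refl → y∉W′ a∈W′ })

      away-lift : ∀ {a a′} → a ∈ W′ → a ≢ x → Equivalent V′ a a′ → a′ ≢ x × a′ ≢ y
      away-lift a∈W′ a≢x a~a′ =
          (λ { refl → away⇒≁x a∈W′ a≢x a~a′ })
        , (λ { refl → away⇒≁x a∈W′ a≢x (λ V′q → trans (a~a′ V′q) (sym (proj₂ V′q))) })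

      PairLiftsTo : I × I → I × I → Set
      PairLiftsTo (a , b) (a′ , b′) = ((a ∈ W′ × a ≢ x) × (b ∈ W′ × b ≢ x) × a ≢ b)
        × (a′ ∈ W × b′ ∈ W) × Antipodal V W a′ b′ × Equivalent V′ a a′ × Equivalent V′ b b′

      same : ∀ {a b c} → a ∈ W′ → b ∈ W′ → Equivalent V′ a c → Equivalent V′ b c → a ≡ b
      same a∈ b∈ a~c b~c = exposed-equivalent⇒≡ exposed′ a∈ b∈ (λ V′q → trans (a~c V′q) (sym (b~c V′q)))

      lifts-injective : ∀ {p q p′ q′} → PairLiftsTo p p′ → PairLiftsTo q q′ → p′ ≈ˢ q′ → p ≈ˢ q
      lifts-injective (((a∈ , _) , (b∈ , _) , _) , _ , _ , a~ , b~) (((c∈ , _) , (d∈ , _) , _) , _ , _ , c~ , d~) (inj₁ (refl , refl)) =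
        inj₁ (same a∈ c∈ a~ c~ , same b∈ d∈ b~ d~)
      lifts-injective (((a∈ , _) , (b∈ , _) , _) , _ , _ , a~ , b~) (((c∈ , _) , (d∈ , _) , _) , _ , _ , c~ , d~) (inj₂ (refl , refl)) =
        inj₂ (same a∈ d∈ a~ d~ , same b∈ c∈ b~ c~)

      touching : List (I × I)
      touching = (x , y) ∷ map (x ,_) A ++ map (y ,_) B

      ∈touching : ∀ {p} → p ∈ touching →
        p ≡ (x , y) ⊎ (∃[ z ] (z ∈ A × p ≡ (x , z))) ⊎ (∃[ z ] (z ∈ B × p ≡ (y , z)))
      ∈touching (here refl) = inj₁ refl
      ∈touching (there i) with ∈-++⁻ (map (x ,_) A) i
      ... | inj₁ j = inj₂ (inj₁ (∈-map⁻ (x ,_) j))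
      ... | inj₂ j = inj₂ (inj₂ (∈-map⁻ (y ,_) j))

      touches : ∀ {p} → p ∈ touching → proj₁ p ≡ x ⊎ proj₁ p ≡ y
      touches i with ∈touching i
      ... | inj₁ refl                 = inj₁ refl
      ... | inj₂ (inj₁ (_ , _ , refl)) = inj₁ refl
      ... | inj₂ (inj₂ (_ , _ , refl)) = inj₂ refl

      touching# : Distinctᴸ _≈ˢ_ touching
      touching# = All.tabulate head# ∷ AllPairs.++⁺ (AllPairs.map⁺ (AllPairs.map A# A!)) (AllPairs.map⁺ (AllPairs.map B# B!))
          (All.tabulate λ i → All.tabulate λ j → cross i j)
        where
        A# : ∀ {z z′} → z ≢ z′ → ¬ ((x , z) ≈ˢ (x , z′))
        A# z≢z′ (inj₁ (_ , e)) = z≢z′ e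
        A# z≢z′ (inj₂ (e , e′)) = z≢z′ (≡.trans e′ e)
        B# : ∀ {z z′} → z ≢ z′ → ¬ ((y , z) ≈ˢ (y , z′))
        B# z≢z′ (inj₁ (_ , e)) = z≢z′ e
        B# z≢z′ (inj₂ (e , e′)) = z≢z′ (≡.trans e′ e)
        head# : ∀ {p} → p ∈ map (x ,_) A ++ map (y ,_) B → ¬ ((x , y) ≈ˢ p)
        head# i with ∈-++⁻ (map (x ,_) A) i
        ... | inj₁ j with ∈-map⁻ (x ,_) j
        ...   | z , z∈A , refl = λ { (inj₁ (_ , refl)) → proj₂ (proj₁ (proj₂ (A⊆ z∈A))) refl
                                   ; (inj₂ (refl , _)) → proj₁ (proj₁ (proj₂ (A⊆ z∈A))) refl }
        head# i | inj₂ j with ∈-map⁻ (y ,_) j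
        ...   | z , z∈B , refl = λ { (inj₁ (e , _)) → x≢y e
                                   ; (inj₂ (refl , _)) → proj₁ (proj₁ (proj₂ (B⊆ z∈B))) refl }
        cross : ∀ {p q} → p ∈ map (x ,_) A → q ∈ map (y ,_) B → ¬ (p ≈ˢ q)
        cross i j with ∈-map⁻ (x ,_) i | ∈-map⁻ (y ,_) j
        ... | z , z∈A , refl | z′ , z′∈B , refl = λ
          { (inj₁ (e , _)) → x≢y e
          ; (inj₂ (refl , _)) → proj₁ (proj₁ (proj₂ (B⊆ z′∈B))) refl }

      -- By `not-collinear`, a point of `W′` other than `x` is not equivalent to `x` or `y`. The
      -- lifted pairs therefore contain neither of them and are new compared with `touching`.
      assemble : ∀ {E₀} E₁ → Distinctᴸ _≈ˢ_ E₁ → length E₁ ≡ length E₀ → (∀ {p′} → p′ ∈ E₁ → ∃[ p ] (p ∈ E₀ × PairLiftsTo p p′)) →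
        ∃[ E ] (AntipodalPairs V W E × length E ≡ 1 ℕ.+ (length A ℕ.+ length B) ℕ.+ length E₀)
      assemble {E₀} E₁ E₁# |E₁| back = touching ++ E₁ , (AllPairs.++⁺ touching# E₁# disjoint , valid) , |E|
        where
        disjoint : All (λ p → All (λ q → ¬ (p ≈ˢ q)) E₁) touching
        disjoint = All.tabulate λ i → All.tabulate λ j → apart i j
          where
          apart : ∀ {p q} → p ∈ touching → q ∈ E₁ → ¬ (p ≈ˢ q)
          apart i j p≈q with back j
          ... | _ , _ , ((a∈ , a≢x) , (b∈ , b≢x) , _) , _ , _ , a~ , b~ with away-lift a∈ a≢x a~ | away-lift b∈ b≢x b~ | touches i | p≈q
          ... | a′≢x , _ | _ | inj₁ e | inj₁ (e′ , _) = a′≢x (≡.trans (≡.sym e′) e)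
          ... | _ , a′≢y | _ | inj₂ e | inj₁ (e′ , _) = a′≢y (≡.trans (≡.sym e′) e)
          ... | _ | b′≢x , _ | inj₁ e | inj₂ (e′ , _) = b′≢x (≡.trans (≡.sym e′) e)
          ... | _ | _ , b′≢y | inj₂ e | inj₂ (e′ , _) = b′≢y (≡.trans (≡.sym e′) e)

        valid : ∀ {p} → p ∈ touching ++ E₁ → proj₁ p ∈ W × proj₂ p ∈ W × proj₁ p ≢ proj₂ p × Antipodal V W (proj₁ p) (proj₂ p)
        valid i with ∈-++⁻ touching i
        valid i | inj₂ j with back j
        ... | _ , k , ((a∈ , a≢x) , (b∈ , _) , a≢b) , (a′∈ , b′∈) , ant , a~ , b~ =
          a′∈ , b′∈ , (λ { refl → a≢b (same a∈ b∈ a~ b~) }) , ant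
        valid i | inj₁ j with ∈touching j
        ... | inj₁ refl = x∈W , y∈W , x≢y , f , Vf , f-min , f-max
        ... | inj₂ (inj₁ (z , z∈A , refl)) = let z∈W , (z≢x , _) , ant = A⊆ z∈A in x∈W , z∈W , z≢x ∘ ≡.sym , ant
        ... | inj₂ (inj₂ (z , z∈B , refl)) = let z∈W , (_ , z≢y) , ant = B⊆ z∈B in y∈W , z∈W , z≢y ∘ ≡.sym , antipodal-sym sub ant

        |E| : length (touching ++ E₁) ≡ 1 ℕ.+ (length A ℕ.+ length B) ℕ.+ length E₀
        |E| = ≡.trans (List.length-++ touching) (≡.cong₂ ℕ._+_
          (≡.cong suc (≡.trans (List.length-++ (map (x ,_) A)) (≡.cong₂ ℕ._+_ (List.length-map (x ,_) A) (List.length-map (y ,_) B)))) |E₁|)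

      lift-pairs : ∀ E₀ → AntipodalPairs V′ W′ E₀ → (∀ {p} → p ∈ E₀ → proj₁ p ≢ x × proj₂ p ≢ x) →
        ∃[ E ] (AntipodalPairs V W E × length E ≡ 1 ℕ.+ (length A ℕ.+ length B) ℕ.+ length E₀)
      lift-pairs E₀ (E₀# , E₀-valid) E₀-away =
        assemble′ (choose {S′ = _≈ˢ_} PairLiftsTo lifts-injective E₀ E₀# lifted)
        where
        assemble′ : ∃[ E₁ ] (Distinctᴸ _≈ˢ_ E₁ × length E₁ ≡ length E₀ × (∀ {p′} → p′ ∈ E₁ → ∃[ p ] (p ∈ E₀ × PairLiftsTo p p′))
                       × (∀ {p} → p ∈ E₀ → ∃[ p′ ] (p′ ∈ E₁ × PairLiftsTo p p′)))
          → ∃[ E ] (AntipodalPairs V W E × length E ≡ 1 ℕ.+ (length A ℕ.+ length B) ℕ.+ length E₀)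
        assemble′ (E₁ , E₁# , |E₁| , back , _) = assemble E₁ E₁# |E₁| back

        lifted : ∀ {p} → p ∈ E₀ → ∃[ p′ ] PairLiftsTo p p′
        lifted i with E₀-valid i | E₀-away i
        ... | a∈W′ , b∈W′ , a≢b , ant | a≢x , b≢x = pair (lift (W′⊆ a∈W′) a∈W′ b∈W′ (λ _ → ≈-refl) ant)
          where
          pair : ∃[ b′ ] (b′ ∈ W × Antipodal V W _ b′ × Equivalent V′ _ b′) → ∃[ p′ ] PairLiftsTo _ p′
          pair (b′ , b′∈W , ant′ , b~b′) = _ , ((a∈W′ , a≢x) , (b∈W′ , b≢x) , a≢b) , (W′⊆ a∈W′ , b′∈W) , ant′ , (λ _ → ≈-refl) , b~b′

      -- If the contracted point is a vertex, no two points can be tied.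
      -- Every antipodal partner b of the contracted point lifts to a partner
      -- of x and to a partner of y, so one of these is redundant in A ++ B.
      LiftsTo : I → I → Set
      LiftsTo b b′ = b ∈ W′ × b′ ∈ B × Equivalent V′ b b′

      count-degree : ∀ {N} → (∀ {b} → b ∈ N → ∃[ a ] (a ∈ A × Equivalent V′ b a)) →
        ∀ M → Unique M → length M ≡ length N → (∀ {b′} → b′ ∈ M → ∃[ b ] (b ∈ N × LiftsTo b b′)) →
        ∀ {e e₁} → StrictMax e W′ x → V′ e₁ → (∀ {w w′} → w ∈ W → w′ ∈ W → e w < e w′ → e₁ w < e₁ w′) →
        (∀ {w w′} → w ∈ W → w′ ∈ W → e₁ w ≈ e₁ w′ → Equivalent V′ w w′) →
        d ℕ.+ length N ℕ.≤ length A ℕ.+ length B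
      count-degree {N} A-partner M M! |M| back {e} {e₁} e-max V′e₁ e₁-mono e₁-sep = ℕ.≤-trans (ℕ.+-monoˡ-≤ (length N) d≤)
          (≡.subst (ℕ._≤ length A ℕ.+ length B) (≡.sym (ℕ.+-assoc (length A) _ _)) (ℕ.+-monoʳ-≤ (length A) B-split))
        where
        ∉M? : Decidable (_∉ M)
        ∉M? z = lem
        B₀ = filter ∉M? B
        B₀⊆ : ∀ {z} → z ∈ B₀ → z ∈ B × z ∉ M
        B₀⊆ = ∈-filter⁻ ∉M? {xs = B}

        -- `M` consists of one partner of `y` over each member of `N`. It is removed from `B`
        -- because a direction that annihilates `A` annihilates `M` too.
        B-split : length B₀ ℕ.+ length N ℕ.≤ length B
        B-split = ≡.subst (ℕ._≤ length B) (≡.trans (List.length-++ B₀) (≡.cong (length B₀ ℕ.+_) |M|))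
          (unique-⊆⇒length-≤ {xs = B₀ ++ M} (Unique.++⁺ (Unique.filter⁺ ∉M? B!) M! (λ (i , j) → proj₂ (B₀⊆ i) j))
            (λ i → [ proj₁ ∘ B₀⊆ , (λ j → proj₁ (proj₂ (proj₂ (proj₂ (back j))))) ]′ (∈-++⁻ B₀ i)))

        e₁-max : ∀ {w} → w ∈ W → e₁ w ≤ e₁ x
        e₁-max w∈W with dominates V′e₁ w∈W
        ... | w′ , w′∈W′ , le with lem {w′ ≡ x}
        ... | yes refl = le
        ... | no ne    = ≤-trans le (<⇒≤ (e₁-mono (W′⊆ w′∈W′) x∈W (e-max w′∈W′ ne)))

        -- `e₁` attains its maximum over `W` at `x`, so in a tie both differences are nonpositive
        -- and must vanish. As `e₁` is generic, `z` would then be equivalent to `x`.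
        no-ties : ∀ {z z′} → z ∈ W → z ≢ x → z ≢ y → z′ ∈ W → ¬ Tied V′ x z z′
        no-ties {z} {z′} z∈W z≢x z≢y z′∈W (α , β , 0<α , 0<β , tie) =
          not-collinear z∈W z≢x z≢y (e₁-sep z∈W x∈W e₁z≈e₁x)
          where
          e₁z≈e₁x : e₁ z ≈ e₁ x
          e₁z≈e₁x = ≤-antisym (e₁-max z∈W) (*-cancelˡ-≤ α 0<α (≤-diff (β * (e₁ x - e₁ z′)) (*-nonNeg (<⇒≤ 0<β) (≤⇒0≤ (e₁-max z′∈W))) (begin
            α * e₁ x + β * (e₁ x - e₁ z′)     ≈⟨ solve 5 (λ α β a b c → α :* c :+ β :* (c :- b) := α :* a :- (α :* (a :- c) :+ β :* (b :- c))) ≈-refl α β (e₁ z) (e₁ z′) (e₁ x) ⟩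
            α * e₁ z - (α * (e₁ z - e₁ x) + β * (e₁ z′ - e₁ x))   ≈⟨ +-congˡ (-‿cong (tie V′e₁)) ⟩
            α * e₁ z - 0#                     ≈⟨ trans (+-congˡ -0#≈0#) (+-identityʳ _) ⟩
            α * e₁ z                          ∎)))
            where open SetoidReasoning setoid

        -- Were there fewer than `d` points in `A ++ B₀`, a nonconstant direction would annihilate
        -- them, hence all of `A` and `B`; sliding along it would end in a tie.
        d≤ : d ℕ.≤ length A ℕ.+ length B₀
        d≤ with ℕ.<-≤-connex (length A ℕ.+ length B₀) d
        ... | inj₂ le = le
        ... | inj₁ lt with annihilator (A ++ B₀) (≡.subst (ℕ._< d) (≡.sym (List.length-++ A)) lt)
        ... | q , V′q , kills , w , w∈W , moved with slide V′q killsA killsB w∈W moved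
          where
          killsA : ∀ {z} → z ∈ A → q z ≈ q x
          killsA = kills ∘ ∈-++⁺ˡ
          killsB : ∀ {z} → z ∈ B → q z ≈ q x
          killsB {z} z∈B with lem {z ∈ M}
          ... | no z∉M = kills (∈-++⁺ʳ A (∈-filter⁺ ∉M? z∈B z∉M))
          ... | yes z∈M with back z∈M
          ... | b , b∈N , _ , _ , b~z with A-partner b∈N
          ... | a , a∈A , b~a = trans (sym (b~z V′q)) (trans (b~a V′q) (killsA a∈A))
        ... | z , z′ , z∈W , z≢x , z≢y , _ , z′∈W , _ , _ , tie = ⊥-elim (no-ties z∈W z≢x z≢y z′∈W tie)

      contracted-degree : x ∈ W′ → ∀ N → Unique N → (∀ {b} → b ∈ N → b ∈ W′ × b ≢ x × Antipodal V′ W′ x b) →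
        d ℕ.+ length N ℕ.≤ length A ℕ.+ length B
      contracted-degree x∈W′ N N! N-valid =
          finish (exposed′ x∈W′) (choose {S = _≡_} {S′ = _≡_} LiftsTo lifts-injective₁ N N! partners)
        where
        lifts-injective₁ : ∀ {b c b′ c′} → LiftsTo b b′ → LiftsTo c c′ → b′ ≡ c′ → b ≡ c
        lifts-injective₁ (b∈ , _ , b~) (c∈ , _ , c~) refl =
          exposed-equivalent⇒≡ exposed′ b∈ c∈ (λ V′q → trans (b~ V′q) (sym (c~ V′q)))

        B-partner : ∀ {b} → b ∈ W′ → b ≢ x → ∃[ b′ ] (b′ ∈ W × Antipodal V W y b′ × Equivalent V′ b b′) → ∃[ b′ ] LiftsTo b b′
        B-partner b∈W′ b≢x (b′ , b′∈W , ant′ , b~b′) =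
          b′ , b∈W′ , ∈-filter⁺ B? b′∈W (away-lift b∈W′ b≢x b~b′ , antipodal-sym sub ant′) , b~b′

        partners : ∀ {b} → b ∈ N → ∃[ b′ ] LiftsTo b b′
        partners {b} i with N-valid i
        ... | b∈W′ , b≢x , ant = B-partner b∈W′ b≢x (lift {y} {x} {b} y∈W x∈W′ b∈W′ (λ V′q → sym (proj₂ V′q)) ant)

        A-partner : ∀ {b} → b ∈ W′ → b ≢ x → ∃[ a ] (a ∈ W × Antipodal V W x a × Equivalent V′ b a) → ∃[ a ] (a ∈ A × Equivalent V′ b a)
        A-partner b∈W′ b≢x (a , a∈W , ant′ , b~a) = a , ∈-filter⁺ A? a∈W (away-lift b∈W′ b≢x b~a , ant′) , b~a

        A-partners : ∀ {b} → b ∈ N → ∃[ a ] (a ∈ A × Equivalent V′ b a)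
        A-partners {b} i with N-valid i
        ... | b∈W′ , b≢x , ant = A-partner b∈W′ b≢x (lift {x} {x} {b} x∈W x∈W′ b∈W′ (λ V′q → ≈-refl) ant)

        finish : Exposed V′ W′ x →
          ∃[ M ] (Unique M × length M ≡ length N × (∀ {b′} → b′ ∈ M → ∃[ b ] (b ∈ N × LiftsTo b b′))
            × (∀ {b} → b ∈ N → ∃[ b′ ] (b′ ∈ M × LiftsTo b b′))) →
          d ℕ.+ length N ℕ.≤ length A ℕ.+ length B
        finish (e , V′e , e-max) (M , M! , |M| , back , _) = refine (genericOn sub′ W V′e)
          where
          refine : ∃[ e₁ ] (V′ e₁ × (∀ {w w′} → w ∈ W → w′ ∈ W → e w < e w′ → e₁ w < e₁ w′)
            × (∀ {w w′} → w ∈ W → w′ ∈ W → e₁ w ≈ e₁ w′ → Equivalent V′ w w′)) → d ℕ.+ length N ℕ.≤ length A ℕ.+ length B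
          refine (e₁ , V′e₁ , e₁-mono , e₁-sep) = count-degree {N} A-partners M M! |M| back {e} {e₁} e-max V′e₁ e₁-mono e₁-sep

-- Induction on the rank.

module Induction (lem : ExcludedMiddle 0ℓ) (ℝ : Reals) {I : Set} where
  open Lists
  open Reals ℝ hiding (zero) renaming (refl to ≈-refl)
  open OrderedField lem ℝ
  open Spaces lem ℝ
  open Sliding lem ℝ {I}
  open LowerBound lem ℝ {I}

  module Step {V : Functions} (sub : IsSubspace V) {W : List I} (W! : Unique W)
    (exposed : ∀ {w} → w ∈ W → Exposed V W w)
    {x y : I} (x∈W : x ∈ W) (y∈W : y ∈ W) (x≢y : x ≢ y)
    {f : I → Carrier} (Vf : V f) (f-min : StrictMin f W x) (f-max : StrictMax f W y)
    {d : ℕ} (rank : HasRank V W (suc d))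
    {W′ : List I} (W′! : Unique W′) (W′⊆ : ∀ {w} → w ∈ W′ → w ∈ W) (y∉W′ : y ∉ W′)
    (dominates : Dominates (Identify V x y) W W′) (exposed′ : ∀ {w} → w ∈ W′ → Exposed (Identify V x y) W′ w) where

    open Contraction sub W! exposed x∈W y∈W x≢y Vf f-min f-max rank

    rank′ : HasRank V′ W′ d
    rank′ l len with rank ((x , y) ∷ l) (s≤s len)
    ... | q , Vq , kills , w , w′ , w∈W , w′∈W , w<w′ =
      q , V′q , kills ∘ there , separate (dominates (IsSubspace.neg-closed sub′ V′q) w∈W) (dominates V′q w′∈W)
      where
      V′q : V′ q
      V′q = Vq , kills (here refl)
      separate : ∃[ u ] (u ∈ W′ × - 1# * q w ≤ - 1# * q u) → ∃[ u ] (u ∈ W′ × q w′ ≤ q u) →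
        ∃[ u ] ∃[ u′ ] (u ∈ W′ × u′ ∈ W′ × q u < q u′)
      separate (u , u∈W′ , le) (u′ , u′∈W′ , le′) = u , u′ , u∈W′ , u′∈W′ ,
        ≤-<-trans (≮⇒≥ (λ w<u → <⇒≱ (neg-< w<u) le)) (<-≤-trans w<w′ le′)

    Goal : ℕ → ℕ → Set
    Goal v s = ∃[ E ] (AntipodalPairs V W E × v ℕ.* s ℕ.≤ 2 ℕ.* length E)

    -- Pairs of `E′` at the contracted vertex are discarded, since their lifts would contain `x` or
    -- `y` and may already be in `touching`. There are at most `length N` of them, and `degree`
    -- gives these back and `d` more. With the pair `x`, `y` itself the gain is `d + 1`, half of
    -- `suc u * suc s - u * s`.
    vertex-step : x ∈ W′ → ∀ u s → u ℕ.+ s ≡ suc (2 ℕ.* d) →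
      ∀ E′ → AntipodalPairs V′ W′ E′ → u ℕ.* s ℕ.≤ 2 ℕ.* length E′ → Goal (suc u) (suc s)
    vertex-step x∈W′ u s eq E′ (E′# , E′-valid) bound =
      conclude (lift-pairs W′! W′⊆ y∉W′ dominates exposed′ E₀ (AllPairs.filter⁺ away? E′# , E′-valid ∘ proj₁ ∘ E₀⊆) (proj₂ ∘ E₀⊆))
      where
      Away : I × I → Set
      Away (a , b) = a ≢ x × b ≢ x
      away? : Decidable Away
      away? p = lem
      touches? : Decidable (¬_ ∘ Away)
      touches? p = lem
      E₀ = filter away? E′
      E₀⊆ : ∀ {p} → p ∈ E₀ → p ∈ E′ × Away p
      E₀⊆ = ∈-filter⁻ away? {xs = E′}
      Eₓ = filter touches? E′
      N? : Decidable (λ b → b ≢ x × Antipodal V′ W′ x b)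
      N? b = lem
      N = filter N? W′

      Eₓ≤N : length Eₓ ℕ.≤ length N
      Eₓ≤N = length-injection {ys = N} {S = _≈ˢ_} (λ (a , b) n → (a ≡ x × b ≡ n) ⊎ (b ≡ x × a ≡ n)) swap-same
               (AllPairs.filter⁺ touches? E′#) partner
        where
        swap-same : ∀ {p q : I × I} {n} → (proj₁ p ≡ x × proj₂ p ≡ n) ⊎ (proj₂ p ≡ x × proj₁ p ≡ n) →
          (proj₁ q ≡ x × proj₂ q ≡ n) ⊎ (proj₂ q ≡ x × proj₁ q ≡ n) → p ≈ˢ q
        swap-same (inj₁ (refl , refl)) (inj₁ (refl , refl)) = inj₁ (refl , refl)
        swap-same (inj₁ (refl , refl)) (inj₂ (refl , refl)) = inj₂ (refl , refl)
        swap-same (inj₂ (refl , refl)) (inj₁ (refl , refl)) = inj₂ (refl , refl)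
        swap-same (inj₂ (refl , refl)) (inj₂ (refl , refl)) = inj₁ (refl , refl)
        partner : ∀ {p} → p ∈ Eₓ → ∃[ n ] (n ∈ N × ((proj₁ p ≡ x × proj₂ p ≡ n) ⊎ (proj₂ p ≡ x × proj₁ p ≡ n)))
        partner {a , b} i with ∈-filter⁻ touches? {xs = E′} i
        ... | j , ¬away with E′-valid j | lem {a ≡ x} | lem {b ≡ x}
        ... | a∈ , b∈ , a≢b , ant | yes refl | _ = b , ∈-filter⁺ N? b∈ (a≢b ∘ ≡.sym , ant) , inj₁ (refl , refl)
        ... | a∈ , b∈ , a≢b , ant | no _ | yes refl = a , ∈-filter⁺ N? a∈ (a≢b , antipodal-sym sub′ ant) , inj₂ (refl , refl)
        ... | _ | no a≢x | no b≢x = contradiction (a≢x , b≢x) ¬away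

      degree : d ℕ.+ length N ℕ.≤ length A ℕ.+ length B
      degree = contracted-degree W′! W′⊆ y∉W′ dominates exposed′ x∈W′ N (Unique.filter⁺ N? W′!) (∈-filter⁻ N? {xs = W′})

      conclude : ∃[ E ] (AntipodalPairs V W E × length E ≡ 1 ℕ.+ (length A ℕ.+ length B) ℕ.+ length E₀) → Goal (suc u) (suc s)
      conclude (E , E-pairs , |E|) = E , E-pairs , (begin
        suc u ℕ.* suc s                                                    ≡⟨ expand u s ⟩
        suc (u ℕ.+ s) ℕ.+ u ℕ.* s                                          ≤⟨ ℕ.+-mono-≤ (ℕ.≤-reflexive (≡.cong suc eq)) bound ⟩
        suc (suc (2 ℕ.* d)) ℕ.+ 2 ℕ.* length E′                            ≡⟨ ≡.cong (λ k → suc (suc (2 ℕ.* d)) ℕ.+ 2 ℕ.* k) (length-filter-∁ away? touches? E′) ⟩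
        suc (suc (2 ℕ.* d)) ℕ.+ 2 ℕ.* (length E₀ ℕ.+ length Eₓ)            ≤⟨ ℕ.+-monoʳ-≤ (suc (suc (2 ℕ.* d))) (ℕ.*-monoʳ-≤ 2 (ℕ.+-monoʳ-≤ (length E₀) Eₓ≤N)) ⟩
        suc (suc (2 ℕ.* d)) ℕ.+ 2 ℕ.* (length E₀ ℕ.+ length N)             ≡⟨ regroup d (length E₀) (length N) ⟩
        2 ℕ.* (1 ℕ.+ (d ℕ.+ length N) ℕ.+ length E₀)                       ≤⟨ ℕ.*-monoʳ-≤ 2 (ℕ.+-monoˡ-≤ (length E₀) (s≤s degree)) ⟩
        2 ℕ.* (1 ℕ.+ (length A ℕ.+ length B) ℕ.+ length E₀)                ≡⟨ ≡.cong (2 ℕ.*_) |E| ⟨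
        2 ℕ.* length E                                                     ∎)
        where
        open ℕ.≤-Reasoning
        expand : ∀ u s → suc u ℕ.* suc s ≡ suc (u ℕ.+ s) ℕ.+ u ℕ.* s
        expand = ℕSolver.solve-∀
        regroup : ∀ d e n → suc (suc (2 ℕ.* d)) ℕ.+ 2 ℕ.* (e ℕ.+ n) ≡ 2 ℕ.* (1 ℕ.+ (d ℕ.+ n) ℕ.+ e)
        regroup = ℕSolver.solve-∀

    -- No pair of `E′` is discarded here, since `x` is not in `W′`. The product grows by `2 s`, so
    -- `s` new pairs are needed; `rank-bound` with `length W ≤ 2 + u` supplies `s - 1` of them, and
    -- the pair `x`, `y` is one more.
    nonvertex-step : x ∉ W′ → ∀ u s → u ℕ.+ s ≡ suc (2 ℕ.* d) → length W ℕ.≤ 2 ℕ.+ u →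
      ∀ E′ → AntipodalPairs V′ W′ E′ → u ℕ.* s ℕ.≤ 2 ℕ.* length E′ → Goal (2 ℕ.+ u) s
    nonvertex-step x∉W′ u s eq |W|≤ E′ E′-pairs@(_ , E′-valid) bound =
      conclude (lift-pairs W′! W′⊆ y∉W′ dominates exposed′ E′ E′-pairs away)
      where
      away : ∀ {p} → p ∈ E′ → proj₁ p ≢ x × proj₂ p ≢ x
      away i = (λ { refl → x∉W′ (proj₁ (E′-valid i)) }) , (λ { refl → x∉W′ (proj₁ (proj₂ (E′-valid i))) })

      s≤ : s ℕ.≤ 1 ℕ.+ (length A ℕ.+ length B)
      s≤ = ℕ.+-cancelˡ-≤ (2 ℕ.+ u) _ _ (begin
        2 ℕ.+ u ℕ.+ s                                    ≡⟨ ≡.cong (2 ℕ.+_) eq ⟩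
        3 ℕ.+ 2 ℕ.* d                                    ≡⟨ regroup d ⟩
        suc (2 ℕ.* suc d)                                ≤⟨ s≤s rank-bound ⟩
        suc (length A ℕ.+ length B ℕ.+ length W)         ≤⟨ s≤s (ℕ.+-monoʳ-≤ (length A ℕ.+ length B) |W|≤) ⟩
        suc (length A ℕ.+ length B) ℕ.+ (2 ℕ.+ u)        ≡⟨ ℕ.+-comm (suc (length A ℕ.+ length B)) (2 ℕ.+ u) ⟩
        (2 ℕ.+ u) ℕ.+ suc (length A ℕ.+ length B)        ∎)
        where
        open ℕ.≤-Reasoning
        regroup : ∀ d → 3 ℕ.+ 2 ℕ.* d ≡ suc (2 ℕ.* suc d)
        regroup = ℕSolver.solve-∀

      conclude : ∃[ E ] (AntipodalPairs V W E × length E ≡ 1 ℕ.+ (length A ℕ.+ length B) ℕ.+ length E′) → Goal (2 ℕ.+ u) s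
      conclude (E , E-pairs , |E|) = E , E-pairs , (begin
        (2 ℕ.+ u) ℕ.* s                                          ≡⟨ ℕ.*-distribʳ-+ s 2 u ⟩
        2 ℕ.* s ℕ.+ u ℕ.* s                                      ≤⟨ ℕ.+-mono-≤ (ℕ.*-monoʳ-≤ 2 s≤) bound ⟩
        2 ℕ.* (1 ℕ.+ (length A ℕ.+ length B)) ℕ.+ 2 ℕ.* length E′ ≡⟨ ℕ.*-distribˡ-+ 2 (1 ℕ.+ (length A ℕ.+ length B)) (length E′) ⟨
        2 ℕ.* (1 ℕ.+ (length A ℕ.+ length B) ℕ.+ length E′)      ≡⟨ ≡.cong (2 ℕ.*_) |E| ⟨
        2 ℕ.* length E                                           ∎)
        where open ℕ.≤-Reasoning

  -- The equation for `v + s` encodes `s = 2d + 1 - v` without subtraction; for `s = 0` nothing is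
  -- claimed. That `v` only bounds `length W` is what the recursion needs: `W′` may be smaller than
  -- the removal of `x` or `y` accounts for.
  antipodal-bound : ∀ d {V} → IsSubspace V → ∀ {W} → Unique W → (∀ {w} → w ∈ W → Exposed V W w) → HasRank V W d →
    ∀ v s → v ℕ.+ s ≡ suc (2 ℕ.* d) → length W ℕ.≤ v → ∃[ E ] (AntipodalPairs V W E × v ℕ.* s ℕ.≤ 2 ℕ.* length E)
  antipodal-bound d sub W! exposed rank v zero eq |W|≤v = [] , ([] , λ ()) , ℕ.≤-reflexive (ℕ.*-zeroʳ v)
  antipodal-bound zero sub W! exposed rank zero (suc s) eq |W|≤v = [] , ([] , λ ()) , z≤n
  antipodal-bound zero sub W! exposed rank (suc zero) (suc s) () |W|≤v
  antipodal-bound zero sub W! exposed rank (suc (suc v)) (suc s) () |W|≤v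
  antipodal-bound (suc d) {V} sub {W} W! exposed rank v s@(suc s₁) eq |W|≤v =
      contract (antipodal-exists sub exposed rank)
    where
    Goal = ∃[ E ] (AntipodalPairs V W E × v ℕ.* s ℕ.≤ 2 ℕ.* length E)

    contract : ∃[ x ] ∃[ y ] (x ∈ W × y ∈ W × x ≢ y × Antipodal V W x y) → Goal
    contract (x , y , x∈W , y∈W , x≢y , f , Vf , f-min , f-max) =
        step (reduce (Identify V x y) (length W₀) W₀ ℕ.≤-refl (Unique.filter⁺ ≢y? W!))
      where
      ≢y? : Decidable (_≢ y)
      ≢y? w = lem
      W₀ = filter ≢y? W
      W₀⊆ : ∀ {w} → w ∈ W₀ → w ∈ W × w ≢ y
      W₀⊆ = ∈-filter⁻ ≢y? {xs = W}
      V′ = Identify V x y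

      dominates₀ : Dominates V′ W W₀
      dominates₀ V′f {w} w∈W with lem {w ≡ y}
      ... | no w≢y   = w , ∈-filter⁺ ≢y? w∈W w≢y , ≤-refl
      ... | yes refl = x , ∈-filter⁺ ≢y? x∈W x≢y , ≤-reflexive (sym (proj₂ V′f))

      step : ∃[ W′ ] (Unique W′ × (∀ {w} → w ∈ W′ → w ∈ W₀) × Dominates V′ W₀ W′ × (∀ {w} → w ∈ W′ → Exposed V′ W′ w)) → Goal
      step (W′ , W′! , W′⊆₀ , dominates₁ , exposed′) = cases lem
        where
        W′⊆ : ∀ {w} → w ∈ W′ → w ∈ W
        W′⊆ i = proj₁ (W₀⊆ (W′⊆₀ i))
        y∉W′ : y ∉ W′
        y∉W′ i = proj₂ (W₀⊆ (W′⊆₀ i)) refl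
        dominates : Dominates V′ W W′
        dominates V′f w∈W with dominates₀ V′f w∈W
        ... | u , u∈W₀ , le with dominates₁ V′f u∈W₀
        ... | u′ , u′∈W′ , le′ = u′ , u′∈W′ , ≤-trans le le′

        module S = Step sub W! exposed x∈W y∈W x≢y Vf f-min f-max rank W′! W′⊆ y∉W′ dominates exposed′

        y∷W′ : suc (length W′) ℕ.≤ length W
        y∷W′ = unique-⊆⇒length-≤ {xs = y ∷ W′} (All.tabulate (λ i e → y∉W′ (≡.subst (_∈ W′) (≡.sym e) i)) ∷ W′!)
          (λ { (here refl) → y∈W ; (there i) → W′⊆ i })

        cases : Dec (x ∈ W′) → Goal
        cases (yes x∈W′) = go v eq |W|≤v
          where
          go : ∀ v → v ℕ.+ s ≡ suc (2 ℕ.* suc d) → length W ℕ.≤ v → S.Goal v s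
          go zero    _  |W|≤0 = contradiction (ℕ.≤-trans y∷W′ |W|≤0) λ ()
          go (suc u) eq |W|≤v =
            let E′ , pairs , bound = antipodal-bound d (identify-subspace sub) W′! exposed′ S.rank′ u s₁ eq′ (ℕ.≤-pred (ℕ.≤-trans y∷W′ |W|≤v))
            in S.vertex-step x∈W′ u s₁ eq′ E′ pairs bound
            where
            eq′ : u ℕ.+ s₁ ≡ suc (2 ℕ.* d)
            eq′ = ℕ.suc-injective (ℕ.suc-injective (≡.trans (≡.cong suc (≡.sym (ℕ.+-suc u s₁))) (≡.trans eq (≡.cong suc (ℕ.*-suc 2 d)))))
        cases (no x∉W′) = go v eq |W|≤v
          where
          xy∷W′ : 2 ℕ.+ length W′ ℕ.≤ length W
          xy∷W′ = unique-⊆⇒length-≤ {xs = x ∷ y ∷ W′}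
            ((x≢y ∷ All.tabulate (λ i e → x∉W′ (≡.subst (_∈ W′) (≡.sym e) i))) ∷ All.tabulate (λ i e → y∉W′ (≡.subst (_∈ W′) (≡.sym e) i)) ∷ W′!)
            (λ { (here refl) → x∈W ; (there (here refl)) → y∈W ; (there (there i)) → W′⊆ i })
          go : ∀ v → v ℕ.+ s ≡ suc (2 ℕ.* suc d) → length W ℕ.≤ v → S.Goal v s
          go zero          _  |W|≤v = contradiction (ℕ.≤-trans xy∷W′ |W|≤v) λ ()
          go (suc zero)    _  |W|≤v = contradiction (ℕ.≤-trans xy∷W′ |W|≤v) λ { (s≤s ()) }
          go (suc (suc u)) eq |W|≤v =
            let E′ , pairs , bound = antipodal-bound d (identify-subspace sub) W′! exposed′ S.rank′ u s eq′ (ℕ.≤-pred (ℕ.≤-pred (ℕ.≤-trans xy∷W′ |W|≤v)))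
            in S.nonvertex-step x∉W′ u s eq′ |W|≤v E′ pairs bound
            where
            eq′ : u ℕ.+ s ≡ suc (2 ℕ.* d)
            eq′ = ℕ.suc-injective (ℕ.suc-injective (≡.trans eq (≡.cong suc (ℕ.*-suc 2 d))))

-- From point sets and hyperplanes to functionals on indices, and back.

module Points (lem : ExcludedMiddle 0ℓ) (ℝ : Reals) where
  open Lists
  open Reals ℝ hiding (zero) renaming (refl to ≈-refl)
  open OrderedField lem ℝ
  open Spaces lem ℝ
  open Geometry ℝ
  open Hyperplane
  open Sum semiring using (sum-cong-≋; ∑-distrib-+; ∑-comm; *-distribˡ-sum; *-distribʳ-sum; sum-replicate-zero)
  open SetoidReasoning setoid

  private variable
    n d : ℕ

  sum-zero : (t : Vector Carrier n) → (∀ i → t i ≈ 0#) → sum t ≈ 0#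
  sum-zero {n} t t≈0 = trans (sum-cong-≋ t≈0) (sum-replicate-zero n)

  sum-⊕ : ∀ ε (s t : Vector Carrier n) → sum (λ i → s i + ε * t i) ≈ sum s + ε * sum t
  sum-⊕ ε s t = trans (∑-distrib-+ s (λ i → ε * t i)) (+-congˡ (sym (*-distribˡ-sum ε t)))

  δ : Fin n → Vector Carrier n
  δ zero    zero    = 1#
  δ zero    (suc j) = 0#
  δ (suc i) zero    = 0#
  δ (suc i) (suc j) = δ i j

  δ-diag : (i : Fin n) → δ i i ≈ 1#
  δ-diag zero    = ≈-refl
  δ-diag (suc i) = δ-diag i

  δ-off : {i j : Fin n} → i ≢ j → δ i j ≈ 0#
  δ-off {i = zero}  {zero}  i≢j = contradiction refl i≢j
  δ-off {i = zero}  {suc j} i≢j = ≈-refl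
  δ-off {i = suc i} {zero}  i≢j = ≈-refl
  δ-off {i = suc i} {suc j} i≢j = δ-off (i≢j ∘ ≡.cong suc)

  δ-nonNeg : (i j : Fin n) → 0# ≤ δ i j
  δ-nonNeg i j with i Fin.≟ j
  ... | yes refl = ≤-resp ≈-refl (sym (δ-diag i)) 0≤1
  ... | no i≢j   = ≤-reflexive (sym (δ-off i≢j))

  sum-δ* : (i : Fin n) (t : Vector Carrier n) → sum (λ j → δ i j * t j) ≈ t i
  sum-δ* zero t = begin
    1# * t zero + sum (λ j → 0# * t (suc j))   ≈⟨ +-cong (*-identityˡ _) (sum-zero (λ j → 0# * t (suc j)) (λ j → zeroˡ _)) ⟩
    t zero + 0#                                ≈⟨ +-identityʳ _ ⟩
    t zero                                     ∎
  sum-δ* (suc i) t = trans (+-cong (zeroˡ _) (sum-δ* i (t ∘ suc))) (+-identityˡ _)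

  sum-δ : (i : Fin n) → sum (δ i) ≈ 1#
  sum-δ i = trans (sum-cong-≋ (λ j → sym (*-identityʳ (δ i j)))) (sum-δ* i (λ _ → 1#))

  ·-cong : {u v p q : Point d} → (∀ i → u i ≈ v i) → p ≋ q → u · p ≈ v · q
  ·-cong u≈v p≋q = sum-cong-≋ (λ i → *-cong (u≈v i) (p≋q i))

  ·-comm : (u p : Point d) → u · p ≈ p · u
  ·-comm u p = sum-cong-≋ (λ i → *-comm (u i) (p i))

  ·-⊕ˡ : ∀ ε (u v p : Point d) → (λ i → u i + ε * v i) · p ≈ u · p + ε * (v · p)
  ·-⊕ˡ ε u v p = trans (sum-cong-≋ (λ i → trans (distribʳ (p i) (u i) (ε * v i)) (+-congˡ (*-assoc ε (v i) (p i)))))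
    (sum-⊕ ε (λ i → u i * p i) (λ i → v i * p i))

  ·-⊕ʳ : ∀ ε (u p q : Point d) → u · (λ i → p i + ε * q i) ≈ u · p + ε * (u · q)
  ·-⊕ʳ ε u p q = trans (·-comm u _) (trans (·-⊕ˡ ε p q u) (+-cong (·-comm p u) (*-congˡ (·-comm q u))))

  ·-*ˡ : ∀ ε (u p : Point d) → (λ i → ε * u i) · p ≈ ε * (u · p)
  ·-*ˡ ε u p = trans (sum-cong-≋ (λ i → *-assoc ε (u i) (p i))) (sym (*-distribˡ-sum ε (λ i → u i * p i)))

  ·-*ʳ : ∀ ε (u p : Point d) → u · (λ i → ε * p i) ≈ ε * (u · p)
  ·-*ʳ ε u p = trans (·-comm u _) (trans (·-*ˡ ε p u) (*-congˡ (·-comm p u)))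

  ·-combination : ∀ (u : Point d) (c : Vector Carrier n) (X : Vector (Point d) n) →
    u · combination c X ≈ sum (λ l → c l * (u · X l))
  ·-combination u c X = begin
    sum (λ j → u j * sum (λ l → c l * X l j))     ≈⟨ sum-cong-≋ (λ j → *-distribˡ-sum (u j) (λ l → c l * X l j)) ⟩
    sum (λ j → sum (λ l → u j * (c l * X l j)))   ≈⟨ ∑-comm (λ j l → u j * (c l * X l j)) ⟩
    sum (λ l → sum (λ j → u j * (c l * X l j)))   ≈⟨ sum-cong-≋ (λ l → sum-cong-≋ (λ j → solve 3 (λ a b c → a :* (b :* c) := b :* (a :* c)) ≈-refl (u j) (c l) (X l j))) ⟩
    sum (λ l → sum (λ j → c l * (u j * X l j)))   ≈⟨ sum-cong-≋ (λ l → sym (*-distribˡ-sum (c l) (λ j → u j * X l j))) ⟩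
    sum (λ l → c l * (u · X l))                   ∎

  -- Gaussian elimination of the first unknown: if no equation involves it, the first unit vector is
  -- a solution; otherwise an equation that does is used to eliminate it from the others and to
  -- recover it at the end.
  linear-system : ∀ d (l : List (Point d)) → length l ℕ.< d →
    ∃[ a ] (¬ (∀ i → a i ≈ 0#) × (∀ {r} → r ∈ l → a · r ≈ 0#))
  linear-system (suc d) l len with lem {∃[ r ] (r ∈ l × r zero ≉ 0#)}
  ... | no ∄r = δ zero , (λ δ≈0 → 1≉0 (δ≈0 zero)) , λ {r} r∈l → trans (sum-δ* zero r) (vanishes r∈l)
    where
    vanishes : ∀ {r} → r ∈ l → r zero ≈ 0#
    vanishes {r} r∈l with lem {r zero ≈ 0#}
    ... | yes e = e
    ... | no ne = contradiction (r , r∈l , ne) ∄r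
  ... | yes (r , r∈l , r₀≉0) with ∈-∃++ r∈l
  ... | us , vs , refl with linear-system d (map eliminate (us ++ vs)) smaller
    where
    eliminate : Point (suc d) → Point d
    eliminate s j = s (suc j) + (- (s zero * r zero ⁻¹)) * r (suc j)
    smaller : length (map eliminate (us ++ vs)) ℕ.< d
    smaller = ≡.subst (ℕ._< d) (≡.sym (List.length-map eliminate (us ++ vs)))
      (ℕ.≤-pred (≡.subst (ℕ._< suc d) (≡.trans (List.length-++ us)
        (≡.trans (ℕ.+-suc (length us) (length vs)) (≡.cong suc (≡.sym (List.length-++ us))))) len))
  ... | b , b≉0 , b-kills = a , (λ a≈0 → b≉0 (a≈0 ∘ suc)) , a-kills
    where
    b·r = b · (r ∘ suc)
    a : Point (suc d)
    a zero    = - (r zero ⁻¹ * b·r)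
    a (suc j) = b j
    a-kills-others : ∀ {s} → s ∈ us ++ vs → a · s ≈ 0#
    a-kills-others {s} i = begin
      - (r zero ⁻¹ * b·r) * s zero + b · (s ∘ suc)                 ≈⟨ solve 4 (λ i t x y → :- (i :* t) :* x :+ y := y :+ (:- (x :* i)) :* t) ≈-refl (r zero ⁻¹) b·r (s zero) (b · (s ∘ suc)) ⟩
      b · (s ∘ suc) + (- (s zero * r zero ⁻¹)) * b·r               ≈⟨ ·-⊕ʳ _ b (s ∘ suc) (r ∘ suc) ⟨
      b · (λ j → s (suc j) + (- (s zero * r zero ⁻¹)) * r (suc j)) ≈⟨ b-kills (∈-map⁺ _ i) ⟩
      0#                                                           ∎
    a-kills : ∀ {s} → s ∈ us ++ r ∷ vs → a · s ≈ 0#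
    a-kills i with ∈-++⁻ us i
    ... | inj₁ j           = a-kills-others (∈-++⁺ˡ j)
    ... | inj₂ (there j)   = a-kills-others (∈-++⁺ʳ us j)
    ... | inj₂ (here refl) = begin
      - (r zero ⁻¹ * b·r) * r zero + b·r     ≈⟨ solve 3 (λ i t x → :- (i :* t) :* x :+ t := t :- (x :* i) :* t) ≈-refl (r zero ⁻¹) b·r (r zero) ⟩
      b·r - (r zero * r zero ⁻¹) * b·r       ≈⟨ +-congˡ (-‿cong (trans (*-congʳ (*-inverseʳ r₀≉0)) (*-identityˡ b·r))) ⟩
      b·r - b·r                              ≈⟨ -‿inverseʳ b·r ⟩
      0#                                     ∎

  module Configuration {n d : ℕ} (X : Vector (Point d) n) where
    open LowerBound lem ℝ {Fin n} using (HasRank; AntipodalPairs)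

    Functionals : Functions {Fin n}
    Functionals f = ∃[ a ] (∀ i → f i ≈ a · X i)

    functional : (a : Point d) → Functionals (λ i → a · X i)
    functional a = a , λ _ → ≈-refl

    functionals-subspace : IsSubspace Functionals
    functionals-subspace .IsSubspace.⊕-closed ε (a , f≈) (b , g≈) =
      (λ i → a i + ε * b i) , λ i → trans (+-cong (f≈ i) (*-congˡ (g≈ i))) (sym (·-⊕ˡ ε a b (X i)))
    functionals-subspace .IsSubspace.*-closed ε (a , f≈) =
      (λ i → ε * a i) , λ i → trans (*-congˡ (f≈ i)) (sym (·-*ˡ ε a (X i)))

    all! : Unique (allFin n)
    all! = Unique.allFin⁺ n

    -- Fewer than `d` equations on `a` leave a nonzero solution. Were it constant on the points, it
    -- would be constant on their affine hull, which is the whole space, and hence zero.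
    full-rank : (∀ p → p ∈′ aff X) → HasRank Functionals (allFin n) d
    full-rank fullDim l len with linear-system d (map (λ (p , q) j → X p j + (- 1#) * X q j) l) (≡.subst (ℕ._< d) (≡.sym (List.length-map _ l)) len)
    ... | a , a≉0 , a-kills = _ , functional a , kills , nonconstant lem
      where
      kills : ∀ {p} → p ∈ l → a · X (proj₁ p) ≈ a · X (proj₂ p)
      kills {p , q} i = x-y≈0⇒x≈y (trans (sym (trans (·-⊕ʳ (- 1#) a (X p) (X q)) (+-congˡ (-1* _)))) (a-kills (∈-map⁺ _ i)))
      nonconstant : Dec (∃[ w ] ∃[ w′ ] (w ∈ allFin n × w′ ∈ allFin n × a · X w < a · X w′)) →
        ∃[ w ] ∃[ w′ ] (w ∈ allFin n × w′ ∈ allFin n × a · X w < a · X w′)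
      nonconstant (yes p) = p
      nonconstant (no ∄p) = ⊥-elim (a≉0 (λ i → trans (sym (sum-δ* i a)) (trans (·-comm (δ i) a)
          (trans (equal (δ i) (λ _ → 0#)) (sum-zero (λ j → a j * 0#) (λ j → zeroʳ (a j)))))))
        where
        const : ∀ i j → a · X i ≈ a · X j
        const i j with lem {a · X i ≈ a · X j}
        ... | yes e = e
        ... | no ne with ≉⇒<⊎> ne
        ... | inj₁ lt = contradiction (i , j , ∈-allFin i , ∈-allFin j , lt) ∄p
        ... | inj₂ gt = contradiction (j , i , ∈-allFin j , ∈-allFin i , gt) ∄p
        value : ∀ m (Y : Vector (Point d) m) → (∀ i j → a · Y i ≈ a · Y j) → ∀ p p′ → p ∈′ aff Y → p′ ∈′ aff Y → a · p ≈ a · p′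
        value zero    Y _ p p′ (c , Σc≈1 , _) _ = contradiction (sym Σc≈1) 1≉0
        value (suc m) Y c p p′ p∈ p′∈ = trans (at p p∈) (sym (at p′ p′∈))
          where
          at : ∀ p → p ∈′ aff Y → a · p ≈ a · Y zero
          at p (w , Σw≈1 , p≋) = begin
            a · p                                  ≈⟨ ·-cong (λ _ → ≈-refl) p≋ ⟩
            a · combination w Y                    ≈⟨ ·-combination a w Y ⟩
            sum (λ l → w l * (a · Y l))            ≈⟨ sum-cong-≋ (λ l → *-congˡ {w l} (c l zero)) ⟩
            sum (λ l → w l * (a · Y zero))         ≈⟨ *-distribʳ-sum (a · Y zero) w ⟨
            sum w * (a · Y zero)                   ≈⟨ *-congʳ Σw≈1 ⟩
            1# * (a · Y zero)                      ≈⟨ *-identityˡ _ ⟩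
            a · Y zero                             ∎
        equal : ∀ p p′ → a · p ≈ a · p′
        equal p p′ = value n X const p p′ (fullDim p) (fullDim p′)

    StrictlyBelow StrictlyAbove : Point d → Fin n → Set
    StrictlyBelow a i = ∀ l → l ≢ i → a · X l < a · X i
    StrictlyAbove a i = ∀ l → l ≢ i → a · X i < a · X l

    point∈conv : ∀ i → X i ∈′ conv X
    point∈conv i = δ i , δ-nonNeg i , sum-δ i , λ j → sym (sum-δ* i (λ l → X l j))

    gap : ∀ (a : Point d) b {p} (c : Vector Carrier n) → sum c ≈ 1# → p ≋ combination c X →
      sum (λ l → c l * (b - a · X l)) ≈ b - a · p
    gap a b {p} c Σc≈1 p≋ = begin
      sum (λ l → c l * (b - a · X l))                         ≈⟨ sum-cong-≋ (λ l → solve 3 (λ c b x → c :* (b :- x) := c :* b :+ (:- :1) :* (c :* x)) ≈-refl (c l) b (a · X l)) ⟩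
      sum (λ l → c l * b + (- 1#) * (c l * (a · X l)))        ≈⟨ sum-⊕ (- 1#) (λ l → c l * b) (λ l → c l * (a · X l)) ⟩
      sum (λ l → c l * b) + (- 1#) * sum (λ l → c l * (a · X l)) ≈⟨ +-cong (sym (*-distribʳ-sum b c)) (-1* _) ⟩
      sum c * b - sum (λ l → c l * (a · X l))                 ≈⟨ +-cong (trans (*-congʳ Σc≈1) (*-identityˡ b)) (-‿cong (sym (trans (·-cong (λ _ → ≈-refl) p≋) (·-combination a c X)))) ⟩
      b - a · p                                               ∎

    conv-≤ : ∀ (a : Point d) b → (∀ l → a · X l ≤ b) → ∀ p → p ∈′ conv X → a · p ≤ b
    conv-≤ a b X≤b p (c , 0≤c , Σc≈1 , p≋) = ≤-diff (b - a · p)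
      (≤-resp ≈-refl (gap a b c Σc≈1 p≋) (sum-nonNeg (λ l → c l * (b - a · X l)) (λ l → *-nonNeg (0≤c l) (≤⇒0≤ (X≤b l)))))
      (solve 2 (λ x b → x :+ (b :- x) := b) ≈-refl (a · p) b)

    conv-≥ : ∀ (a : Point d) b → (∀ l → b ≤ a · X l) → ∀ p → p ∈′ conv X → b ≤ a · p
    conv-≥ a b b≤X p p∈ = ≤-resp (-‿involutive b) (trans (-‿cong (trans (·-*ˡ (- 1#) a p) (-1* _))) (-‿involutive _))
      (neg-mono-≤ (conv-≤ (λ i → - 1# * a i) (- b)
        (λ l → ≤-resp (sym (trans (·-*ˡ (- 1#) a (X l)) (-1* _))) ≈-refl (neg-mono-≤ (b≤X l))) p p∈))

    nonzero : ∀ {a : Point d} {i j} → a · X i < a · X j → ¬ (∀ k → a k ≈ 0#)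
    nonzero {a} {i} {j} lt a≈0 = <-irrefl (trans (vanish i) (sym (vanish j))) lt
      where
      vanish : ∀ i → a · X i ≈ 0#
      vanish i = sum-zero (λ k → a k * X i k) (λ k → trans (*-congʳ (a≈0 k)) (zeroˡ _))

    below⇒vertex : ∀ {a i} → ∃[ l ] l ≢ i → StrictlyBelow a i → X i ∈′ vert (conv X)
    below⇒vertex {a} {i} (l₀ , l₀≢i) below =
      H , ((X i , point∈conv i , ≈-refl) , inj₁ (conv-≤ a (a · X i) weak))
        , (λ (p∈ , p∈H) → only p∈ p∈H)
        , (λ p≋ → (δ i , δ-nonNeg i , sum-δ i , λ j → trans (p≋ j) (sym (sum-δ* i (λ l → X l j)))) , ·-cong (λ _ → ≈-refl) p≋)
      where
      H : Hyperplane d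
      H = record { normal = a ; offset = a · X i ; normal≉0 = nonzero (below l₀ l₀≢i) }
      weak : ∀ l → a · X l ≤ a · X i
      weak l with l Fin.≟ i
      ... | yes refl = ≤-refl
      ... | no l≢i   = <⇒≤ (below l l≢i)
      only : ∀ {p} → p ∈′ conv X → a · p ≈ a · X i → p ≋ X i
      only {p} (c , 0≤c , Σc≈1 , p≋) a·p≈ j = begin
        p j                              ≈⟨ p≋ j ⟩
        sum (λ l → c l * X l j)          ≈⟨ sum-cong-≋ replace ⟩
        sum (λ l → c l * X i j)          ≈⟨ *-distribʳ-sum (X i j) c ⟨
        sum c * X i j                    ≈⟨ *-congʳ Σc≈1 ⟩
        1# * X i j                       ≈⟨ *-identityˡ _ ⟩
        X i j                            ∎
        where
        terms≈0 : ∀ l → c l * (a · X i - a · X l) ≈ 0#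
        terms≈0 = sum≈0⇒≈0 (λ l → c l * (a · X i - a · X l)) (λ l → *-nonNeg (0≤c l) (≤⇒0≤ (weak l)))
          (trans (gap a (a · X i) c Σc≈1 p≋) (trans (+-congˡ (-‿cong a·p≈)) (-‿inverseʳ _)))
        replace : ∀ l → c l * X l j ≈ c l * X i j
        replace l with l Fin.≟ i
        ... | yes refl = ≈-refl
        ... | no l≢i   = trans (trans (*-congʳ c≈0) (zeroˡ _)) (sym (trans (*-congʳ c≈0) (zeroˡ _)))
          where
          c≈0 : c l ≈ 0#
          c≈0 = x*y≈0⇒y≈0 (0<⇒≉ (<⇒0< (below l l≢i))) (trans (*-comm _ _) (terms≈0 l))

    -- When `v` is written as a convex combination, supportingness of `H` forces every point with
    -- nonzero weight onto `H`, where `v` is the only point of the hull.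
    vertex⇒point : ∀ {v} → v ∈′ vert (conv X) → v ∈′ points X
    vertex⇒point {v} (H , (_ , side) , ∩⊆ , ⊆∩) = positive (lem {∃[ l ] c l ≉ 0#})
      where
      v∈ = ⊆∩ {v} (λ _ → ≈-refl)
      c = proj₁ (proj₁ v∈)
      0≤c = proj₁ (proj₂ (proj₁ v∈))
      Σc≈1 = proj₁ (proj₂ (proj₂ (proj₁ v∈)))
      v≋ = proj₂ (proj₂ (proj₂ (proj₁ v∈)))
      v∈H = proj₂ v∈
      a = normal H
      b = offset H
      terms≈0 : ∀ l → c l * (b - a · X l) ≈ 0#
      terms≈0 = [ upper , lower ]′ side
        where
        upper : (∀ p → p ∈′ conv X → a · p ≤ b) → ∀ l → c l * (b - a · X l) ≈ 0#
        upper ≤b = sum≈0⇒≈0 (λ l → c l * (b - a · X l)) (λ l → *-nonNeg (0≤c l) (≤⇒0≤ (≤b (X l) (point∈conv l))))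
              (trans (gap a b c Σc≈1 v≋) (trans (+-congˡ (-‿cong v∈H)) (-‿inverseʳ b)))
        lower : (∀ p → p ∈′ conv X → b ≤ a · p) → ∀ l → c l * (b - a · X l) ≈ 0#
        lower b≤ l = begin
          c l * (b - a · X l)            ≈⟨ solve 3 (λ c b x → c :* (b :- x) := :- (c :* (x :- b))) ≈-refl (c l) b (a · X l) ⟩
          - (c l * (a · X l - b))        ≈⟨ -‿cong (sum≈0⇒≈0 (λ l → c l * (a · X l - b)) (λ l → *-nonNeg (0≤c l) (≤⇒0≤ (b≤ (X l) (point∈conv l)))) total l) ⟩
          - 0#                           ≈⟨ -0#≈0# ⟩
          0#                             ∎
          where
          total : sum (λ l → c l * (a · X l - b)) ≈ 0#
          total = begin
            sum (λ l → c l * (a · X l - b))            ≈⟨ sum-cong-≋ (λ l → solve 3 (λ c b x → c :* (x :- b) := (:- :1) :* (c :* (b :- x))) ≈-refl (c l) b (a · X l)) ⟩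
            sum (λ l → - 1# * (c l * (b - a · X l)))   ≈⟨ *-distribˡ-sum (- 1#) (λ l → c l * (b - a · X l)) ⟨
            - 1# * sum (λ l → c l * (b - a · X l))     ≈⟨ *-congˡ (trans (gap a b c Σc≈1 v≋) (trans (+-congˡ (-‿cong v∈H)) (-‿inverseʳ b))) ⟩
            - 1# * 0#                                  ≈⟨ zeroʳ _ ⟩
            0#                                         ∎
      positive : Dec (∃[ l ] c l ≉ 0#) → v ∈′ points X
      positive (no ∄l) = contradiction (trans (sym Σc≈1) (sum-zero c c≈0)) 1≉0
        where
        c≈0 : ∀ l → c l ≈ 0#
        c≈0 l with lem {c l ≈ 0#}
        ... | yes e = e
        ... | no ne = contradiction (l , ne) ∄l
      positive (yes (l , c≉0)) = l , λ j → sym (∩⊆ (point∈conv l , sym (x-y≈0⇒x≈y (x*y≈0⇒y≈0 c≉0 (terms≈0 l)))) j)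

    module _ (distinct : Distinct X) where

      strict-side : ∀ {i} (H : Hyperplane d) → Supports H (conv X) → points X ∩ ⟦ H ⟧ ≐ singleton (X i) →
        StrictlyBelow (normal H) i ⊎ StrictlyAbove (normal H) i
      strict-side {i} H (_ , side) (∩⊆ , ⊆∩) with side
      ... | inj₁ ≤b = inj₁ λ l l≢i → ≤-resp ≈-refl (sym i∈H) (≤b (X l) (point∈conv l)) , off l l≢i
        where
        i∈H = proj₂ (⊆∩ {X i} (λ _ → ≈-refl))
        off : ∀ l → l ≢ i → normal H · X l ≉ normal H · X i
        off l l≢i e = distinct l i l≢i (∩⊆ ((l , λ _ → ≈-refl) , trans e i∈H))
      ... | inj₂ b≤ = inj₂ λ l l≢i → ≤-resp (sym i∈H) ≈-refl (b≤ (X l) (point∈conv l)) , off l l≢i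
        where
        i∈H = proj₂ (⊆∩ {X i} (λ _ → ≈-refl))
        off : ∀ l → l ≢ i → normal H · X i ≉ normal H · X l
        off l l≢i e = distinct l i l≢i (∩⊆ ((l , λ _ → ≈-refl) , trans (sym e) i∈H))

      vertex⇒exposed : ∀ {i} → X i ∈′ vert (conv X) → Exposed Functionals (allFin n) i
      vertex⇒exposed {i} (H , supports , ∩⊆ , ⊆∩)
        with strict-side H supports ((λ { ((l , p≋) , p∈H) → ∩⊆ ((δ l , δ-nonNeg l , sum-δ l , λ j → trans (p≋ j) (sym (sum-δ* l (λ m → X m j)))) , p∈H) })
                                    , λ p≋ → (i , p≋) , proj₂ (⊆∩ p≋))
      ... | inj₁ below = _ , functional (normal H) , λ _ → below _
      ... | inj₂ above = _ , IsSubspace.neg-closed functionals-subspace (functional (normal H)) , λ _ l≢i → neg-< (above _ l≢i)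

      -- Parallel normals agree up to a factor `t` of either sign, and each hyperplane may support
      -- from either side. Everything is referred to the normal of `H`; then `i` and `j` cannot both
      -- be strict maxima, nor both strict minima.
      strictlyAntipodal⇒antipodal : ∀ {i j} → StrictlyAntipodal X i j → Antipodal Functionals (allFin n) i j
      strictlyAntipodal⇒antipodal {i} {j} (i≢j , H , H′ , supports , supports′ , (t , t≉0 , H′≈tH) , _ , ∩H , ∩H′) =
          combine (strict-side H supports ∩H) (transfer (strict-side H′ supports′ ∩H′))
        where
        a = normal H
        scaled : ∀ l → normal H′ · X l ≈ t * (a · X l)
        scaled l = trans (·-cong {u = normal H′} {p = X l} H′≈tH (λ _ → ≈-refl)) (·-*ˡ t a (X l))
        unscale : ∀ {l m} → normal H′ · X l < normal H′ · X m → (0# < t → a · X l < a · X m) × (t < 0# → a · X m < a · X l)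
        unscale {l} {m} lt =
            (λ 0<t → *-cancelˡ-< t (<⇒≤ 0<t) t-lt)
          , (λ t<0 → *-cancelˡ-< (- t) (≤-resp -0#≈0# ≈-refl (neg-mono-≤ (<⇒≤ t<0)))
                      (<-resp (-‿distribˡ-* _ _) (-‿distribˡ-* _ _) (neg-mono-< t-lt)))
          where
          t-lt : t * (a · X l) < t * (a · X m)
          t-lt = <-resp (scaled l) (scaled m) lt
        transfer : StrictlyBelow (normal H′) j ⊎ StrictlyAbove (normal H′) j → StrictlyBelow a j ⊎ StrictlyAbove a j
        transfer s with ≉⇒<⊎> t≉0 | s
        ... | inj₁ t<0 | inj₁ below = inj₂ λ l ne → proj₂ (unscale (below l ne)) t<0
        ... | inj₁ t<0 | inj₂ above = inj₁ λ l ne → proj₂ (unscale (above l ne)) t<0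
        ... | inj₂ 0<t | inj₁ below = inj₁ λ l ne → proj₁ (unscale (below l ne)) 0<t
        ... | inj₂ 0<t | inj₂ above = inj₂ λ l ne → proj₁ (unscale (above l ne)) 0<t
        combine : StrictlyBelow a i ⊎ StrictlyAbove a i → StrictlyBelow a j ⊎ StrictlyAbove a j → Antipodal Functionals (allFin n) i j
        combine (inj₁ bᵢ) (inj₁ bⱼ) = ⊥-elim (<-asym (bᵢ j (i≢j ∘ ≡.sym)) (bⱼ i i≢j))
        combine (inj₂ aᵢ) (inj₂ aⱼ) = ⊥-elim (<-asym (aᵢ j (i≢j ∘ ≡.sym)) (aⱼ i i≢j))
        combine (inj₁ bᵢ) (inj₂ aⱼ) = antipodal-sym functionals-subspace (_ , functional a , (λ _ → aⱼ _) , (λ _ → bᵢ _))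
        combine (inj₂ aᵢ) (inj₁ bⱼ) = _ , functional a , (λ _ → aᵢ _) , (λ _ → bⱼ _)

    antipodal⇒strictlyAntipodal : ∀ {i j} → i ≢ j → Antipodal Functionals (allFin n) i j → StrictlyAntipodal X i j
    antipodal⇒strictlyAntipodal {i} {j} i≢j (f , (a , f≈) , f-min , f-max) =
        i≢j , H , H′ , ((X i , point∈conv i , ≈-refl) , inj₂ (conv-≥ a (a · X i) weak))
      , ((X j , point∈conv j , ≈-refl) , inj₁ (conv-≤ a (a · X j) weak′))
      , (1# , 1≉0 , λ _ → sym (*-identityˡ _))
      , (λ (H⊆H′ , _) → <-irrefl (H⊆H′ {X i} ≈-refl) (above j (i≢j ∘ ≡.sym)))
      , ((λ { ((l , p≋) , p∈H) → only-i l p≋ p∈H }) , λ p≋ → (i , p≋) , ·-cong (λ _ → ≈-refl) p≋)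
      , ((λ { ((l , p≋) , p∈H) → only-j l p≋ p∈H }) , λ p≋ → (j , p≋) , ·-cong (λ _ → ≈-refl) p≋)
      where
      above : StrictlyAbove a i
      above l ne = <-resp (f≈ i) (f≈ l) (f-min (∈-allFin l) ne)
      below : StrictlyBelow a j
      below l ne = <-resp (f≈ l) (f≈ j) (f-max (∈-allFin l) ne)
      a≉0 : ¬ (∀ k → a k ≈ 0#)
      a≉0 = nonzero (below i i≢j)
      H H′ : Hyperplane d
      H = record { normal = a ; offset = a · X i ; normal≉0 = a≉0 }
      H′ = record { normal = a ; offset = a · X j ; normal≉0 = a≉0 }
      weak : ∀ l → a · X i ≤ a · X l
      weak l with l Fin.≟ i
      ... | yes refl = ≤-refl
      ... | no ne    = <⇒≤ (above l ne)
      weak′ : ∀ l → a · X l ≤ a · X j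
      weak′ l with l Fin.≟ j
      ... | yes refl = ≤-refl
      ... | no ne    = <⇒≤ (below l ne)
      only-i : ∀ l {p} → p ≋ X l → a · p ≈ a · X i → p ≋ X i
      only-i l p≋ e with l Fin.≟ i
      ... | yes refl = p≋
      ... | no ne    = ⊥-elim (<-irrefl (trans (sym e) (·-cong (λ _ → ≈-refl) p≋)) (above l ne))
      only-j : ∀ l {p} → p ≋ X l → a · p ≈ a · X j → p ≋ X j
      only-j l p≋ e with l Fin.≟ j
      ... | yes refl = p≋
      ... | no ne    = ⊥-elim (<-irrefl (trans (sym (·-cong (λ _ → ≈-refl) p≋)) e) (below l ne))

-- Counting strictly antipodal pairs, and tools for the examples.

module Counting (lem : ExcludedMiddle 0ℓ) (ℝ : Reals) where
  open Lists
  open Reals ℝ hiding (zero) renaming (refl to ≈-refl)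
  open OrderedField lem ℝ
  open Spaces lem ℝ
  open Geometry ℝ
  open Points lem ℝ
  open Sum semiring using (sum-cong-≋; ∑-distrib-+; *-distribˡ-sum; *-distribʳ-sum)

  private variable
    n d k : ℕ

  SA : Vector (Point d) n → List (Fin n × Fin n)
  SA {n = n} X = filter (λ (i , j) → lem {i Fin.< j × StrictlyAntipodal X i j}) (cartesianProduct (allFin n) (allFin n))

  ∈-SA⁺ : (X : Vector (Point d) n) → ∀ {i j} → i Fin.< j → StrictlyAntipodal X i j → (i , j) ∈ SA X
  ∈-SA⁺ X i<j ant = ∈-filter⁺ (λ (i , j) → lem {i Fin.< j × StrictlyAntipodal X i j})
    (∈-cartesianProduct⁺ (∈-allFin _) (∈-allFin _)) (i<j , ant)

  ∈-SA⁻ : (X : Vector (Point d) n) → ∀ {p} → p ∈ SA X → proj₁ p Fin.< proj₂ p × StrictlyAntipodal X (proj₁ p) (proj₂ p)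
  ∈-SA⁻ {n = n} X i = proj₂ (∈-filter⁻ (λ (i , j) → lem {i Fin.< j × StrictlyAntipodal X i j}) {xs = cartesianProduct (allFin n) (allFin n)} i)

  SA! : (X : Vector (Point d) n) → Unique (SA X)
  SA! {n = n} X = Unique.filter⁺ _ (Unique.cartesianProduct⁺ (Unique.allFin⁺ n) (Unique.allFin⁺ n))

  sa-upper : (X : Vector (Point d) n) → Distinct X → ∀ L →
    (∀ {i j} → i ≢ j → Antipodal (Configuration.Functionals X) (allFin n) i j → ∃[ q ] (q ∈ L × (i , j) ≈ˢ q)) →
    sa lem X ℕ.≤ length L
  sa-upper X distinct L covers = length-injection {ys = L} (λ p q → proj₁ p Fin.< proj₂ p × p ≈ˢ q) injective (SA! X) covered
    where
    injective : ∀ {p p′ q} → proj₁ p Fin.< proj₂ p × p ≈ˢ q → proj₁ p′ Fin.< proj₂ p′ × p′ ≈ˢ q → p ≡ p′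
    injective (_  , inj₁ (refl , refl)) (_   , inj₁ (refl , refl)) = refl
    injective (_  , inj₂ (refl , refl)) (_   , inj₂ (refl , refl)) = refl
    injective (lt , inj₁ (refl , refl)) (lt′ , inj₂ (refl , refl)) = contradiction lt′ (ℕ.<-asym lt)
    injective (lt , inj₂ (refl , refl)) (lt′ , inj₁ (refl , refl)) = contradiction lt′ (ℕ.<-asym lt)
    covered : ∀ {p} → p ∈ SA X → ∃[ q ] (q ∈ L × (proj₁ p Fin.< proj₂ p × p ≈ˢ q))
    covered i with ∈-SA⁻ X i
    ... | lt , ant with covers (proj₁ ant) (Configuration.strictlyAntipodal⇒antipodal X distinct ant)
    ... | q , q∈L , same = q , q∈L , lt , same

  sa-lower : ∀ {k e} (C : 𝓒ˢ (k ℕ.+ e) (k ℕ.+ e ℕ.+ k)) →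
    (k ℕ.+ e ℕ.+ k) ℕ.* suc e ℕ.≤ 2 ℕ.* sa lem (𝓒ˢ.X C)
  -- For dimension `k + e` and `v = k + e + k` points, the complementary factor `2d + 1 - v` is
  -- `e + 1`; the product of the two is twice the lower estimate.
  sa-lower {k} {e} C with Induction.antipodal-bound lem ℝ (k ℕ.+ e) functionals-subspace all!
      (λ {w} _ → vertex⇒exposed distinct (proj₁ strictlyConvex {X w} (w , λ _ → ≈-refl))) (full-rank fullDim)
      (k ℕ.+ e ℕ.+ k) (suc e) (total k e) (ℕ.≤-reflexive (List.length-tabulate {n = k ℕ.+ e ℕ.+ k} id))
    where
    open 𝓒ˢ C
    open Configuration X
    total : ∀ k e → k ℕ.+ e ℕ.+ k ℕ.+ suc e ≡ suc (2 ℕ.* (k ℕ.+ e))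
    total = ℕSolver.solve-∀
  ... | E , (E# , E-valid) , bound = ℕ.≤-trans bound (ℕ.*-monoʳ-≤ 2 (length-injection {ys = SA X} _≈ˢ_ (λ p q → ≈ˢ-trans p (≈ˢ-sym q)) E# found))
    where
    open 𝓒ˢ C
    open Configuration X
    found : ∀ {p} → p ∈ E → ∃[ q ] (q ∈ SA X × p ≈ˢ q)
    found {i , j} p∈E with E-valid p∈E | Fin.<-cmp i j
    ... | _ , _ , i≢j , ant | B.tri< lt _ _ = (i , j) , ∈-SA⁺ X lt (antipodal⇒strictlyAntipodal i≢j ant) , inj₁ (refl , refl)
    ... | _ , _ , i≢j , ant | B.tri≈ _ e _ = contradiction e i≢j
    ... | _ , _ , i≢j , ant | B.tri> _ _ gt = (j , i) ,
      ∈-SA⁺ X gt (antipodal⇒strictlyAntipodal (i≢j ∘ ≡.sym) (antipodal-sym functionals-subspace ant)) , inj₂ (refl , refl)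

  pairs : ∀ n → List (Fin n × Fin n)
  pairs zero    = []
  pairs (suc n) = map (λ j → zero , suc j) (allFin n) ++ map (λ (i , j) → suc i , suc j) (pairs n)

  length-pairs : ∀ n → 2 ℕ.* length (pairs n) ℕ.+ n ≡ n ℕ.* n
  length-pairs zero    = refl
  length-pairs (suc n) = ≡.trans (≡.cong (λ l → 2 ℕ.* l ℕ.+ suc n)
      (≡.trans (List.length-++ (map (λ j → zero , suc j) (allFin n)))
        (≡.cong₂ ℕ._+_ (≡.trans (List.length-map _ (allFin n)) (List.length-tabulate {n = n} id)) (List.length-map _ (pairs n)))))
    (≡.trans (regroup n (length (pairs n))) (≡.trans (≡.cong (λ s → s ℕ.+ (n ℕ.+ suc n)) (length-pairs n)) (square n)))
    where
    regroup : ∀ n l → 2 ℕ.* (n ℕ.+ l) ℕ.+ suc n ≡ 2 ℕ.* l ℕ.+ n ℕ.+ (n ℕ.+ suc n)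
    regroup = ℕSolver.solve-∀
    square : ∀ n → n ℕ.* n ℕ.+ (n ℕ.+ suc n) ≡ suc n ℕ.* suc n
    square = ℕSolver.solve-∀

  ∈-pairs : ∀ {n} {i j : Fin n} → i ≢ j → ∃[ q ] (q ∈ pairs n × (i , j) ≈ˢ q)
  ∈-pairs {i = zero}  {zero}  i≢j = contradiction refl i≢j
  ∈-pairs {i = zero}  {suc j} i≢j = _ , ∈-++⁺ˡ (∈-map⁺ _ (∈-allFin j)) , inj₁ (refl , refl)
  ∈-pairs {i = suc i} {zero}  i≢j = _ , ∈-++⁺ˡ (∈-map⁺ _ (∈-allFin i)) , inj₂ (refl , refl)
  ∈-pairs {suc n} {i = suc i} {suc j} i≢j with ∈-pairs (i≢j ∘ ≡.cong suc)
  ... | q , q∈ , inj₁ (refl , refl) = _ , ∈-++⁺ʳ (map (λ j → zero , suc j) (allFin n)) (∈-map⁺ _ q∈) , inj₁ (refl , refl)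
  ... | q , q∈ , inj₂ (refl , refl) = _ , ∈-++⁺ʳ (map (λ j → zero , suc j) (allFin n)) (∈-map⁺ _ q∈) , inj₂ (refl , refl)

  sum-++ : ∀ d {k} (t : Vector Carrier (d ℕ.+ k)) → sum t ≈ sum (λ i → t (i ↑ˡ k)) + sum (λ j → t (d ↑ʳ j))
  sum-++ zero    t = sym (+-identityˡ _)
  sum-++ (suc d) t = trans (+-congˡ (sum-++ d (t ∘ suc))) (sym (+-assoc _ _ _))

  sum-mono : (s t : Vector Carrier n) → (∀ i → s i ≤ t i) → sum s ≤ sum t
  sum-mono {zero}  s t s≤t = ≤-refl
  sum-mono {suc n} s t s≤t = +-mono-≤ (s≤t zero) (sum-mono (s ∘ suc) (t ∘ suc) (s≤t ∘ suc))

  term≤sum : (t : Vector Carrier n) → (∀ i → 0# ≤ t i) → ∀ i → t i ≤ sum t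
  term≤sum t 0≤t i = ≤-resp (sum-δ* i t) ≈-refl (sum-mono _ t below)
    where
    below : ∀ m → δ i m * t m ≤ t m
    below m with i Fin.≟ m
    ... | yes refl = ≤-reflexive (trans (*-congʳ (δ-diag i)) (*-identityˡ _))
    ... | no i≢m   = ≤-resp (sym (trans (*-congʳ (δ-off i≢m)) (zeroˡ _))) ≈-refl (0≤t m)

  two-terms≤sum : (t : Vector Carrier n) → (∀ i → 0# ≤ t i) → ∀ {i j} → i ≢ j → t i + t j ≤ sum t
  two-terms≤sum t 0≤t {i} {j} i≢j =
    ≤-resp (trans (∑-distrib-+ (λ m → δ i m * t m) (λ m → δ j m * t m)) (+-cong (sum-δ* i t) (sum-δ* j t))) ≈-refl (sum-mono _ t below)
    where
    below : ∀ m → δ i m * t m + δ j m * t m ≤ t m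
    below m with i Fin.≟ m | j Fin.≟ m
    ... | yes refl | yes refl = contradiction refl i≢j
    ... | yes refl | no j≢m   = ≤-reflexive (trans (+-cong (trans (*-congʳ (δ-diag i)) (*-identityˡ _)) (trans (*-congʳ (δ-off j≢m)) (zeroˡ _))) (+-identityʳ _))
    ... | no i≢m   | yes refl = ≤-reflexive (trans (+-cong (trans (*-congʳ (δ-off i≢m)) (zeroˡ _)) (trans (*-congʳ (δ-diag j)) (*-identityˡ _))) (+-identityˡ _))
    ... | no i≢m   | no j≢m   = ≤-resp (sym (trans (+-cong (trans (*-congʳ (δ-off i≢m)) (zeroˡ _)) (trans (*-congʳ (δ-off j≢m)) (zeroˡ _))) (+-identityʳ _))) ≈-refl (0≤t m)

  -- Both examples consist of the unit vectors and `k` further points. The values of a functional at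
  -- the unit vectors are then simply its coefficients.
  module Extension {d k : ℕ} (Y : Vector (Point d) k) where
    open SetoidReasoning setoid

    X : Vector (Point d) (d ℕ.+ k)
    X = δ ++ᵛ Y

    open Configuration X public

    data View : Fin (d ℕ.+ k) → Set where
      unit : ∀ i → View (i ↑ˡ k)
      extra : ∀ j → View (d ↑ʳ j)

    view : ∀ i → View i
    view i with Fin.splitAt d i in eq
    ... | inj₁ i′ = ≡.subst View (Fin.splitAt⁻¹-↑ˡ eq) (unit i′)
    ... | inj₂ j  = ≡.subst View (Fin.splitAt⁻¹-↑ʳ eq) (extra j)

    unit≢extra : ∀ {i j} → i ↑ˡ k ≢ d ↑ʳ j
    unit≢extra {i} {j} e with ≡.trans (≡.sym (Fin.splitAt-↑ˡ d i k)) (≡.trans (≡.cong (Fin.splitAt d) e) (Fin.splitAt-↑ʳ d k j))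
    ... | ()

    X-unit : ∀ i → X (i ↑ˡ k) ≡ δ i
    X-unit i = ≡.cong [ δ , Y ]′ (Fin.splitAt-↑ˡ d i k)

    X-extra : ∀ j → X (d ↑ʳ j) ≡ Y j
    X-extra j = ≡.cong [ δ , Y ]′ (Fin.splitAt-↑ʳ d k j)

    value-unit : ∀ (a : Point d) i → a · X (i ↑ˡ k) ≈ a i
    value-unit a i = trans (reflexive (≡.cong (a ·_) (X-unit i))) (trans (·-comm a (δ i)) (sum-δ* i a))

    value-extra : ∀ (a : Point d) j → a · X (d ↑ʳ j) ≈ a · Y j
    value-extra a j = reflexive (≡.cong (a ·_) (X-extra j))

    below : ∀ {a : Point d} {x v} → a · X x ≈ v → (∀ i → i ↑ˡ k ≢ x → a i < v) → (∀ j → d ↑ʳ j ≢ x → a · Y j < v) → StrictlyBelow a x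
    below {a} ax≈v units extras l l≢x with view l
    ... | unit i  = <-resp (sym (value-unit a i)) (sym ax≈v) (units i l≢x)
    ... | extra j = <-resp (sym (value-extra a j)) (sym ax≈v) (extras j l≢x)

    -- The coefficients `u`, `v` express the origin as an affine combination. Any `p` is the
    -- combination of the unit vectors with weights `p i`, the missing weight `1# - sum p` being
    -- placed at the origin.
    full-dimensional : ∀ (u : Point d) (v : Vector Carrier k) → sum u + sum v ≈ 1# → (∀ j → u j + sum (λ l → v l * Y l j) ≈ 0#) →
      ∀ p → p ∈′ aff X
    full-dimensional u v Σ≈1 vanish p = c , Σc≈1 , λ j → sym (coordinate j)
      where
      t = 1# - sum p
      c = (λ i → p i + t * u i) ++ᵛ (λ l → t * v l)
      c-unit : ∀ i → c (i ↑ˡ k) ≈ p i + t * u i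
      c-unit i = reflexive (≡.cong [ _ , _ ]′ (Fin.splitAt-↑ˡ d i k))
      c-extra : ∀ l → c (d ↑ʳ l) ≈ t * v l
      c-extra l = reflexive (≡.cong [ _ , _ ]′ (Fin.splitAt-↑ʳ d k l))
      Σc≈1 : sum c ≈ 1#
      Σc≈1 = begin
        sum c                                          ≈⟨ sum-++ d c ⟩
        sum (λ i → c (i ↑ˡ k)) + sum (λ l → c (d ↑ʳ l)) ≈⟨ +-cong (trans (sum-cong-≋ c-unit) (sum-⊕ t p u)) (trans (sum-cong-≋ c-extra) (sym (*-distribˡ-sum t v))) ⟩
        (sum p + t * sum u) + t * sum v                ≈⟨ solve 4 (λ p t u v → (p :+ t :* u) :+ t :* v := p :+ t :* (u :+ v)) ≈-refl (sum p) t (sum u) (sum v) ⟩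
        sum p + t * (sum u + sum v)                    ≈⟨ +-congˡ (trans (*-congˡ Σ≈1) (*-identityʳ t)) ⟩
        sum p + (1# - sum p)                           ≈⟨ solve 1 (λ p → p :+ (:1 :- p) := :1) ≈-refl (sum p) ⟩
        1#                                             ∎
      coordinate : ∀ j → combination c X j ≈ p j
      coordinate j = begin
        sum (λ l → c l * X l j)                                                       ≈⟨ sum-++ d (λ l → c l * X l j) ⟩
        sum (λ i → c (i ↑ˡ k) * X (i ↑ˡ k) j) + sum (λ l → c (d ↑ʳ l) * X (d ↑ʳ l) j) ≈⟨ +-cong (trans (sum-cong-≋ unit-terms) (sum-δ* j (λ i → p i + t * u i))) (trans (sum-cong-≋ extra-terms) (sym (*-distribˡ-sum t (λ l → v l * Y l j)))) ⟩
        (p j + t * u j) + t * sum (λ l → v l * Y l j)                                 ≈⟨ solve 4 (λ p t u v → (p :+ t :* u) :+ t :* v := p :+ t :* (u :+ v)) ≈-refl (p j) t (u j) (sum (λ l → v l * Y l j)) ⟩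
        p j + t * (u j + sum (λ l → v l * Y l j))                                     ≈⟨ +-congˡ (trans (*-congˡ (vanish j)) (zeroʳ t)) ⟩
        p j + 0#                                                                      ≈⟨ +-identityʳ _ ⟩
        p j                                                                           ∎
        where
        δ-sym : ∀ {n} (i j : Fin n) → δ i j ≈ δ j i
        δ-sym zero    zero    = ≈-refl
        δ-sym zero    (suc j) = ≈-refl
        δ-sym (suc i) zero    = ≈-refl
        δ-sym (suc i) (suc j) = δ-sym i j
        unit-terms : ∀ i → c (i ↑ˡ k) * X (i ↑ˡ k) j ≈ δ j i * (p i + t * u i)
        unit-terms i = trans (*-cong (c-unit i) (trans (reflexive (≡.cong (λ q → q j) (X-unit i))) (δ-sym i j))) (*-comm _ _)
        extra-terms : ∀ l → c (d ↑ʳ l) * X (d ↑ʳ l) j ≈ t * (v l * Y l j)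
        extra-terms l = trans (*-cong (c-extra l) (reflexive (≡.cong (λ q → q j) (X-extra l)))) (*-assoc t (v l) (Y l j))

    module Member (vertices : ∀ x → ∃[ a ] StrictlyBelow a x) (others : ∀ (x : Fin (d ℕ.+ k)) → ∃[ l ] l ≢ x)
      (fullDim : ∀ p → p ∈′ aff X) where

      X-distinct : Distinct X
      X-distinct i j i≢j Xi≋Xj = let a , a-below = vertices i in
        <-irrefl (·-cong (λ _ → ≈-refl) (λ m → sym (Xi≋Xj m))) (a-below j (i≢j ∘ ≡.sym))

      member : 𝓒ˢ d (d ℕ.+ k)
      member = record
        { X = X ; distinct = X-distinct ; fullDim = fullDim
        ; strictlyConvex = (λ (i , p≋) → vertex-resp p≋ (below⇒vertex (others i) (proj₂ (vertices i)))) , vertex⇒point }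
        where
        vertex-resp : ∀ {p q} → p ≋ q → q ∈′ vert (conv X) → p ∈′ vert (conv X)
        vertex-resp p≋q (H , supports , ∩⊆ , ⊆∩) =
          H , supports , (λ i j → trans (∩⊆ i j) (sym (p≋q j))) , (λ r≋p → ⊆∩ (λ j → trans (r≋p j) (p≋q j)))

-- The two examples for the upper estimates.

module Constructions (lem : ExcludedMiddle 0ℓ) (ℝ : Reals) where
  open Lists
  open Reals ℝ hiding (zero) renaming (refl to ≈-refl)
  open OrderedField lem ℝ
  open Spaces lem ℝ
  open Geometry ℝ
  open Points lem ℝ
  open Counting lem ℝ
  open Sum semiring using (sum-cong-≋; ∑-distrib-+; *-distribˡ-sum; *-distribʳ-sum)
  open SetoidReasoning setoid

  sum-const : ∀ n c → sum {n} (λ _ → c) ≈ fromℕ n * c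
  sum-const zero    c = sym (zeroˡ c)
  sum-const (suc n) c = trans (+-congˡ (sum-const n c)) (solve 2 (λ c m → c :+ m :* c := (:1 :+ m) :* c) ≈-refl c (fromℕ n))

  length-cartesianProduct : ∀ {A B : Set} (xs : List A) (ys : List B) → length (cartesianProduct xs ys) ≡ length xs ℕ.* length ys
  length-cartesianProduct []       ys = refl
  length-cartesianProduct (x ∷ xs) ys = ≡.trans (List.length-++ (map (x ,_) ys))
    (≡.cong₂ ℕ._+_ (List.length-map (x ,_) ys) (length-cartesianProduct xs ys))

  -- A simplex, with points y_j stacked just beyond some of its facets, so
  -- close that y_j is antipodal only to the vertex opposite to its facet.
  module Stacked (d₀ k′ : ℕ) (k′≤d : k′ ℕ.≤ 3 ℕ.+ d₀) where
    d k : ℕ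
    d = 3 ℕ.+ d₀
    k = suc k′

    ι : Fin k′ → Fin d
    ι j = Fin.inject≤ j k′≤d

    ι-injective : ∀ {i j} → ι i ≡ ι j → i ≡ j
    ι-injective = Fin.inject≤-injective k′≤d k′≤d _ _

    D r : Carrier
    D = fromℕ (2 ℕ.+ d₀)
    r = D ⁻¹

    2≤D : 2# ≤ D
    2≤D = ≤-diff (fromℕ d₀) (0≤fromℕ d₀) (+-assoc 1# 1# (fromℕ d₀))

    1<D : 1# < D
    1<D = <-≤-trans (<-diff 1# 0<1 ≈-refl) 2≤D

    0<D : 0# < D
    0<D = <-trans 0<1 1<D

    0<r : 0# < r
    0<r = 0<⁻¹ 0<D

    D*r : D * r ≈ 1#
    D*r = *-inverseʳ (0<⇒≉ 0<D)

    r<1 : r < 1#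
    r<1 = *-cancelˡ-< D (<⇒≤ 0<D) (<-resp (sym D*r) (sym (*-identityʳ D)) 1<D)

    -- The origin completes the unit vectors to a simplex. In barycentric coordinates `Y (suc j)`
    -- has weight `- r` at the unit vector `ι j` and `r` at each of the `d` other vertices; total
    -- weight one forces `r = 1 / (d - 1)`.
    Y : Vector (Point d) k
    Y zero    m = 0#
    Y (suc j) m = r * (1# + (- 2#) * δ (ι j) m)

    open Extension {d} {k} Y

    origin-value : ∀ (a : Point d) → a · Y zero ≈ 0#
    origin-value a = sum-zero (λ i → a i * 0#) (λ i → zeroʳ (a i))

    apex-value : ∀ (a : Point d) j → a · Y (suc j) ≈ r * (sum a - 2# * a (ι j))
    apex-value a j = begin
      a · (λ m → r * (1# + (- 2#) * δ (ι j) m))          ≈⟨ ·-*ʳ r a (λ m → 1# + (- 2#) * δ (ι j) m) ⟩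
      r * (a · (λ m → 1# + (- 2#) * δ (ι j) m))          ≈⟨ *-congˡ (·-⊕ʳ (- 2#) a (λ _ → 1#) (δ (ι j))) ⟩
      r * (a · (λ _ → 1#) + (- 2#) * (a · δ (ι j)))      ≈⟨ *-congˡ (+-cong (sum-cong-≋ (λ m → *-identityʳ (a m))) (*-congˡ (trans (·-comm a (δ (ι j))) (sum-δ* (ι j) a)))) ⟩
      r * (sum a + (- 2#) * a (ι j))                     ≈⟨ *-congˡ (+-congˡ (-‿distribˡ-* 2# (a (ι j)))) ⟨
      r * (sum a - 2# * a (ι j))                         ∎

    D*apex-value : ∀ (a : Point d) j → D * (a · Y (suc j)) ≈ sum a - 2# * a (ι j)
    D*apex-value a j = begin
      D * (a · Y (suc j))                       ≈⟨ *-congˡ (apex-value a j) ⟩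
      D * (r * (sum a - 2# * a (ι j)))          ≈⟨ *-assoc D r _ ⟨
      D * r * (sum a - 2# * a (ι j))            ≈⟨ *-congʳ D*r ⟩
      1# * (sum a - 2# * a (ι j))               ≈⟨ *-identityˡ _ ⟩
      sum a - 2# * a (ι j)                      ∎

    unit-below : ∀ m → StrictlyBelow (δ m) (m ↑ˡ k)
    unit-below m = below {δ m} (trans (value-unit (δ m) m) (δ-diag m))
      (λ i ne → <-resp (sym (δ-off {i = m} {i} (λ { refl → ne refl }))) ≈-refl 0<1)
      (λ { zero _ → <-resp (sym (origin-value (δ m))) ≈-refl 0<1
         ; (suc j) _ → <-resp (sym (sum-δ* m (Y (suc j)))) ≈-refl (≤-<-trans (y≤r j) r<1) })
      where
      y≤r : ∀ j → Y (suc j) m ≤ r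
      y≤r j = ≤-resp ≈-refl (*-identityʳ r) (*-monoˡ-≤ r (<⇒≤ 0<r)
        (≤-diff (2# * δ (ι j) m) (*-nonNeg (<⇒≤ 0<2) (δ-nonNeg (ι j) m))
          (solve 2 (λ t x → (:1 :+ (:- t) :* x) :+ t :* x := :1) ≈-refl 2# (δ (ι j) m))))

    origin-below : StrictlyBelow (λ _ → - 1#) (d ↑ʳ zero)
    origin-below = below (trans (value-extra (λ _ → - 1#) zero) (origin-value (λ _ → - 1#))) (λ _ _ → -1<0) (λ where
        zero ne → contradiction refl ne
        (suc j) _ → <-resp (sym (apex-value (λ _ → - 1#) j)) (zeroʳ r) (*-monoˡ-< r 0<r
          (<-diff (D - 1#) (<⇒0< 1<D) (begin
            (sum {d} (λ _ → - 1#) - 2# * - 1#) + (D - 1#)       ≈⟨ +-congʳ (+-congʳ (sum-const d (- 1#))) ⟩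
            ((1# + D) * - 1# - 2# * - 1#) + (D - 1#)            ≈⟨ solve 1 (λ D → ((:1 :+ D) :* (:- :1) :- :2 :* (:- :1)) :+ (D :- :1) := con (+ 0)) ≈-refl D ⟩
            0#                                                  ∎))))
      where
      -1<0 : - 1# < 0#
      -1<0 = <-diff 1# 0<1 (-‿inverseˡ 1#)

    apex-below : ∀ j → StrictlyBelow (λ m → - 1# * δ (ι j) m) (d ↑ʳ suc j)
    apex-below j = below (trans (value-extra a (suc j)) (trans (apex-value a j) (trans (*-congˡ at-j) (*-identityʳ r))))
      (λ i _ → ≤-<-trans (≤-resp (sym (-1* _)) -0#≈0# (neg-mono-≤ (δ-nonNeg (ι j) i))) 0<r)
      (λ { zero _ → <-resp (sym (origin-value a)) ≈-refl 0<r
         ; (suc l) ne → <-resp (sym (apex-value a l)) (*-identityʳ r) (*-monoˡ-< r 0<r (at-other l (λ { refl → ne refl }))) })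
      where
      a : Point d
      a m = - 1# * δ (ι j) m
      sum-a : sum a ≈ - 1#
      sum-a = trans (sym (*-distribˡ-sum (- 1#) (δ (ι j)))) (trans (*-congˡ (sum-δ (ι j))) (*-identityʳ _))
      at-j : sum a - 2# * a (ι j) ≈ 1#
      at-j = begin
        sum a - 2# * (- 1# * δ (ι j) (ι j))   ≈⟨ +-cong sum-a (-‿cong (*-congˡ (*-congˡ (δ-diag (ι j))))) ⟩
        - 1# - 2# * (- 1# * 1#)               ≈⟨ solve 0 ((:- :1) :- :2 :* ((:- :1) :* :1) := :1) ≈-refl ⟩
        1#                                    ∎
      at-other : ∀ l → l ≢ j → sum a - 2# * a (ι l) < 1#
      at-other l l≢j = <-diff 2# 0<2 (begin
        (sum a - 2# * (- 1# * δ (ι j) (ι l))) + 2#   ≈⟨ +-congʳ (+-cong sum-a (-‿cong (*-congˡ (*-congˡ (δ-off (λ e → l≢j (≡.sym (ι-injective e)))))))) ⟩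
        (- 1# - 2# * (- 1# * 0#)) + 2#               ≈⟨ solve 0 (((:- :1) :- :2 :* ((:- :1) :* con (+ 0))) :+ :2 := :1) ≈-refl ⟩
        1#                                           ∎)

    vertices : ∀ x → ∃[ a ] StrictlyBelow a x
    vertices x with view x
    ... | unit i        = δ i , unit-below i
    ... | extra zero    = (λ _ → - 1#) , origin-below
    ... | extra (suc j) = (λ m → - 1# * δ (ι j) m) , apex-below j

    others : ∀ (x : Fin (d ℕ.+ k)) → ∃[ l ] l ≢ x
    others zero    = suc zero , λ ()
    others (suc x) = zero , λ ()

    spans : ∀ p → p ∈′ aff X
    spans = full-dimensional (λ _ → 0#) (δ zero)
      (trans (+-cong (sum-zero {d} (λ _ → 0#) (λ _ → ≈-refl)) (sum-δ {k} zero)) (+-identityˡ 1#))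
      (λ j → trans (+-identityˡ _) (sum-δ* {k} zero (λ l → Y l j)))

    open Member vertices others spans public

    L : List (Fin (d ℕ.+ k) × Fin (d ℕ.+ k))
    L = map (λ (i , j) → i ↑ˡ k , j ↑ˡ k) (pairs d) ++ map (λ i → i ↑ˡ k , d ↑ʳ zero) (allFin d)
        ++ map (λ j → ι j ↑ˡ k , d ↑ʳ suc j) (allFin k′)

    length-L : length L ≡ length (pairs d) ℕ.+ (d ℕ.+ k′)
    length-L = ≡.trans (List.length-++ (map (λ (i , j) → i ↑ˡ k , j ↑ˡ k) (pairs d))) (≡.cong₂ ℕ._+_ (List.length-map _ (pairs d))
      (≡.trans (List.length-++ (map (λ i → i ↑ˡ k , d ↑ʳ zero {k′}) (allFin d)))
        (≡.cong₂ ℕ._+_ (≡.trans (List.length-map _ (allFin d)) (List.length-tabulate {n = d} id))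
                       (≡.trans (List.length-map _ (allFin k′)) (List.length-tabulate {n = k′} id)))))

    -- With G = a · y_j − a evaluated at the vertices of the simplex, the
    -- definition of y_j says that the sum of all values of G is 2 G (ι j).
    gap-sum : ∀ (a : Point d) j → sum (λ m → a · Y (suc j) - a m) + a · Y (suc j) ≈ 2# * (a · Y (suc j) - a (ι j))
    gap-sum a j = begin
      sum (λ m → y - a m) + y                             ≈⟨ +-congʳ (sum-cong-≋ (λ m → +-congˡ {y} (sym (-1* (a m))))) ⟩
      sum (λ m → y + - 1# * a m) + y                      ≈⟨ +-congʳ (sum-⊕ (- 1#) (λ _ → y) a) ⟩
      (sum {d} (λ _ → y) + - 1# * sum a) + y              ≈⟨ +-congʳ (+-congʳ (sum-const d y)) ⟩
      ((1# + D) * y + - 1# * sum a) + y                   ≈⟨ solve 3 (λ D y s → ((:1 :+ D) :* y :+ (:- :1) :* s) :+ y := :2 :* y :+ (D :* y :- s)) ≈-refl D y (sum a) ⟩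
      2# * y + (D * y - sum a)                            ≈⟨ +-congˡ (+-congʳ (D*apex-value a j)) ⟩
      2# * y + ((sum a - 2# * a (ι j)) - sum a)           ≈⟨ solve 3 (λ y s b → :2 :* y :+ ((s :- :2 :* b) :- s) := :2 :* (y :- b)) ≈-refl y (sum a) (a (ι j)) ⟩
      2# * (y - a (ι j))                                  ∎
      where y = a · Y (suc j)

    Antipodalᶠ : Fin (d ℕ.+ k) → Fin (d ℕ.+ k) → Set
    Antipodalᶠ = Antipodal Functionals (allFin (d ℕ.+ k))

    module _ {f : Fin (d ℕ.+ k) → Carrier} {a : Point d} (f≈ : ∀ i → f i ≈ a · X i)
             {x : Fin (d ℕ.+ k)} {j : Fin k′} (f-min : StrictMin f (allFin (d ℕ.+ k)) x)
             (f-max : StrictMax f (allFin (d ℕ.+ k)) (d ↑ʳ suc j)) where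
      y = a · Y (suc j)

      f-unit : ∀ i → f (i ↑ˡ k) ≈ a i
      f-unit i = trans (f≈ (i ↑ˡ k)) (value-unit a i)
      f-origin : f (d ↑ʳ zero) ≈ 0#
      f-origin = trans (f≈ (d ↑ʳ zero)) (trans (value-extra a zero) (origin-value a))
      f-apex : ∀ l → f (d ↑ʳ suc l) ≈ a · Y (suc l)
      f-apex l = trans (f≈ (d ↑ʳ suc l)) (value-extra a (suc l))

      G : Vector Carrier d
      G m = y - a m
      0<G : ∀ m → 0# < G m
      0<G m = <⇒0< (<-resp (f-unit m) (f-apex j) (f-max (∈-allFin (m ↑ˡ k)) unit≢extra))
      0<y : 0# < y
      0<y = <-resp f-origin (f-apex j) (f-max (∈-allFin (d ↑ʳ zero)) (λ e → case-zero (Fin.↑ʳ-injective d zero (suc j) e)))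
        where
        case-zero : ∀ {n} {j : Fin n} → zero ≢ suc j
        case-zero ()

      -- All gaps are positive, that of the origin being `y`, and by `gap-sum` the gaps over the
      -- whole simplex add up to twice the gap at `ι j`. A minimum at another vertex would have a
      -- larger gap than `ι j`, so these two alone would exceed the total.
      unit-min : ∀ {m} → x ≡ m ↑ˡ k → m ≡ ι j
      unit-min {m} refl with m Fin.≟ ι j
      ... | yes e = e
      ... | no m≢ι = ⊥-elim (<-irrefl (sym (gap-sum a j)) (≤-<-trans (≤-diff _ (<⇒≤ (<⇒0< Gι<Gm)) (solve 2 (λ u v → :2 :* u :+ (v :- u) := v :+ u) ≈-refl (G (ι j)) (G m)))
              (≤-<-trans (two-terms≤sum G (λ i → <⇒≤ (0<G i)) m≢ι) (<-diff y 0<y ≈-refl))))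
        where
        Gι<Gm : G (ι j) < G m
        Gι<Gm = <-diff _ (<⇒0< (<-resp (f-unit m) (f-unit (ι j)) (f-min (∈-allFin (ι j ↑ˡ k)) (λ e → m≢ι (≡.sym (Fin.↑ˡ-injective k _ _ e))))))
          (solve 3 (λ y u v → (y :- u) :+ (u :- v) := y :- v) ≈-refl y (a (ι j)) (a m))

      origin-min : x ≢ d ↑ʳ zero
      origin-min refl = <-irrefl (sym (gap-sum a j)) (≤-<-trans (≤-reflexive (solve 1 (λ u → :2 :* u := u :+ u) ≈-refl (G (ι j))))
          (<-diff (((sum G - G (ι j)) + (y - G (ι j)))) (<-resp (+-identityˡ 0#) (+-comm _ _) (0<-+′ (<⇒0< Gι<y) (≤⇒0≤ (term≤sum G (λ i → <⇒≤ (0<G i)) (ι j)))))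
            (solve 3 (λ g s y → (g :+ g) :+ ((s :- g) :+ (y :- g)) := s :+ y) ≈-refl (G (ι j)) (sum G) y)))
        where
        0<-+′ : ∀ {u v} → 0# < u → 0# ≤ v → 0# + 0# < u + v
        0<-+′ 0<u 0≤v = <-resp (sym (+-identityˡ 0#)) ≈-refl (0<-+ 0<u 0≤v)
        Gι<y : G (ι j) < y
        Gι<y = <-diff (a (ι j)) (<-resp f-origin (f-unit (ι j)) (f-min (∈-allFin (ι j ↑ˡ k)) unit≢extra))
          (solve 2 (λ y u → (y :- u) :+ u := y) ≈-refl y (a (ι j)))

      -- By the definition of the stacked points, `D * Δ` is twice the difference of `a` at `ι l`
      -- and `ι j`. That difference is below `Δ`, because both values lie strictly between the
      -- values at the two stacked points or the assumed extremes fail. So `D < 2`, whereas `D ≥ 2`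
      -- in dimension at least three.
      apex-min : ∀ {l} → x ≢ d ↑ʳ suc l
      apex-min {l} refl = <-irrefl ≈-refl (<-≤-trans (<-≤-trans D-gap (*-monoʳ-≤ 2≤D)) ≤-refl)
        where
        Δ = y - a · Y (suc l)
        gap< : a (ι l) - a (ι j) < Δ
        gap< = <-diff _ (0<-+ (<⇒0< (<-resp (f-unit (ι l)) (f-apex j) (f-max (∈-allFin (ι l ↑ˡ k)) unit≢extra)))
                              (<⇒≤ (<⇒0< (<-resp (f-apex l) (f-unit (ι j)) (f-min (∈-allFin (ι j ↑ˡ k)) unit≢extra)))))
          (solve 4 (λ u v p q → (u :- v) :+ ((p :- u) :+ (v :- q)) := p :- q) ≈-refl (a (ι l)) (a (ι j)) y (a · Y (suc l)))
        0<Δ : 0# < Δ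
        0<Δ = <⇒0< (<-trans (<-resp (f-apex l) (f-unit (ι j)) (f-min (∈-allFin (ι j ↑ˡ k)) unit≢extra))
                            (<-resp (f-unit (ι j)) (f-apex j) (f-max (∈-allFin (ι j ↑ˡ k)) unit≢extra)))
        D-gap : D * Δ < 2# * Δ
        D-gap = <-resp (begin
            2# * (a (ι l) - a (ι j))                                         ≈⟨ solve 3 (λ s u v → :2 :* (u :- v) := (s :- :2 :* v) :- (s :- :2 :* u)) ≈-refl (sum a) (a (ι l)) (a (ι j)) ⟩
            (sum a - 2# * a (ι j)) - (sum a - 2# * a (ι l))                  ≈⟨ +-cong (D*apex-value a j) (-‿cong (D*apex-value a l)) ⟨
            D * y - D * (a · Y (suc l))                                      ≈⟨ solve 3 (λ D p q → D :* p :- D :* q := D :* (p :- q)) ≈-refl D y (a · Y (suc l)) ⟩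
            D * Δ                                                            ∎) ≈-refl (*-monoˡ-< 2# 0<2 gap<)
        *-monoʳ-≤ : ∀ {u v} → u ≤ v → u * Δ ≤ v * Δ
        *-monoʳ-≤ u≤v = ≤-resp (*-comm _ _) (*-comm _ _) (*-monoˡ-≤ Δ (<⇒≤ 0<Δ) u≤v)

    apex-partner : ∀ {x j} → Antipodalᶠ x (d ↑ʳ suc j) → x ≡ ι j ↑ˡ k
    apex-partner {x} (f , (a , f≈) , f-min , f-max) with view x
    ... | unit m        = ≡.cong (_↑ˡ k) (unit-min {f} {a} f≈ f-min f-max refl)
    ... | extra zero    = ⊥-elim (origin-min {f} {a} f≈ f-min f-max refl)
    ... | extra (suc l) = ⊥-elim (apex-min {f} {a} f≈ f-min f-max {l} refl)

    covers : ∀ {x y} → x ≢ y → Antipodalᶠ x y → ∃[ q ] (q ∈ L × (x , y) ≈ˢ q)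
    covers {x} {y} x≢y ant with view x | view y
    ... | _ | extra (suc j) = _ , ∈-++⁺ʳ (map (λ (i , j) → i ↑ˡ k , j ↑ˡ k) (pairs d)) (∈-++⁺ʳ (map (λ i → i ↑ˡ k , d ↑ʳ zero) (allFin d)) (∈-map⁺ _ (∈-allFin j)))
                              , inj₁ (apex-partner ant , refl)
    ... | extra (suc j) | _ = _ , ∈-++⁺ʳ (map (λ (i , j) → i ↑ˡ k , j ↑ˡ k) (pairs d)) (∈-++⁺ʳ (map (λ i → i ↑ˡ k , d ↑ʳ zero) (allFin d)) (∈-map⁺ _ (∈-allFin j)))
                              , inj₂ (refl , apex-partner (antipodal-sym functionals-subspace ant))
    ... | extra zero | extra zero = contradiction refl x≢y
    ... | unit i | extra zero = _ , ∈-++⁺ʳ (map (λ (i , j) → i ↑ˡ k , j ↑ˡ k) (pairs d)) (∈-++⁺ˡ (∈-map⁺ _ (∈-allFin i))) , inj₁ (refl , refl)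
    ... | extra zero | unit i = _ , ∈-++⁺ʳ (map (λ (i , j) → i ↑ˡ k , j ↑ˡ k) (pairs d)) (∈-++⁺ˡ (∈-map⁺ _ (∈-allFin i))) , inj₂ (refl , refl)
    ... | unit i | unit j with ∈-pairs {i = i} {j} (λ { refl → x≢y refl })
    ...   | q , q∈ , inj₁ (refl , refl) = _ , ∈-++⁺ˡ (∈-map⁺ _ q∈) , inj₁ (refl , refl)
    ...   | q , q∈ , inj₂ (refl , refl) = _ , ∈-++⁺ˡ (∈-map⁺ _ q∈) , inj₂ (refl , refl)

    -- This is the first line of `U`: the `d (d + 1) / 2` edges of the simplex, and one pair for
    -- each of the `k - 1` stacked points.
    sa-bound : sa lem (𝓒ˢ.X member) ℕ.≤ length (pairs d) ℕ.+ (d ℕ.+ k′)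
    sa-bound = ≡.subst (sa lem X ℕ.≤_) length-L (sa-upper X X-distinct L covers)

  -- The join of a k-dimensional cross-polytope and a simplex with e vertices.
  module CrossJoin (k′ e : ℕ) where
    k d : ℕ
    k = suc k′
    d = k ℕ.+ e

    ι : Fin k → Fin d
    ι j = j ↑ˡ e

    Y : Vector (Point d) k
    Y j m = - 1# * δ (ι j) m

    open Extension {d} {k} Y

    negative-value : ∀ (a : Point d) j → a · Y j ≈ - a (ι j)
    negative-value a j = trans (·-*ʳ (- 1#) a (δ (ι j))) (trans (-1* _) (-‿cong (trans (·-comm a (δ (ι j))) (sum-δ* (ι j) a))))

    unit-below : ∀ m → StrictlyBelow (δ m) (m ↑ˡ k)
    unit-below m = below {δ m} (trans (value-unit (δ m) m) (δ-diag m))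
      (λ i ne → <-resp (sym (δ-off {i = m} {i} (λ { refl → ne refl }))) ≈-refl 0<1)
      (λ j _ → <-resp (sym (negative-value (δ m) j)) ≈-refl (≤-<-trans (≤-resp ≈-refl -0#≈0# (neg-mono-≤ (δ-nonNeg m (ι j)))) 0<1))

    negative-below : ∀ j → StrictlyBelow (λ m → - 1# * δ (ι j) m) (d ↑ʳ j)
    negative-below j = below (trans (value-extra a j) (trans (negative-value a j) (trans (-‿cong (-1* _)) (trans (-‿involutive _) (δ-diag (ι j))))))
      (λ i _ → ≤-<-trans (≤-resp (sym (-1* _)) -0#≈0# (neg-mono-≤ (δ-nonNeg (ι j) i))) 0<1)
      (λ l ne → <-resp (sym (trans (negative-value a l) (trans (-‿cong (-1* _)) (trans (-‿involutive _)
                 (δ-off (λ e′ → ne (≡.cong (d ↑ʳ_) (≡.sym (Fin.↑ˡ-injective e _ _ e′))))))))) ≈-refl 0<1)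
      where
      a : Point d
      a m = - 1# * δ (ι j) m

    vertices : ∀ x → ∃[ a ] StrictlyBelow a x
    vertices x with view x
    ... | unit i  = δ i , unit-below i
    ... | extra j = (λ m → - 1# * δ (ι j) m) , negative-below j

    others : ∀ (x : Fin (d ℕ.+ k)) → ∃[ l ] l ≢ x
    others x with view x
    ... | unit i  = d ↑ʳ zero , λ eq → unit≢extra (≡.sym eq)
    ... | extra j = ι zero ↑ˡ k , unit≢extra

    spans : ∀ p → p ∈′ aff X
    -- The origin is the midpoint of two opposite vertices of the cross-polytope.
    spans = full-dimensional (λ m → 2# ⁻¹ * δ (ι zero) m) (λ l → 2# ⁻¹ * δ zero l)
        (begin
          sum (λ m → 2# ⁻¹ * δ (ι zero) m) + sum (λ l → 2# ⁻¹ * δ {k} zero l)   ≈⟨ +-cong (half (ι zero)) (half {k} zero) ⟩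
          2# ⁻¹ + 2# ⁻¹                                                         ≈⟨ solve 1 (λ h → h :+ h := :2 :* h) ≈-refl (2# ⁻¹) ⟩
          2# * 2# ⁻¹                                                            ≈⟨ *-inverseʳ (0<⇒≉ 0<2) ⟩
          1#                                                                    ∎)
        (λ j → begin
          2# ⁻¹ * δ (ι zero) j + sum (λ l → 2# ⁻¹ * δ {k} zero l * Y l j)       ≈⟨ +-congˡ (trans (sum-cong-≋ (λ l → *-assoc (2# ⁻¹) (δ {k} zero l) (Y l j))) (sym (*-distribˡ-sum (2# ⁻¹) (λ l → δ {k} zero l * Y l j)))) ⟩
          2# ⁻¹ * δ (ι zero) j + 2# ⁻¹ * sum (λ l → δ {k} zero l * Y l j)       ≈⟨ +-congˡ (*-congˡ (sum-δ* {k} zero (λ l → Y l j))) ⟩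
          2# ⁻¹ * δ (ι zero) j + 2# ⁻¹ * (- 1# * δ (ι zero) j)                  ≈⟨ solve 2 (λ h x → h :* x :+ h :* ((:- :1) :* x) := con (+ 0)) ≈-refl (2# ⁻¹) (δ (ι zero) j) ⟩
          0#                                                                    ∎)
      where
      half : ∀ {n} (i : Fin n) → sum (λ m → 2# ⁻¹ * δ i m) ≈ 2# ⁻¹
      half i = trans (sym (*-distribˡ-sum (2# ⁻¹) (δ i))) (trans (*-congˡ (sum-δ i)) (*-identityʳ _))

    open Member vertices others spans public

    positive negative : Fin k → Fin (d ℕ.+ k)
    positive j = ι j ↑ˡ k
    negative j = d ↑ʳ j
    apex : Fin e → Fin (d ℕ.+ k)
    apex m = (k ↑ʳ m) ↑ˡ k

    L₁ L₂ L₃ L₄ L : List (Fin (d ℕ.+ k) × Fin (d ℕ.+ k))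
    L₁ = map (λ j → positive j , negative j) (allFin k)
    L₂ = map (λ (i , j) → apex i , apex j) (pairs e)
    L₃ = map (λ (m , j) → apex m , positive j) (cartesianProduct (allFin e) (allFin k))
    L₄ = map (λ (m , j) → apex m , negative j) (cartesianProduct (allFin e) (allFin k))
    L = L₁ ++ L₂ ++ L₃ ++ L₄

    length-L : length L ≡ k ℕ.+ (length (pairs e) ℕ.+ (e ℕ.* k ℕ.+ e ℕ.* k))
    length-L = ≡.trans (List.length-++ L₁) (≡.cong₂ ℕ._+_ (≡.trans (List.length-map _ (allFin k)) (List.length-tabulate {n = k} id))
      (≡.trans (List.length-++ L₂) (≡.cong₂ ℕ._+_ (List.length-map _ (pairs e))
        (≡.trans (List.length-++ L₃) (≡.cong₂ ℕ._+_ (≡.trans (List.length-map _ (cartesianProduct (allFin e) (allFin k))) product)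
                                                    (≡.trans (List.length-map _ (cartesianProduct (allFin e) (allFin k))) product))))))
      where
      product : length (cartesianProduct (allFin e) (allFin k)) ≡ e ℕ.* k
      product = ≡.trans (length-cartesianProduct (allFin e) (allFin k))
        (≡.cong₂ ℕ._*_ (List.length-tabulate {n = e} id) (List.length-tabulate {n = k} id))

    Antipodalᶠ : Fin (d ℕ.+ k) → Fin (d ℕ.+ k) → Set
    Antipodalᶠ = Antipodal Functionals (allFin (d ℕ.+ k))

    Opposite : Fin (d ℕ.+ k) → Fin (d ℕ.+ k) → Set
    Opposite x x̄ = ∀ a → a · X x̄ ≈ - (a · X x)

    opposite⁺ : ∀ j → Opposite (positive j) (negative j)
    opposite⁺ j a = trans (value-extra a j) (trans (negative-value a j) (-‿cong (sym (value-unit a (ι j)))))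

    opposite⁻ : ∀ j → Opposite (negative j) (positive j)
    opposite⁻ j a = trans (sym (-‿involutive _)) (-‿cong (sym (opposite⁺ j a)))

    -- A minimum at `x` lies below the value at the opposite of `y`, and a maximum at `y` above the
    -- value at the opposite of `x`; by symmetry about the origin these inequalities contradict each
    -- other. Thus a cross-polytope vertex is antipodal, within the cross-polytope, at most to its
    -- opposite.
    not-antipodal : ∀ {x x̄ y ȳ} → Opposite x x̄ → Opposite y ȳ → ȳ ≢ x → x̄ ≢ y → ¬ Antipodalᶠ x y
    not-antipodal {x} {x̄} {y} {ȳ} oppₓ opp-y ȳ≢x x̄≢y (f , (a , f≈) , f-min , f-max) = <-asym
      (<-resp (f≈ x) (trans (f≈ ȳ) (opp-y a)) (f-min (∈-allFin ȳ) ȳ≢x))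
      (<-resp ≈-refl (-‿involutive _) (neg-mono-< (<-resp (trans (f≈ x̄) (oppₓ a)) (f≈ y) (f-max (∈-allFin x̄) x̄≢y))))

    data Kind : Fin (d ℕ.+ k) → Set where
      pos : ∀ j → Kind (positive j)
      neg : ∀ j → Kind (negative j)
      top : ∀ m → Kind (apex m)

    kind : ∀ x → Kind x
    kind x with view x
    ... | extra j = neg j
    ... | unit i with Fin.splitAt k i in eq
    ...   | inj₁ j = ≡.subst (λ i → Kind (i ↑ˡ k)) (Fin.splitAt⁻¹-↑ˡ eq) (pos j)
    ...   | inj₂ m = ≡.subst (λ i → Kind (i ↑ˡ k)) (Fin.splitAt⁻¹-↑ʳ eq) (top m)

    ∈L₁ : ∀ j → (positive j , negative j) ∈ L
    ∈L₁ j = ∈-++⁺ˡ (∈-map⁺ _ (∈-allFin j))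
    ∈L₃ : ∀ m j → (apex m , positive j) ∈ L
    ∈L₃ m j = ∈-++⁺ʳ L₁ (∈-++⁺ʳ L₂ (∈-++⁺ˡ (∈-map⁺ _ (∈-cartesianProduct⁺ (∈-allFin m) (∈-allFin j)))))
    ∈L₄ : ∀ m j → (apex m , negative j) ∈ L
    ∈L₄ m j = ∈-++⁺ʳ L₁ (∈-++⁺ʳ L₂ (∈-++⁺ʳ L₃ (∈-map⁺ _ (∈-cartesianProduct⁺ (∈-allFin m) (∈-allFin j)))))

    ≢positive : ∀ {i j} → i ≢ j → positive i ≢ positive j
    ≢positive i≢j eq = i≢j (Fin.↑ˡ-injective e _ _ (Fin.↑ˡ-injective k _ _ eq))

    ≢negative : ∀ {i j} → i ≢ j → negative i ≢ negative j
    ≢negative i≢j eq = i≢j (Fin.↑ʳ-injective d _ _ eq)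

    covers : ∀ {x y} → x ≢ y → Antipodalᶠ x y → ∃[ q ] (q ∈ L × (x , y) ≈ˢ q)
    covers {x} {y} x≢y ant with kind x | kind y
    ... | top m | pos j = _ , ∈L₃ m j , inj₁ (refl , refl)
    ... | pos j | top m = _ , ∈L₃ m j , inj₂ (refl , refl)
    ... | top m | neg j = _ , ∈L₄ m j , inj₁ (refl , refl)
    ... | neg j | top m = _ , ∈L₄ m j , inj₂ (refl , refl)
    ... | pos i | pos j = ⊥-elim (not-antipodal {positive i} {negative i} {positive j} {negative j} (opposite⁺ i) (opposite⁺ j) (unit≢extra ∘ ≡.sym) (unit≢extra ∘ ≡.sym) ant)
    ... | neg i | neg j = ⊥-elim (not-antipodal {negative i} {positive i} {negative j} {positive j} (opposite⁻ i) (opposite⁻ j) unit≢extra unit≢extra ant)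
    ... | pos i | neg j with i Fin.≟ j
    ...   | yes refl = _ , ∈L₁ i , inj₁ (refl , refl)
    ...   | no i≢j   = ⊥-elim (not-antipodal {positive i} {negative i} {negative j} {positive j} (opposite⁺ i) (opposite⁻ j) (≢positive (i≢j ∘ ≡.sym)) (≢negative i≢j) ant)
    covers {x} {y} x≢y ant | neg i | pos j with i Fin.≟ j
    ...   | yes refl = _ , ∈L₁ i , inj₂ (refl , refl)
    ...   | no i≢j   = ⊥-elim (not-antipodal {negative i} {positive i} {positive j} {negative j} (opposite⁻ i) (opposite⁺ j) (≢negative (i≢j ∘ ≡.sym)) (≢positive i≢j) ant)
    covers {x} {y} x≢y ant | top m | top m′ with ∈-pairs {i = m} {m′} (λ { refl → x≢y refl })
    ...   | q , q∈ , inj₁ (refl , refl) = _ , ∈-++⁺ʳ L₁ (∈-++⁺ˡ (∈-map⁺ _ q∈)) , inj₁ (refl , refl)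
    ...   | q , q∈ , inj₂ (refl , refl) = _ , ∈-++⁺ʳ L₁ (∈-++⁺ˡ (∈-map⁺ _ q∈)) , inj₂ (refl , refl)

    -- This is the second line of `U` with `e = d - k`: `k` opposite pairs, `e (e - 1) / 2` pairs in
    -- the simplex, and all `2 e k` pairs between the two parts.
    sa-bound : sa lem (𝓒ˢ.X member) ℕ.≤ k ℕ.+ (length (pairs e) ℕ.+ (e ℕ.* k ℕ.+ e ℕ.* k))
    sa-bound = ≡.subst (sa lem X ℕ.≤_) length-L (sa-upper X X-distinct L covers)

-- The order of magnitude, the two estimates, and their quotient.

module Bounds (lem : ExcludedMiddle 0ℓ) (ℝ : Reals) where
  open Reals ℝ hiding (zero) renaming (refl to ≈-refl)
  open OrderedField lem ℝ
  open Geometry ℝ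
  open Estimates ℝ
  open Counting lem ℝ
  open Constructions lem ℝ
  open SetoidReasoning setoid

  stacked : ∀ d k → 2 ℕ.≤ k → k ℕ.< d →
    ∃[ m ] (saValues lem d (d ℕ.+ k) m × 2 ℕ.* m ℕ.+ 2 ℕ.≤ d ℕ.* d ℕ.+ d ℕ.+ 2 ℕ.* k)
  stacked d (suc k′) 2≤k k<d with ℕ.m≤n⇒∃[o]m+o≡n (ℕ.≤-trans (s≤s 2≤k) k<d)
  ... | d₀ , refl = _ , (S.member , refl) , ℕ.≤-trans (ℕ.+-monoˡ-≤ 2 (ℕ.*-monoʳ-≤ 2 S.sa-bound))
          (ℕ.≤-reflexive (≡.trans (regroup (length (pairs S.d)) S.d k′) (≡.cong (λ s → s ℕ.+ S.d ℕ.+ 2 ℕ.* suc k′) (length-pairs S.d))))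
    where
    module S = Stacked d₀ k′ (ℕ.≤-trans (ℕ.n≤1+n k′) (ℕ.<⇒≤ k<d))
    regroup : ∀ l d k′ → 2 ℕ.* (l ℕ.+ (d ℕ.+ k′)) ℕ.+ 2 ≡ 2 ℕ.* l ℕ.+ d ℕ.+ d ℕ.+ 2 ℕ.* suc k′
    regroup = ℕSolver.solve-∀

  crossJoin : ∀ k e → 2 ℕ.≤ k →
    ∃[ m ] (saValues lem (k ℕ.+ e) (k ℕ.+ e ℕ.+ k) m × 2 ℕ.* m ℕ.+ e ℕ.≤ 2 ℕ.* k ℕ.+ 4 ℕ.* (e ℕ.* k) ℕ.+ e ℕ.* e)
  crossJoin (suc k′) e 2≤k = _ , (C.member , refl) , ℕ.≤-trans (ℕ.+-monoˡ-≤ e (ℕ.*-monoʳ-≤ 2 C.sa-bound))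
      (ℕ.≤-reflexive (≡.trans (regroup (length (pairs e)) e (suc k′)) (≡.cong (2 ℕ.* suc k′ ℕ.+ 4 ℕ.* (e ℕ.* suc k′) ℕ.+_) (length-pairs e))))
    where
    module C = CrossJoin k′ e
    regroup : ∀ l e k → 2 ℕ.* (k ℕ.+ (l ℕ.+ (e ℕ.* k ℕ.+ e ℕ.* k))) ℕ.+ e ≡ 2 ℕ.* k ℕ.+ 4 ℕ.* (e ℕ.* k) ℕ.+ (2 ℕ.* l ℕ.+ e)
    regroup = ℕSolver.solve-∀

  minimum-exists : (S : Pred ℕ 0ℓ) → ∀ {n} → S n → ∃[ m ] IsMinimum S m
  minimum-exists S {n} n∈S = search n n ℕ.≤-refl n∈S
    where
    search : ∀ b n → n ℕ.≤ b → S n → ∃[ m ] IsMinimum S m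
    search b n n≤b n∈S with lem {∃[ n′ ] (n′ ℕ.< n × S n′)}
    ... | no ∄n′ = n , n∈S , λ n′ n′∈S → ℕ.≮⇒≥ (λ n′<n → ∄n′ (n′ , n′<n , n′∈S))
    search zero    n n≤b n∈S | yes (n′ , n′<n , _) = contradiction (ℕ.≤-trans n′<n n≤b) λ ()
    search (suc b) n n≤b n∈S | yes (n′ , n′<n , n′∈S) = search b n′ (ℕ.≤-pred (ℕ.≤-trans n′<n n≤b)) n′∈S

  if-elim : ∀ (P : Carrier → Set) b {x y} → (b ≡ true → P x) → (b ≡ false → P y) → P (if b then x else y)
  if-elim P true  t f = t refl
  if-elim P false t f = f refl

  *2-cancel-≤ : ∀ {x y} → 2# * x ≤ 2# * y → x ≤ y
  *2-cancel-≤ = *-cancelˡ-≤ 2# 0<2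

  2*half : ∀ x → 2# * (x / fromℕ 2) ≈ x
  2*half x = begin
    2# * (x * fromℕ 2 ⁻¹)            ≈⟨ *-congʳ fromℕ-2 ⟨
    fromℕ 2 * (x * fromℕ 2 ⁻¹)       ≈⟨ solve 3 (λ t x i → t :* (x :* i) := x :* (t :* i)) ≈-refl (fromℕ 2) x (fromℕ 2 ⁻¹) ⟩
    x * (fromℕ 2 * fromℕ 2 ⁻¹)       ≈⟨ *-congˡ (*-inverseʳ (0<⇒≉ (0<fromℕ-suc 1))) ⟩
    x * 1#                           ≈⟨ *-identityʳ x ⟩
    x                                ∎

  fromℕ-3 : fromℕ 3 ≈ 1# + 2#
  fromℕ-3 = +-congˡ fromℕ-2

  fromℕ-2* : ∀ n → fromℕ (2 ℕ.* n) ≈ 2# * fromℕ n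
  fromℕ-2* n = trans (fromℕ-* 2 n) (*-congʳ fromℕ-2)

  module _ (k e′ : ℕ) (2≤k : 2 ℕ.≤ k) where
    e d : ℕ
    e = suc e′
    d = k ℕ.+ e

    k<d : k ℕ.< d
    k<d = ℕ.m<m+n k ℕ.z<s

    K E′ E D : Carrier
    K  = fromℕ k
    E′ = fromℕ e′
    E  = fromℕ e
    D  = fromℕ d

    0≤K : 0# ≤ K
    0≤K = 0≤fromℕ k
    0≤E′ : 0# ≤ E′
    0≤E′ = 0≤fromℕ e′
    0<E : 0# < E
    0<E = 0<fromℕ-suc e′
    0≤E : 0# ≤ E
    0≤E = <⇒≤ 0<E

    0<K : 0# < K
    0<K = <-≤-trans (0<fromℕ-suc 1) (fromℕ-mono-≤ 2≤k)

    D≈K+E : D ≈ K + E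
    D≈K+E = fromℕ-+ k e

    D-K≈E : D - K ≈ E
    D-K≈E = trans (+-congʳ D≈K+E) (solve 2 (λ K E → (K :+ E) :- K := E) ≈-refl K E)

    ℓ : Carrier
    ℓ = (2# * K + E) * (1# + E)

    0<ℓ : 0# < ℓ
    0<ℓ = 0<-* (0<-+ (0<-* 0<2 0<K) 0≤E) (0<-+ 0<1 0≤E)

    2L≈ℓ : 2# * L d k ≈ ℓ
    2L≈ℓ = begin
      2# * L d k                                  ≈⟨ 2*half _ ⟩
      D * D - K * K + D + K                       ≈⟨ +-congʳ (+-cong (+-congʳ (*-cong D≈K+E D≈K+E)) D≈K+E) ⟩
      (K + E) * (K + E) - K * K + (K + E) + K     ≈⟨ solve 2 (λ K E → (K :+ E) :* (K :+ E) :- K :* K :+ (K :+ E) :+ K := (:2 :* K :+ E) :* (:1 :+ E)) ≈-refl K E ⟩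
      ℓ                                           ∎

    0<L : 0# < L d k
    0<L = *-cancelˡ-< 2# (<⇒≤ 0<2) (<-resp (sym (zeroʳ 2#)) (sym 2L≈ℓ) 0<ℓ)

    fromℕ-ℓ : fromℕ ((k ℕ.+ e ℕ.+ k) ℕ.* suc e) ≈ ℓ
    fromℕ-ℓ = begin
      fromℕ ((k ℕ.+ e ℕ.+ k) ℕ.* suc e)       ≈⟨ fromℕ-* (k ℕ.+ e ℕ.+ k) (suc e) ⟩
      fromℕ (d ℕ.+ k) * (1# + E)              ≈⟨ *-congʳ (trans (fromℕ-+ d k) (+-congʳ D≈K+E)) ⟩
      (K + E + K) * (1# + E)                  ≈⟨ solve 2 (λ K E → (K :+ E :+ K) :* (:1 :+ E) := (:2 :* K :+ E) :* (:1 :+ E)) ≈-refl K E ⟩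
      ℓ                                       ∎

    U₁ U₂ : Carrier
    U₁ = D * (D + 1#) / fromℕ 2 + K - 1#
    U₂ = K + (D - K) * (D + fromℕ 3 * K - 1#) / fromℕ 2

    2U₁ : 2# * U₁ ≈ (K + E) * (K + E + 1#) + 2# * K - 2#
    2U₁ = begin
      2# * (D * (D + 1#) / fromℕ 2 + K - 1#)          ≈⟨ solve 2 (λ h K → :2 :* (h :+ K :- :1) := :2 :* h :+ :2 :* K :- :2) ≈-refl (D * (D + 1#) / fromℕ 2) K ⟩
      2# * (D * (D + 1#) / fromℕ 2) + 2# * K - 2#     ≈⟨ +-congʳ (+-congʳ (trans (2*half _) (*-cong D≈K+E (+-congʳ D≈K+E)))) ⟩
      (K + E) * (K + E + 1#) + 2# * K - 2#            ∎

    2U₂ : 2# * U₂ ≈ 2# * K + E * (E + (2# + 2#) * K - 1#)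
    2U₂ = begin
      2# * U₂                                                           ≈⟨ distribˡ 2# K _ ⟩
      2# * K + 2# * ((D - K) * (D + fromℕ 3 * K - 1#) / fromℕ 2)        ≈⟨ +-congˡ (2*half _) ⟩
      2# * K + (D - K) * (D + fromℕ 3 * K - 1#)                         ≈⟨ +-congˡ (*-cong D-K≈E (+-congʳ (+-cong D≈K+E (*-congʳ fromℕ-3)))) ⟩
      2# * K + E * (K + E + (1# + 2#) * K - 1#)                         ≈⟨ solve 2 (λ K E → :2 :* K :+ E :* (K :+ E :+ (:1 :+ :2) :* K :- :1) := :2 :* K :+ E :* (E :+ (:2 :+ :2) :* K :- :1)) ≈-refl K E ⟩
      2# * K + E * (E + (2# + 2#) * K - 1#)                             ∎

    -- The first line of `U` is in force when `3k ≤ 2d - 2`; with `d = k + e` this gives the sign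
    -- condition on which the quotient bound depends.
    small-k : (k ℕ.≤ᵇ (2 ℕ.* d ℕ.∸ 2) ℕ./ 3) ≡ true → k ℕ.≤ 2 ℕ.* e
    small-k b = ℕ.+-cancelˡ-≤ (2 ℕ.* k) k (2 ℕ.* e) (≡.subst₂ ℕ._≤_ (triple k) (ℕ.*-distribˡ-+ 2 k e)
      (ℕ.≤-trans (ℕ.*-monoˡ-≤ 3 (ℕ.≤ᵇ⇒≤ k ((2 ℕ.* d ℕ.∸ 2) ℕ./ 3) (≡.subst T (≡.sym b) _)))
        (ℕ.≤-trans (ℕ.m/n*n≤m (2 ℕ.* d ℕ.∸ 2) 3) (ℕ.m∸n≤m (2 ℕ.* d) 2))))
      where
      triple : ∀ k → k ℕ.* 3 ≡ 2 ℕ.* k ℕ.+ k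
      triple = ℕSolver.solve-∀

    lower : ∀ {m} → saValues lem d (d ℕ.+ k) m → ℓ ≤ 2# * fromℕ m
    lower {m} (C , refl) = ≤-resp fromℕ-ℓ (fromℕ-2* m) (fromℕ-mono-≤ (sa-lower {k} {e} C))

    upper₁ : ∀ {m} → IsMinimum (saValues lem d (d ℕ.+ k)) m → 2# * fromℕ m ≤ (K + E) * (K + E + 1#) + 2# * K - 2#
    upper₁ {m} (_ , least) with stacked d k 2≤k k<d
    ... | m′ , m′∈S , bound = ≤-resp (trans (+-congʳ (trans (fromℕ-+ (2 ℕ.* m) 2) (+-cong (fromℕ-2* m) fromℕ-2))) (solve 1 (λ x → (x :+ :2) :- :2 := x) ≈-refl (2# * fromℕ m)))
        (+-congʳ (begin
          fromℕ (d ℕ.* d ℕ.+ d ℕ.+ 2 ℕ.* k)       ≈⟨ trans (fromℕ-+ (d ℕ.* d ℕ.+ d) (2 ℕ.* k)) (+-cong (trans (fromℕ-+ (d ℕ.* d) d) (+-congʳ (fromℕ-* d d))) (fromℕ-2* k)) ⟩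
          D * D + D + 2# * K                      ≈⟨ +-congʳ (+-cong (*-cong D≈K+E D≈K+E) D≈K+E) ⟩
          (K + E) * (K + E) + (K + E) + 2# * K    ≈⟨ solve 2 (λ x k → x :* x :+ x :+ k := x :* (x :+ :1) :+ k) ≈-refl (K + E) (2# * K) ⟩
          (K + E) * (K + E + 1#) + 2# * K         ∎))
        (+-monoˡ-≤ (- 2#) (fromℕ-mono-≤ (ℕ.≤-trans (ℕ.+-monoˡ-≤ 2 (ℕ.*-monoʳ-≤ 2 (least m′ m′∈S))) bound)))

    upper₂ : ∀ {m} → IsMinimum (saValues lem d (d ℕ.+ k)) m → 2# * fromℕ m ≤ 2# * K + E * (E + (2# + 2#) * K - 1#)
    upper₂ {m} (_ , least) with crossJoin k e 2≤k
    ... | m′ , m′∈S , bound = ≤-resp (trans (+-congʳ (trans (fromℕ-+ (2 ℕ.* m) e) (+-congʳ (fromℕ-2* m)))) (solve 2 (λ x e → (x :+ e) :- e := x) ≈-refl (2# * fromℕ m) E))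
        (begin
          fromℕ (2 ℕ.* k ℕ.+ 4 ℕ.* (e ℕ.* k) ℕ.+ e ℕ.* e) - E     ≈⟨ +-congʳ (trans (fromℕ-+ (2 ℕ.* k ℕ.+ 4 ℕ.* (e ℕ.* k)) (e ℕ.* e))
                                                                       (+-cong (trans (fromℕ-+ (2 ℕ.* k) (4 ℕ.* (e ℕ.* k))) (+-cong (fromℕ-2* k) (trans (fromℕ-* 4 (e ℕ.* k)) (*-cong fromℕ-4 (fromℕ-* e k))))) (fromℕ-* e e))) ⟩
          2# * K + (2# + 2#) * (E * K) + E * E - E                ≈⟨ solve 2 (λ K E → :2 :* K :+ (:2 :+ :2) :* (E :* K) :+ E :* E :- E := :2 :* K :+ E :* (E :+ (:2 :+ :2) :* K :- :1)) ≈-refl K E ⟩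
          2# * K + E * (E + (2# + 2#) * K - 1#)                   ∎)
        (+-monoˡ-≤ (- E) (fromℕ-mono-≤ (ℕ.≤-trans (ℕ.+-monoˡ-≤ e (ℕ.*-monoʳ-≤ 2 (least m′ m′∈S))) bound)))
      where
      fromℕ-4 : fromℕ 4 ≈ 2# + 2#
      fromℕ-4 = trans (+-congˡ fromℕ-3) (sym (+-assoc 1# 1# 2#))

    minimum : ∃[ m ] IsMinimum (saValues lem d (d ℕ.+ k)) m
    minimum = minimum-exists _ (proj₁ (proj₂ (crossJoin k e 2≤k)))

    theta-lower : ∀ {m} → IsMinimum (saValues lem d (d ℕ.+ k)) m → 2# ⁻¹ * ((D - K) * D) ≤ fromℕ m
    theta-lower {m} (m∈S , _) = *2-cancel-≤ (≤-trans (≤-reflexive (begin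
        2# * (2# ⁻¹ * ((D - K) * D))      ≈⟨ *-assoc _ _ _ ⟨
        2# * 2# ⁻¹ * ((D - K) * D)        ≈⟨ *-cong (*-inverseʳ (0<⇒≉ 0<2)) (*-cong D-K≈E D≈K+E) ⟩
        1# * (E * (K + E))                ≈⟨ *-identityˡ _ ⟩
        E * (K + E)                       ∎))
      (≤-trans (≤-diff (2# * K + E + K * E) (0≤-+ (0≤-+ (*-nonNeg (<⇒≤ 0<2) 0≤K) 0≤E) (*-nonNeg 0≤K 0≤E))
        (solve 2 (λ K E → E :* (K :+ E) :+ (:2 :* K :+ E :+ K :* E) := (:2 :* K :+ E) :* (:1 :+ E)) ≈-refl K E)) (lower m∈S)))

    -- The cross-polytope example alone has the right order for all `k`. Substituting `1# + E′` for
    -- `E` makes the term `2k` visibly at most `2ek`, as `e ≥ 1`.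
    theta-upper : ∀ {m} → IsMinimum (saValues lem d (d ℕ.+ k)) m → fromℕ m ≤ (2# + 2#) * ((D - K) * D)
    theta-upper min = *2-cancel-≤ (≤-trans (upper₂ min)
      (≤-diff (2# * K + (2# + 2#) * (E′ * K) + (2# + 2# + 2# + 1#) * (E * E) + E)
        (0≤-+ (0≤-+ (0≤-+ (*-nonNeg (<⇒≤ 0<2) 0≤K) (*-nonNeg 0≤4 (*-nonNeg 0≤E′ 0≤K))) (*-nonNeg (0≤-+ (0≤-+ 0≤4 (<⇒≤ 0<2)) 0≤1) (*-nonNeg 0≤E 0≤E))) 0≤E)
        (begin
          (2# * K + E * (E + (2# + 2#) * K - 1#)) + (2# * K + (2# + 2#) * (E′ * K) + (2# + 2# + 2# + 1#) * (E * E) + E)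
            ≈⟨ solve 2 (λ K E′ → let E = :1 :+ E′ in
                 (:2 :* K :+ E :* (E :+ (:2 :+ :2) :* K :- :1)) :+ (:2 :* K :+ (:2 :+ :2) :* (E′ :* K) :+ (:2 :+ :2 :+ :2 :+ :1) :* (E :* E) :+ E)
                   := :2 :* ((:2 :+ :2) :* (E :* (K :+ E)))) ≈-refl K E′ ⟩
          2# * ((2# + 2#) * (E * (K + E)))       ≈⟨ *-congˡ (*-congˡ (*-cong D-K≈E D≈K+E)) ⟨
          2# * ((2# + 2#) * ((D - K) * D))       ∎)))
      where
      0≤4 : 0# ≤ 2# + 2#
      0≤4 = 0≤-+ (<⇒≤ 0<2) (<⇒≤ 0<2)

    estimates : ∀ {m} → IsMinimum (saValues lem d (d ℕ.+ k)) m → L d k ≤ fromℕ m × fromℕ m ≤ U d k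
    estimates {m} min = *2-cancel-≤ (≤-trans (≤-reflexive 2L≈ℓ) (lower (proj₁ min)))
      , if-elim (fromℕ m ≤_) (k ℕ.≤ᵇ (2 ℕ.* d ℕ.∸ 2) ℕ./ 3) {U₁} {U₂}
          (λ _ → *2-cancel-≤ (≤-trans (upper₁ min) (≤-reflexive (sym 2U₁))))
          (λ _ → *2-cancel-≤ (≤-trans (upper₂ min) (≤-reflexive (sym 2U₂))))

    ratio≤2 : U d k / L d k ≤ fromℕ 2
    ratio≤2 = /-≤ 0<L (≤-resp ≈-refl (trans (sym 2L≈ℓ) (*-congʳ (sym fromℕ-2)))
        (if-elim (_≤ ℓ) (k ℕ.≤ᵇ (2 ℕ.* d ℕ.∸ 2) ℕ./ 3) {U₁} {U₂} case₁ case₂))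
      where
      case₂ : _ → U₂ ≤ ℓ
      case₂ _ = *2-cancel-≤ (≤-resp (sym 2U₂) ≈-refl
        (≤-diff (2# * K + (1# + 2#) * E + E * E) (0≤-+ (0≤-+ (*-nonNeg (<⇒≤ 0<2) 0≤K) (*-nonNeg (0≤-+ 0≤1 (<⇒≤ 0<2)) 0≤E)) (*-nonNeg 0≤E 0≤E))
          (solve 2 (λ K E → (:2 :* K :+ E :* (E :+ (:2 :+ :2) :* K :- :1)) :+ (:2 :* K :+ (:1 :+ :2) :* E :+ E :* E)
                            := :2 :* ((:2 :* K :+ E) :* (:1 :+ E))) ≈-refl K E)))
      -- In the difference of `2ℓ` and `2U₁` only the term `K * (2# * E - K)` has a doubtful sign,
      -- and `small-k` settles it.
      case₁ : (k ℕ.≤ᵇ (2 ℕ.* d ℕ.∸ 2) ℕ./ 3) ≡ true → U₁ ≤ ℓ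
      case₁ b = *2-cancel-≤ (≤-resp (sym 2U₁) ≈-refl
        (≤-diff (K + E + E * E + 2# + K * (2# * E - K))
          (0≤-+ (0≤-+ (0≤-+ (0≤-+ 0≤K 0≤E) (*-nonNeg 0≤E 0≤E)) (<⇒≤ 0<2)) (*-nonNeg 0≤K (≤⇒0≤ (≤-resp ≈-refl (fromℕ-2* e) (fromℕ-mono-≤ (small-k b))))))
          (solve 2 (λ K E → ((K :+ E) :* (K :+ E :+ :1) :+ :2 :* K :- :2) :+ (K :+ E :+ E :* E :+ :2 :+ K :* (:2 :* E :- K))
                            := :2 :* ((:2 :* K :+ E) :* (:1 :+ E))) ≈-refl K E)))

  -- For d = j² + j and k = j² the ratio equals 2 − 3 / (2j + 1).
  module _ (j′ : ℕ) where
    j k : ℕ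
    -- From `j = 3` on, `2j < j^2`, so by `small-k` the second line of `U` is in force.
    j = 3 ℕ.+ j′
    k = j ℕ.* j

    private
      J = fromℕ j

    2≤k : 2 ℕ.≤ k
    2≤k = ℕ.≤-trans (s≤s (s≤s z≤n)) (ℕ.m≤m*n j j)

    2j<k : 2 ℕ.* j ℕ.< k
    2j<k = ℕ.*-monoˡ-< j {2} {j} (s≤s (s≤s (s≤s z≤n)))

    k+j>k : k ℕ.< k ℕ.+ j
    k+j>k = k<d k (2 ℕ.+ j′) 2≤k

    2U≈ : 2# * U (k ℕ.+ j) k ≈ 2# * fromℕ k + J * (J + (2# + 2#) * fromℕ k - 1#)
    2U≈ = if-elim (λ u → 2# * u ≈ 2# * fromℕ k + J * (J + (2# + 2#) * fromℕ k - 1#))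
      (k ℕ.≤ᵇ (2 ℕ.* (k ℕ.+ j) ℕ.∸ 2) ℕ./ 3) {U₁ k (2 ℕ.+ j′) 2≤k} {U₂ k (2 ℕ.+ j′) 2≤k}
      (λ b → ⊥-elim (ℕ.<⇒≱ 2j<k (small-k k (2 ℕ.+ j′) 2≤k b)))
      (λ _ → 2U₂ k (2 ℕ.+ j′) 2≤k)

    -- For these parameters `2U` is `j (j + 1) (4j - 1)` and `2L` is `j (j + 1) (2j + 1)`. The
    -- positive common factor cancels, and `4j - 1` is `2 (2j + 1) - 3`.
    ratio-deficit : ∀ c → U (k ℕ.+ j) k / L (k ℕ.+ j) k ≤ c → (2# - c) * (2# * J + 1#) ≤ 2# + 1#
    ratio-deficit c U/L≤c = *-cancelˡ-≤ (J * J + J) (0<-+ (0<-* 0<J 0<J) (<⇒≤ 0<J))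
      (≤-diff (c * ℓ′ - (2# * (J * J) + J * (J + (2# + 2#) * (J * J) - 1#))) (≤⇒0≤ 2U≤cℓ)
        (solve 2 (λ J c → (J :* J :+ J) :* ((:2 :- c) :* (:2 :* J :+ :1))
            :+ (c :* ((:2 :* (J :* J) :+ J) :* (:1 :+ J)) :- (:2 :* (J :* J) :+ J :* (J :+ (:2 :+ :2) :* (J :* J) :- :1)))
          := (J :* J :+ J) :* (:2 :+ :1)) ≈-refl J c))
      where
      ℓ′ = (2# * (J * J) + J) * (1# + J)
      K≈J² : fromℕ k ≈ J * J
      K≈J² = fromℕ-* j j
      0<J : 0# < J
      0<J = 0<fromℕ-suc (2 ℕ.+ j′)
      2U≤cℓ : 2# * (J * J) + J * (J + (2# + 2#) * (J * J) - 1#) ≤ c * ℓ′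
      2U≤cℓ = ≤-resp
        (trans 2U≈ (+-cong (*-congˡ K≈J²) (*-congˡ (+-congʳ (+-congˡ (*-congˡ K≈J²))))))
        (begin
          2# * (c * L (k ℕ.+ j) k)      ≈⟨ solve 3 (λ t c l → t :* (c :* l) := c :* (t :* l)) ≈-refl 2# c (L (k ℕ.+ j) k) ⟩
          c * (2# * L (k ℕ.+ j) k)      ≈⟨ *-congˡ (2L≈ℓ k (2 ℕ.+ j′) 2≤k) ⟩
          c * ((2# * fromℕ k + J) * (1# + J)) ≈⟨ *-congˡ (*-congʳ (+-congʳ (*-congˡ K≈J²))) ⟩
          c * ℓ′                        ∎)
        (*-monoˡ-≤ 2# (<⇒≤ 0<2) (/-≤⁻¹ (0<L k (2 ℕ.+ j′) 2≤k) U/L≤c))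

  -- A constant `c < 2` would bound `2j + 1` by `3 / (2 - c)` for all these `j`, against the
  -- Archimedean property.
  sharp : ∀ c → c < fromℕ 2 → ¬ (∀ (d k : ℕ) → 2 ℕ.≤ k → k ℕ.< d → U d k / L d k ≤ c)
  sharp c c<2 ratio≤c with archimedean ((2# + 1#) * (2# - c) ⁻¹)
  ... | n , 3/γ<n = <⇒≱ (<-≤-trans 3<γn γn≤) (ratio-deficit n c (ratio≤c _ _ (2≤k n) (k+j>k n)))
    where
    γ = 2# - c
    0<γ : 0# < γ
    0<γ = <⇒0< (<-resp ≈-refl fromℕ-2 c<2)
    N = fromℕ n
    3<γn : 2# + 1# < γ * N
    3<γn = <-resp (trans (solve 3 (λ g t i → g :* (t :* i) := t :* (g :* i)) ≈-refl γ (2# + 1#) (γ ⁻¹)) (trans (*-congˡ (*-inverseʳ (0<⇒≉ 0<γ))) (*-identityʳ _)))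
      ≈-refl (*-monoˡ-< γ 0<γ 3/γ<n)
    J = fromℕ (3 ℕ.+ n)
    γn≤ : γ * N ≤ γ * (2# * J + 1#)
    γn≤ = *-monoˡ-≤ γ (<⇒≤ 0<γ) (≤-trans (fromℕ-mono-≤ (ℕ.m≤n+m n 3)) (≤-diff (J + 1#) (0≤-+ (0≤fromℕ (3 ℕ.+ n)) 0≤1)
      (solve 1 (λ J → J :+ (J :+ :1) := :2 :* J :+ :1) ≈-refl J)))

  module _ {P : ℕ → ℕ → Set} where
    by-difference : (∀ k e′ → 2 ℕ.≤ k → P (k ℕ.+ suc e′) k) → ∀ d k → 2 ℕ.≤ k → k ℕ.< d → P d k
    by-difference p d k 2≤k k<d with ℕ.m≤n⇒∃[o]m+o≡n k<d
    ... | e′ , eq with ≡.trans (ℕ.+-suc k e′) eq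
    ... | refl = p k e′ 2≤k

proposition2p20 : (lem : ExcludedMiddle 0ℓ) (ℝ : Reals) →
    let open Reals ℝ
        open Estimates ℝ
        open Geometry ℝ
    in
    -- the minimum exists and is Θ((d - k) d)
    (∃[ c₁ ] ∃[ c₂ ] (0# < c₁ × 0# < c₂ ×
      (∀ (d k : ℕ) → 2 ℕ.≤ k → k ℕ.< d →
        ∃[ m ] (IsMinimum (saValues lem d (d ℕ.+ k)) m
          × c₁ * ((fromℕ d - fromℕ k) * fromℕ d) ≤ fromℕ m
          × fromℕ m ≤ c₂ * ((fromℕ d - fromℕ k) * fromℕ d)))))
    ×
    -- L and U are lower and upper estimates of the minimum
    (∀ (d k m : ℕ) → 2 ℕ.≤ k → k ℕ.< d →
      IsMinimum (saValues lem d (d ℕ.+ k)) m →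
      L d k ≤ fromℕ m × fromℕ m ≤ U d k)
    ×
    -- U / L ≤ 2
    (∀ (d k : ℕ) → 2 ℕ.≤ k → k ℕ.< d → U d k / L d k ≤ fromℕ 2)
    ×
    -- no constant below 2 will do
    (∀ c → c < fromℕ 2 →
      ¬ (∀ (d k : ℕ) → 2 ℕ.≤ k → k ℕ.< d → U d k / L d k ≤ c))
proposition2p20 lem ℝ =
    (2# ⁻¹ , 2# + 2# , 0<⁻¹ 0<2 , 0<-+ 0<2 (<⇒≤ 0<2)
      , by-difference (λ k e′ 2≤k → let m , min = minimum k e′ 2≤k in m , min , theta-lower k e′ 2≤k min , theta-upper k e′ 2≤k min))
  , (λ d k m 2≤k k<d → by-difference {λ d k → IsMinimum (saValues lem d (d ℕ.+ k)) m → L d k ≤ fromℕ m × fromℕ m ≤ U d k}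
      (λ k e′ 2≤k → estimates k e′ 2≤k) d k 2≤k k<d)
  , by-difference ratio≤2
  , sharp
  where
  open Reals ℝ
  open OrderedField lem ℝ
  open Geometry ℝ
  open Estimates ℝ
  open Bounds lem ℝ
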